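{- For every $N\ge 1$, the family of lollipop graphs $\{L_{m,n}\}$ on $m+n=N$ vertices (with $m\geq 1$, $n\ge 0$) forms a chain in the poset $\mathcal{S}_N$. In particular, for $m\geq 3$ and $n\geq 0$, $$L_{m-1,n+1}\geq_s L_{m,n}.$$ Hence, the path $P_N$ is the maximal element and the complete graph $K_N$ is the minimal element of the chain.
   Context: All graphs are finite and simple. For $m\ge1$, $n\ge0$ and $N=m+n$, the lollipop graph $L_{m,n}$ is the graph on vertex set $\{1,\dots,N\}$ with all edges between distinct vertices in $\{1,\dots,m\}$ and the edges joining $i$ and $i+1$ for $m\le i\le N-1$. Thus $L_{N,0}=K_N$ is the complete graph and $L_{1,N-1}=P_N$ is the path on $N$ vertices. The chromatic symmetric function of a graph $G$ with vertices $v_1,\dots,v_N$ is $X_G=\sum_{\kappa}x_{\kappa(v_1)}\cdots x_{\kappa(v_N)}$, summed over all proper colorings $\kappa:V(G)\to\{1,2,3,\dots\}$; it is a homogeneous symmetric function of degree $N$ over $\mathbb{Q}$. Let $s_\lambda$ be the Schur symmetric functions; $[s_\lambda]F$ denotes the coefficient of $s_\lambda$ in $F$ expanded in this basis, and $F$ is Schur-positive if $[s_\lambda]F\ge 0$ for all $\lambda$. For connected graphs $G,H$ on $N$ vertices (for which $[s_{(1^N)}]X_G$ and $[s_{(1^N)}]X_H$ are positive), set $$X_s(G,H)=X_G-\frac{[s_{(1^N)}]X_G}{[s_{(1^N)}]X_H}X_H.$$ $\mathcal{S}_N$ is the poset whose elements are the equivalence classes of connected graphs on $N$ vertices under $G\sim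 H\iff X_G=X_H$, ordered by $G\geq_s H$ if and only if $X_s(G,H)$ is Schur-positive. A chain is a set of pairwise comparable elements. -}

module Defs where

open import Data.Fin.Base as Fin using (Fin; zero; suc; toℕ; inject₁)
import Data.Fin.Induction as Fin
import Data.Fin.Properties as Fin
open import Data.Integer.Base using (+_)
open import Data.List.Base
  using (List; []; _∷_; map; foldr; filter; length; concat; concatMap;
         replicate; upTo; allFin; zip; cartesianProductWith)
open import Data.Nat.ListAction using (sum)
open import Data.List.Properties using (≡-dec)
open import Data.List.Relation.Unary.All as All using (All)
open import Data.List.Relation.Unary.Linked using (Linked; linked?)
open import Data.Nat.Base as ℕ using (ℕ; zero; suc; _∸_; _≤_; _<_; _≥_; s≤s)
import Data.Nat.Properties as ℕ
open import Data.Product.Base using (Σ-syntax; ∃-syntax; _×_; _,_; uncurry)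
open import Data.Rational.Base as ℚ using (ℚ; 0ℚ; _/_; _÷_)
open import Data.Sum.Base using (_⊎_; inj₁; inj₂; swap)
open import Data.Vec.Base as Vec using (Vec)
open import Level using (0ℓ)
open import Relation.Binary.Construct.Closure.ReflexiveTransitive
  using (Star; ε; _◅_; _◅◅_; reverse)
open import Relation.Binary.Definitions using (Symmetric; Irreflexive) renaming (Decidable to Decidable₂)
open import Relation.Binary.PropositionalEquality
  using (_≡_; _≢_; refl; sym; trans; cong; subst)
open import Relation.Nullary using (Dec; yes; no; ¬?; _×-dec_; _⊎-dec_; _→-dec_)
open import Relation.Unary using (Pred; _∈_; Decidable)

------------------------------------------------------------------------
-- Graphs

record Graph (N : ℕ) : Set₁ where
  field
    Adj    : Fin N → Fin N → Set
    adj?   : Decidable₂ Adj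
    symm   : Symmetric Adj
    irrefl : Irreflexive _≡_ Adj

Connected : ∀ {N} → Graph N → Set
Connected G = ∀ u v → Star (Graph.Adj G) u v

record ConnectedGraph (N : ℕ) : Set₁ where
  field
    graph     : Graph N
    connected : Connected graph

open ConnectedGraph public

------------------------------------------------------------------------
-- Power series in x₁, x₂, …

-- The list α₁ ∷ … ∷ αₖ ∷ [] stands for the monomial x₁^α₁ ⋯ xₖ^αₖ, and a
-- series is given by its coefficients.  Trailing zeros may be appended to
-- an exponent list without changing the monomial; the series X and schur
-- below respect this.
Series : Set
Series = List ℕ → ℚ

fromℕ : ℕ → ℚ
fromℕ n = + n / 1

words : ∀ k n → List (Vec (Fin k) n)
words k zero    = Vec.[] ∷ []
words k (suc n) = cartesianProductWith Vec._∷_ (allFin k) (words k n)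

-- Exponent list of the product of the variables indexed by the letters.
exponents : ∀ {k} → List (Fin k) → List ℕ
exponents {k} w = map (λ i → length (filter (i Fin.≟_) w)) (allFin k)

exponents? : ∀ {k} (w : List (Fin k)) (α : List ℕ) → Dec (exponents w ≡ α)
exponents? w α = ≡-dec ℕ._≟_ (exponents w) α

------------------------------------------------------------------------
-- Chromatic symmetric function

Proper : ∀ {N k} → Graph N → Vec (Fin k) N → Set
Proper G κ = ∀ u v → Graph.Adj G u v → Vec.lookup κ u ≢ Vec.lookup κ v

proper? : ∀ {N k} (G : Graph N) → Decidable (Proper {N} {k} G)
proper? G κ = Fin.all? λ u → Fin.all? λ v →
  Graph.adj? G u v →-dec ¬? (Vec.lookup κ u Fin.≟ Vec.lookup κ v)

-- A colouring contributing to the coefficient at α₁ ∷ … ∷ αₖ ∷ [] uses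
-- only the first k colours.
X : ∀ {N} → Graph N → Series
X {N} G α = fromℕ (length (filter
  (λ κ → proper? G κ ×-dec exponents? (Vec.toList κ) α)
  (words (length α) N)))

------------------------------------------------------------------------
-- Partitions and Schur functions

_⊢_ : List ℕ → ℕ → Set
μ ⊢ N = Linked _≥_ μ × All (0 <_) μ × sum μ ≡ N

infix 4 _⊢_

_⊢?_ : ∀ μ N → Dec (μ ⊢ N)
μ ⊢? N = linked? ℕ._≥?_ μ ×-dec All.all? (0 ℕ.<?_) μ ×-dec (sum μ ℕ.≟ N)

-- A partition of N has at most N parts, each at most N.
partitions : ℕ → List (List ℕ)
partitions N = filter (_⊢? N)
  (concatMap (λ ℓ → map (λ w → map toℕ (Vec.toList w)) (words (suc N) ℓ))
             (upTo (suc N)))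

-- A tableau is the list of its rows, from the longest (English notation).
fillings : ∀ k → List ℕ → List (List (List (Fin k)))
fillings k []      = [] ∷ []
fillings k (r ∷ μ) =
  cartesianProductWith _∷_ (map Vec.toList (words k r)) (fillings k μ)

-- zip cuts the upper row to the length of the lower one.
ColumnStrict : ∀ {k} → List (Fin k) → List (Fin k) → Set
ColumnStrict upper lower = All (uncurry Fin._<_) (zip upper lower)

Semistandard : ∀ {k} → List (List (Fin k)) → Set
Semistandard T = All (Linked Fin._≤_) T × Linked ColumnStrict T

semistandard? : ∀ {k} → Decidable (Semistandard {k})
semistandard? T =
  All.all? (linked? Fin._≤?_) T ×-dec
  linked? (λ r r′ → All.all? (λ (i , j) → i Fin.<? j) (zip r r′)) T

schur : List ℕ → Series
schur μ α = fromℕ (length (filter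
  (λ T → semistandard? T ×-dec exponents? (concat T) α)
  (fillings (length α) μ)))

sumℚ : List ℚ → ℚ
sumℚ = foldr ℚ._+_ 0ℚ

-- F, homogeneous symmetric of degree N, is the combination of Schur
-- functions with coefficients c.  As the Schur functions are a basis, c is
-- determined by F on the partitions of N; its other values are irrelevant.
SchurExpansion : ℕ → Series → (List ℕ → ℚ) → Set
SchurExpansion N F c =
  ∀ α → F α ≡ sumℚ (map (λ μ → c μ ℚ.* schur μ α) (partitions N))

SchurPositive : ℕ → Series → Set
SchurPositive N F =
  ∃[ c ] SchurExpansion N F c × (∀ μ → μ ⊢ N → 0ℚ ℚ.≤ c μ)

------------------------------------------------------------------------
-- The poset of connected graphs

_∼_ : ∀ {N} → ConnectedGraph N → ConnectedGraph N → Set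
G ∼ H = ∀ α → X (graph G) α ≡ X (graph H) α

1^ : ℕ → List ℕ
1^ N = replicate N 1

-- X_s(G,H), where a and b are the coefficients of s_(1^N) in X_G and X_H.
Xₛ : ∀ {N} → ConnectedGraph N → ConnectedGraph N → (a b : ℚ) → .{{ℚ.NonZero b}} → Series
Xₛ G H a b α = X (graph G) α ℚ.- (a ÷ b) ℚ.* X (graph H) α

record _≥ₛ_ {N} (G H : ConnectedGraph N) : Set where
  field
    cG cH         : List ℕ → ℚ
    expansionG    : SchurExpansion N (X (graph G)) cG
    expansionH    : SchurExpansion N (X (graph H)) cH
    {{nonZero}}   : ℚ.NonZero (cH (1^ N))
    schurPositive : SchurPositive N (Xₛ G H (cG (1^ N)) (cH (1^ N)))

infix 4 _∼_ _≥ₛ_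

IsChain : ∀ {N} → Pred (ConnectedGraph N) 0ℓ → Set₁
IsChain P = ∀ G H → G ∈ P → H ∈ P → G ≥ₛ H ⊎ H ≥ₛ G

IsMaximum : ∀ {N} → Pred (ConnectedGraph N) 0ℓ → ConnectedGraph N → Set₁
IsMaximum P G = G ∈ P × (∀ H → H ∈ P → G ≥ₛ H)

IsMinimum : ∀ {N} → Pred (ConnectedGraph N) 0ℓ → ConnectedGraph N → Set₁
IsMinimum P G = G ∈ P × (∀ H → H ∈ P → H ≥ₛ G)

------------------------------------------------------------------------
-- Lollipops, paths and complete graphs

connectedFromSteps : ∀ {N} (G : Graph (suc N)) →
  (∀ i → Graph.Adj G (inject₁ i) (suc i)) → Connected G
connectedFromSteps G step u v = reverse (Graph.symm G) (from0 u) ◅◅ from0 v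
  where
  from0 : ∀ v → Star (Graph.Adj G) zero v
  from0 = Fin.<-weakInduction (Star (Graph.Adj G) zero) ε
            (λ i p → p ◅◅ (step i ◅ ε))

-- Vertices are numbered from 0: the vertex i of {1,…,N} is the element of Fin N
-- with toℕ equal to i - 1.
module _ {N : ℕ} (m : ℕ) where

  CliqueEdge : Fin N → Fin N → Set
  CliqueEdge u v = u ≢ v × toℕ u < m × toℕ v < m

  TailEdge : Fin N → Fin N → Set
  TailEdge u v = m ≤ suc (toℕ u) × suc (toℕ u) ≡ toℕ v

  LollipopAdj : Fin N → Fin N → Set
  LollipopAdj u v = CliqueEdge u v ⊎ (TailEdge u v ⊎ TailEdge v u)

-- Of m + n ≡ N vertices, the tail length n is determined by m and N.
lollipopGraph : ∀ {N} (m n : ℕ) → .(m ℕ.+ n ≡ N) → Graph N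
lollipopGraph {N} m n _ = record
  { Adj    = LollipopAdj m
  ; adj?   = λ u v → clique? u v ⊎-dec (tail? u v ⊎-dec tail? v u)
  ; symm   = λ { (inj₁ (u≢v , u<m , v<m)) → inj₁ ((λ eq → u≢v (sym eq)) , v<m , u<m)
               ; (inj₂ t) → inj₂ (swap t) }
  ; irrefl = λ { refl (inj₁ (u≢u , _)) → u≢u refl
               ; refl (inj₂ (inj₁ (_ , eq))) → ℕ.1+n≢n eq
               ; refl (inj₂ (inj₂ (_ , eq))) → ℕ.1+n≢n eq }
  }
  where
  clique? : Decidable₂ (CliqueEdge {N} m)
  clique? u v = ¬? (u Fin.≟ v) ×-dec (toℕ u ℕ.<? m) ×-dec (toℕ v ℕ.<? m)

  tail? : Decidable₂ (TailEdge {N} m)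
  tail? u v = (m ℕ.≤? suc (toℕ u)) ×-dec (suc (toℕ u) ℕ.≟ toℕ v)

pathGraph : ∀ N → Graph N
pathGraph N = record
  { Adj    = λ u v → suc (toℕ u) ≡ toℕ v ⊎ suc (toℕ v) ≡ toℕ u
  ; adj?   = λ u v → (suc (toℕ u) ℕ.≟ toℕ v) ⊎-dec (suc (toℕ v) ℕ.≟ toℕ u)
  ; symm   = swap
  ; irrefl = λ { refl (inj₁ eq) → ℕ.1+n≢n eq ; refl (inj₂ eq) → ℕ.1+n≢n eq }
  }

completeGraph : ∀ N → Graph N
completeGraph N = record
  { Adj    = _≢_
  ; adj?   = λ u v → ¬? (u Fin.≟ v)
  ; symm   = λ u≢v eq → u≢v (sym eq)
  ; irrefl = λ eq u≢v → u≢v eq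
  }

private
  toℕ-step : ∀ {N} (i : Fin N) → suc (toℕ (inject₁ i)) ≡ suc (toℕ i)
  toℕ-step i = cong ℕ.suc (Fin.toℕ-inject₁ i)

  inject₁≢suc : ∀ {N} (i : Fin N) → inject₁ i ≢ suc i
  inject₁≢suc i eq = ℕ.1+n≢n (sym (trans (sym (Fin.toℕ-inject₁ i)) (cong toℕ eq)))

lollipop : ∀ {N} (m n : ℕ) → .(m ℕ.+ n ≡ N) → ConnectedGraph N
lollipop {zero}  m n eq = record { graph = lollipopGraph m n eq ; connected = λ () }
lollipop {suc N} m n eq = record
  { graph     = lollipopGraph m n eq
  ; connected = connectedFromSteps (lollipopGraph m n eq) step
  }
  where
  step : ∀ i → LollipopAdj m (inject₁ i) (suc i)
  step i with suc (toℕ i) ℕ.<? m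
  ... | yes i+1<m = inj₁ ( inject₁≢suc i
                         , subst (_< m) (sym (Fin.toℕ-inject₁ i)) (ℕ.<-trans (ℕ.n<1+n _) i+1<m)
                         , i+1<m)
  ... | no  i+1≮m = inj₂ (inj₁ ( subst (m ≤_) (sym (toℕ-step i)) (ℕ.≮⇒≥ i+1≮m)
                               , toℕ-step i))

path : ∀ N → ConnectedGraph N
path zero    = record { graph = pathGraph 0 ; connected = λ () }
path (suc N) = record
  { graph     = pathGraph (suc N)
  ; connected = connectedFromSteps (pathGraph (suc N)) (λ i → inj₁ (toℕ-step i))
  }

complete : ∀ N → ConnectedGraph N
complete zero    = record { graph = completeGraph 0 ; connected = λ () }
complete (suc N) = record
  { graph     = completeGraph (suc N)
  ; connected = connectedFromSteps (completeGraph (suc N)) inject₁≢suc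
  }

-- The classes under _∼_ of the lollipops on N vertices.
Lollipops : ∀ N → Pred (ConnectedGraph N) 0ℓ
Lollipops N G =
  ∃[ m ] ∃[ n ] Σ[ eq ∈ m ℕ.+ n ≡ N ] (1 ≤ m × G ∼ lollipop m n eq)

lengthenTail : ∀ {m n N} → 3 ≤ m → m ℕ.+ n ≡ N → (m ∸ 1) ℕ.+ (n ℕ.+ 1) ≡ N
lengthenTail {suc m} {n} (s≤s _) eq =
  trans (trans (cong (m ℕ.+_) (ℕ.+-comm n 1)) (ℕ.+-suc m n)) eq

{-# OPTIONS --safe #-}
-- Let e_j be the elementary symmetric functions, P_r the chromatic symmetric
-- function of the path on r vertices, and U_{m,r} the sum of x_S x_w over the
-- m-element sets S of colours and the proper colourings w of that path whose
-- first colour is not in S.  The lollipop L_{m,n} has the chromatic symmetric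
-- function (m-1)! U_{m-1,n+1}, and U_{m,r+1} = m e_{m+1} P_r + U_{m+1,r}.  So
-- after division by the coefficient of s_(1^N), consecutive lollipops differ by
-- a nonnegative multiple of D_{m,r} = (m+1) e_m P_r - U_{m,r}.  The recursions
-- P_r = e_r + sum_j (j-1) e_j P_{r-j} and the one for U give
--   D_{m,r} = sum_{j=2}^{r-1} (j-1) e_j D_{m,r-j}
--             + sum_{b=1}^{min(m,r)} b (m+r+1-b) s_(2^b,1^{m+r-2b}),
-- which by the Pieri rule for e_j is a sum of Schur functions other than
-- s_(1^N).  The Pieri rule follows by induction on the number of variables:
-- adding vertical strips nearly commutes with removing horizontal ones.
module Submission where

open import Defs
open import Algebra.Bundles using (CommutativeRing)
import Algebra.Properties.AbelianGroup
import Algebra.Properties.Ring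
import Algebra.Solver.Ring
import Algebra.Solver.Ring.AlmostCommutativeRing as ACR
open import Data.Bool.Base using (true; false; if_then_else_)
open import Data.Fin.Base as Fin using (Fin; zero; suc; inject₁; toℕ)
import Data.Fin.Properties as Fin
open import Data.Integer.Base as ℤ using (ℤ; +_; -[1+_])
import Data.Integer.Properties as ℤ
open import Data.List.Base
  using (List; []; _∷_; _++_; map; concat; concatMap; cartesianProductWith;
         filter; length; lookup; replicate; tabulate; zip; allFin; upTo; applyUpTo)
open import Data.List.Properties
  using (≡-dec; ∷-injective; filter-++; filter-≐; length-++; map-tabulate)
open import Data.List.Relation.Unary.All as All using (All; []; _∷_)
import Data.List.Relation.Unary.All.Properties as All
open import Data.List.Relation.Unary.Linked as Linked using (Linked; []; [-]; _∷_; linked?)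
open import Data.Maybe.Base using (Maybe; just; nothing)
open import Data.Nat.Base as ℕ using (ℕ; zero; suc; z≤n; s≤s; _≤_; _<_; _≥_; _∸_; _<ᵇ_)
open import Data.Nat.Coprimality as Coprime using (1-coprimeTo)
open import Data.Nat.ListAction using (sum)
open import Data.Nat.ListAction.Properties using (sum-++)
import Data.Nat.Properties as ℕ
open import Data.Product.Base using (_,_; _×_; proj₁; proj₂; Σ-syntax)
open import Data.Rational.Base as ℚ using (ℚ; 0ℚ; 1ℚ)
import Data.Rational.Properties as ℚ
open import Data.Sum.Base as Sum using (_⊎_; inj₁; inj₂)
open import Data.Unit.Base using (⊤; tt)
open import Data.Vec.Base as Vec using (Vec)
open import Function.Base using (_∘_; id)
open import Level using (0ℓ)
import Relation.Binary.Reasoning.Setoid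
open import Relation.Binary.PropositionalEquality as ≡ using (_≡_; _≢_)
open import Relation.Nullary using (¬_; Dec; yes; no; contradiction; does; _×-dec_)
open import Relation.Unary using (Pred; Decidable)

-- The coefficient of X at `α` concerns only `length α` colours, so identities are proved in
-- `Poly k` for each number k of variables. A Schur expansion has one coefficient function for all
-- `α`, hence positivity is recorded by a list of shapes that does not depend on k. The new variable
-- of `Poly (suc k)` belongs to the largest letter, whose cells in a tableau form a horizontal
-- strip; this is what brings horizontal strips into the Pieri rule.
--
-- D is the right quantity to expand because U_m satisfies, up to products e_a e_b, a recursion with
-- the same kernel (j-1) e_j as P. In the difference the product e_m e_r has the negative
-- coefficient -m(r-1). It cancels the term j = r of the convolution, since D_{m,0} = m e_m, and
-- therefore the sum over j stops at r-1. The other products pair up as e_a e_b - e_{a+1} e_{b-1}.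
-- For a >= b this is a single Schur function, and for r > m the pairs with a < b cancel against
-- their mirror images.

-- Commutative rings with an equation solver over the integers

module RingKit (R : CommutativeRing 0ℓ 0ℓ) where
  open CommutativeRing R public
    hiding (zero) renaming (Carrier to ⟨R⟩)
  open Relation.Binary.Reasoning.Setoid setoid public
  private
    module RP = Algebra.Properties.Ring ring
    module AP = Algebra.Properties.AbelianGroup +-abelianGroup

  ι : ℕ → ⟨R⟩
  ι zero    = 0#
  ι (suc n) = 1# + ι n

  ι-+ : ∀ m n → ι (m ℕ.+ n) ≈ ι m + ι n
  ι-+ zero    n = sym (+-identityˡ _)
  ι-+ (suc m) n = trans (+-congˡ (ι-+ m n)) (sym (+-assoc _ _ _))

  ι-* : ∀ m n → ι (m ℕ.* n) ≈ ι m * ι n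
  ι-* zero    n = sym (zeroˡ _)
  ι-* (suc m) n = begin
    ι (n ℕ.+ m ℕ.* n)       ≈⟨ ι-+ n (m ℕ.* n) ⟩
    ι n + ι (m ℕ.* n)       ≈⟨ +-cong (sym (*-identityˡ _)) (ι-* m n) ⟩
    1# * ι n + ι m * ι n    ≈⟨ distribʳ _ _ _ ⟨
    (1# + ι m) * ι n        ∎

  private
    -- Unlike `ι`, this sends 1 to `1#` itself, so that `con (+ 1)` in a solver equation denotes
    -- `1#` definitionally. By contrast `ι 1` is `1# + 0#` and has to be entered as
    -- `con (+ 1) :+ con (+ 0)`.
    pos : ℕ → ⟨R⟩
    pos zero          = 0#
    pos (suc zero)    = 1#
    pos (suc (suc n)) = 1# + pos (suc n)

    pos≈ι : ∀ n → pos n ≈ ι n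
    pos≈ι zero          = refl
    pos≈ι (suc zero)    = sym (+-identityʳ _)
    pos≈ι (suc (suc n)) = +-congˡ (pos≈ι (suc n))

    int : ℤ → ⟨R⟩
    int (+ n)    = pos n
    int -[1+ n ] = - pos (suc n)

    int-neg : ∀ i → int (ℤ.- i) ≈ - int i
    int-neg (+ zero)  = sym AP.ε⁻¹≈ε
    int-neg (+ suc n) = refl
    int-neg -[1+ n ]  = sym (AP.⁻¹-involutive _)

    cancel : ∀ x y → (1# + x) + - (1# + y) ≈ x + - y
    cancel x y = begin
      (1# + x) + - (1# + y)     ≈⟨ +-cong (+-comm 1# x) (sym (AP.⁻¹-∙-comm 1# y)) ⟩
      (x + 1#) + (- 1# + - y)   ≈⟨ +-assoc x 1# _ ⟩
      x + (1# + (- 1# + - y))   ≈⟨ +-congˡ (+-assoc 1# (- 1#) (- y)) ⟨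
      x + ((1# + - 1#) + - y)   ≈⟨ +-congˡ (+-congʳ (-‿inverseʳ 1#)) ⟩
      x + (0# + - y)            ≈⟨ +-congˡ (+-identityˡ _) ⟩
      x + - y                   ∎

    int-⊖ : ∀ m n → int (m ℤ.⊖ n) ≈ ι m + - ι n
    int-⊖ m zero = begin
      int (m ℤ.⊖ 0)  ≡⟨ ≡.cong int (ℤ.⊖-≥ {m} {0} z≤n) ⟩
      pos m          ≈⟨ pos≈ι m ⟩
      ι m            ≈⟨ +-identityʳ _ ⟨
      ι m + 0#       ≈⟨ +-congˡ AP.ε⁻¹≈ε ⟨
      ι m + - 0#     ∎
    int-⊖ zero (suc n) = begin
      int (0 ℤ.⊖ suc n)  ≡⟨ ≡.cong int (ℤ.⊖-< {0} {suc n} (s≤s z≤n)) ⟩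
      - pos (suc n)      ≈⟨ -‿cong (pos≈ι (suc n)) ⟩
      - ι (suc n)        ≈⟨ +-identityˡ _ ⟨
      0# + - ι (suc n)   ∎
    int-⊖ (suc m) (suc n) = begin
      int (suc m ℤ.⊖ suc n)  ≡⟨ ≡.cong int (ℤ.[1+m]⊖[1+n]≡m⊖n m n) ⟩
      int (m ℤ.⊖ n)          ≈⟨ int-⊖ m n ⟩
      ι m + - ι n            ≈⟨ cancel _ _ ⟨
      ι (suc m) + - ι (suc n) ∎

    int-+ : ∀ i j → int (i ℤ.+ j) ≈ int i + int j
    int-+ (+ m) (+ n) = trans (pos≈ι (m ℕ.+ n))
      (trans (ι-+ m n) (sym (+-cong (pos≈ι m) (pos≈ι n))))
    int-+ (+ m) -[1+ n ] = trans (int-⊖ m (suc n))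
      (sym (+-cong (pos≈ι m) (-‿cong (pos≈ι (suc n)))))
    int-+ -[1+ m ] (+ n) = trans (int-⊖ n (suc m)) (trans (+-comm _ _)
      (sym (+-cong (-‿cong (pos≈ι (suc m))) (pos≈ι n))))
    int-+ -[1+ m ] -[1+ n ] = begin
      - pos (suc (suc (m ℕ.+ n)))    ≈⟨ -‿cong (pos≈ι (suc (suc (m ℕ.+ n)))) ⟩
      - ι (suc (suc (m ℕ.+ n)))      ≡⟨ ≡.cong (λ h → - ι (suc h)) (ℕ.+-suc m n) ⟨
      - ι (suc m ℕ.+ suc n)          ≈⟨ -‿cong (ι-+ (suc m) (suc n)) ⟩
      - (ι (suc m) + ι (suc n))      ≈⟨ AP.⁻¹-∙-comm _ _ ⟨
      - ι (suc m) + - ι (suc n)      ≈⟨ +-cong (-‿cong (pos≈ι (suc m))) (-‿cong (pos≈ι (suc n))) ⟨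
      - pos (suc m) + - pos (suc n)  ∎

    int-*-pos : ∀ m n → int (+ m ℤ.* + n) ≈ pos m * pos n
    int-*-pos m n = begin
      int (+ m ℤ.* + n)  ≡⟨ ≡.cong int (ℤ.pos-* m n) ⟨
      pos (m ℕ.* n)      ≈⟨ pos≈ι (m ℕ.* n) ⟩
      ι (m ℕ.* n)        ≈⟨ ι-* m n ⟩
      ι m * ι n          ≈⟨ *-cong (pos≈ι m) (pos≈ι n) ⟨
      pos m * pos n      ∎

    int-*-negʳ : ∀ i n → int (i ℤ.* + n) ≈ int i * pos n → int (i ℤ.* ℤ.- + n) ≈ int i * int (ℤ.- + n)
    int-*-negʳ i n eq = begin
      int (i ℤ.* ℤ.- + n)    ≡⟨ ≡.cong int (ℤ.neg-distribʳ-* i (+ n)) ⟨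
      int (ℤ.- (i ℤ.* + n))  ≈⟨ int-neg (i ℤ.* + n) ⟩
      - int (i ℤ.* + n)      ≈⟨ -‿cong eq ⟩
      - (int i * pos n)      ≈⟨ RP.-‿distribʳ-* _ _ ⟩
      int i * - pos n        ≈⟨ *-congˡ (int-neg (+ n)) ⟨
      int i * int (ℤ.- + n)  ∎

    int-*-right : ∀ i n → int (i ℤ.* + n) ≈ int i * pos n
    int-*-right (+ m)    n = int-*-pos m n
    int-*-right -[1+ m ] n = begin
      int (-[1+ m ] ℤ.* + n)           ≡⟨ ≡.cong int (ℤ.neg-distribˡ-* (+ suc m) (+ n)) ⟨
      int (ℤ.- (+ suc m ℤ.* + n))      ≈⟨ int-neg (+ suc m ℤ.* + n) ⟩
      - int (+ suc m ℤ.* + n)          ≈⟨ -‿cong (int-*-pos (suc m) n) ⟩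
      - (pos (suc m) * pos n)          ≈⟨ RP.-‿distribˡ-* _ _ ⟩
      - pos (suc m) * pos n            ∎

    int-* : ∀ i j → int (i ℤ.* j) ≈ int i * int j
    int-* i (+ n)    = int-*-right i n
    int-* i -[1+ n ] = int-*-negʳ i (suc n) (int-*-right i (suc n))

    morphism : ℤ.+-*-rawRing ACR.-Raw-AlmostCommutative⟶ ACR.fromCommutativeRing R
    morphism = record
      { ⟦_⟧ = int ; +-homo = int-+ ; *-homo = int-* ; -‿homo = int-neg
      ; 0-homo = refl ; 1-homo = refl }

    coeff≟ : ∀ i j → Maybe (int i ≈ int j)
    coeff≟ i j with i ℤ.≟ j
    ... | yes eq = just (reflexive (≡.cong int eq))
    ... | no  _  = nothing

  module Solver = Algebra.Solver.Ring ℤ.+-*-rawRing (ACR.fromCommutativeRing R) morphism coeff≟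

-- Finite sums and Iverson brackets

module Sums (R : CommutativeRing 0ℓ 0ℓ) where
  open RingKit R

  ∑ : {A : Set} → List A → (A → ⟨R⟩) → ⟨R⟩
  ∑ []       f = 0#
  ∑ (x ∷ xs) f = f x + ∑ xs f

  module _ {A : Set} where
    ∑-cong-All : ∀ {xs} {f g : A → ⟨R⟩} → All (λ x → f x ≈ g x) xs → ∑ xs f ≈ ∑ xs g
    ∑-cong-All []         = refl
    ∑-cong-All (eq ∷ eqs) = +-cong eq (∑-cong-All eqs)

    ∑-cong : ∀ xs {f g : A → ⟨R⟩} → (∀ x → f x ≈ g x) → ∑ xs f ≈ ∑ xs g
    ∑-cong []       eq = refl
    ∑-cong (x ∷ xs) eq = +-cong (eq x) (∑-cong xs eq)

    ∑-zero : ∀ xs {f : A → ⟨R⟩} → (∀ x → f x ≈ 0#) → ∑ xs f ≈ 0#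
    ∑-zero []       eq = refl
    ∑-zero (x ∷ xs) eq = trans (+-cong (eq x) (∑-zero xs eq)) (+-identityˡ 0#)

    ∑-+ : ∀ xs (f g : A → ⟨R⟩) → ∑ xs (λ x → f x + g x) ≈ ∑ xs f + ∑ xs g
    ∑-+ []       f g = sym (+-identityˡ 0#)
    ∑-+ (x ∷ xs) f g = trans (+-congˡ (∑-+ xs f g))
      (solve 4 (λ a b c d → (a :+ b) :+ (c :+ d) := (a :+ c) :+ (b :+ d)) refl _ _ _ _)
      where open Solver

    ∑-*ˡ : ∀ xs a (f : A → ⟨R⟩) → ∑ xs (λ x → a * f x) ≈ a * ∑ xs f
    ∑-*ˡ []       a f = sym (zeroʳ a)
    ∑-*ˡ (x ∷ xs) a f = trans (+-congˡ (∑-*ˡ xs a f)) (sym (distribˡ _ _ _))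

    ∑-*ʳ : ∀ xs a (f : A → ⟨R⟩) → ∑ xs (λ x → f x * a) ≈ ∑ xs f * a
    ∑-*ʳ xs a f = trans (∑-cong xs λ x → *-comm (f x) a) (trans (∑-*ˡ xs a f) (*-comm a _))

    ∑-neg : ∀ xs (f : A → ⟨R⟩) → ∑ xs (λ x → - f x) ≈ - ∑ xs f
    ∑-neg []       f = solve 0 (con (+ 0) := :- con (+ 0)) refl
      where open Solver
    ∑-neg (x ∷ xs) f = trans (+-congˡ (∑-neg xs f))
      (solve 2 (λ a b → :- a :+ :- b := :- (a :+ b)) refl _ _)
      where open Solver

    ∑-++ : ∀ xs ys (f : A → ⟨R⟩) → ∑ (xs ++ ys) f ≈ ∑ xs f + ∑ ys f
    ∑-++ []       ys f = sym (+-identityˡ _)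
    ∑-++ (x ∷ xs) ys f = trans (+-congˡ (∑-++ xs ys f)) (sym (+-assoc _ _ _))

  module _ {A B : Set} where
    ∑-map : ∀ xs (h : A → B) (f : B → ⟨R⟩) → ∑ (map h xs) f ≈ ∑ xs (f ∘ h)
    ∑-map []       h f = refl
    ∑-map (x ∷ xs) h f = +-congˡ (∑-map xs h f)

    ∑-concatMap : ∀ xs (h : A → List B) (f : B → ⟨R⟩) →
                  ∑ (concatMap h xs) f ≈ ∑ xs (λ x → ∑ (h x) f)
    ∑-concatMap []       h f = refl
    ∑-concatMap (x ∷ xs) h f =
      trans (∑-++ (h x) (concatMap h xs) f) (+-congˡ (∑-concatMap xs h f))

    ∑-swap : ∀ xs ys (f : A → B → ⟨R⟩) →
             ∑ xs (λ x → ∑ ys (f x)) ≈ ∑ ys (λ y → ∑ xs (λ x → f x y))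
    ∑-swap []       ys f = sym (∑-zero ys λ _ → refl)
    ∑-swap (x ∷ xs) ys f =
      trans (+-congˡ (∑-swap xs ys f)) (sym (∑-+ ys (f x) _))

  ∑-product : ∀ {A B C : Set} (h : A → B → C) xs ys (f : C → ⟨R⟩) →
              ∑ (cartesianProductWith h xs ys) f ≈ ∑ xs (λ x → ∑ ys (λ y → f (h x y)))
  ∑-product h []       ys f = refl
  ∑-product h (x ∷ xs) ys f =
    trans (∑-++ (map (h x) ys) _ f) (+-cong (∑-map ys (h x) f) (∑-product h xs ys f))

  ∑-allFin : ∀ {k} (f : Fin (suc k) → ⟨R⟩) →
             ∑ (allFin (suc k)) f ≈ f zero + ∑ (allFin k) (f ∘ suc)
  ∑-allFin {k} f = +-congˡ (trans
    (reflexive (≡.cong (λ xs → ∑ xs f) (≡.sym (map-tabulate id suc))))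
    (∑-map (allFin k) suc f))

  -- The Iverson bracket. It turns filters into factors, so that counts become sums whose order can
  -- be exchanged.
  [_] : ∀ {P : Set} → Dec P → ⟨R⟩
  [ d ] = if does d then 1# else 0#

  []-yes : ∀ {P : Set} (d : Dec P) → P → [ d ] ≈ 1#
  []-yes (yes _) p = refl
  []-yes (no ¬p) p with () ← ¬p p

  []-no : ∀ {P : Set} (d : Dec P) → ¬ P → [ d ] ≈ 0#
  []-no (no _)  ¬p = refl
  []-no (yes p) ¬p with () ← ¬p p

  []-cong : ∀ {P Q : Set} (d : Dec P) (e : Dec Q) → (P → Q) → (Q → P) → [ d ] ≈ [ e ]
  []-cong (yes p) e f g = sym ([]-yes e (f p))
  []-cong (no ¬p) e f g = sym ([]-no e (¬p ∘ g))

  []-× : ∀ {P Q S : Set} (d : Dec P) (e : Dec Q) (c : Dec S) → (S → P × Q) → (P → Q → S) → [ c ] ≈ [ d ] * [ e ]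
  []-× (no ¬p) e       c f g = trans ([]-no c λ s → let p , _ = f s in ¬p p) (sym (zeroˡ _))
  []-× (yes p) (no ¬q) c f g = trans ([]-no c λ s → let _ , q = f s in ¬q q) (sym (zeroʳ _))
  []-× (yes p) (yes q) c f g = trans ([]-yes c (g p q)) (sym (*-identityˡ _))

-- Formal power series in one variable

module PowerSeries (R : CommutativeRing 0ℓ 0ℓ) where
  open RingKit R

  -- The Cauchy product, peeled at the left factor; `⊛-suc` peels it at the right one.
  _⊛_ : (ℕ → ⟨R⟩) → (ℕ → ⟨R⟩) → ℕ → ⟨R⟩
  (f ⊛ g) zero    = f 0 * g 0
  (f ⊛ g) (suc n) = f 0 * g (suc n) + ((f ∘ suc) ⊛ g) n

  infixl 7 _⊛_

  const : ⟨R⟩ → ℕ → ⟨R⟩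
  const a zero    = a
  const a (suc n) = 0#

  open Solver

  ⊛-cong : ∀ {f f′ g g′} → (∀ n → f n ≈ f′ n) → (∀ n → g n ≈ g′ n) → ∀ n → (f ⊛ g) n ≈ (f′ ⊛ g′) n
  ⊛-cong p q zero    = *-cong (p 0) (q 0)
  ⊛-cong p q (suc n) = +-cong (*-cong (p 0) (q (suc n))) (⊛-cong (p ∘ suc) q n)

  ⊛-zeroˡ : ∀ {f} g → (∀ n → f n ≈ 0#) → ∀ n → (f ⊛ g) n ≈ 0#
  ⊛-zeroˡ g p zero    = trans (*-congʳ (p 0)) (zeroˡ _)
  ⊛-zeroˡ g p (suc n) = trans (+-cong (trans (*-congʳ (p 0)) (zeroˡ _)) (⊛-zeroˡ g (p ∘ suc) n)) (+-identityˡ 0#)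

  ⊛-distribʳ : ∀ h f g n → ((λ i → f i + g i) ⊛ h) n ≈ (f ⊛ h) n + (g ⊛ h) n
  ⊛-distribʳ h f g zero    = distribʳ _ _ _
  ⊛-distribʳ h f g (suc n) = trans (+-congˡ (⊛-distribʳ h (f ∘ suc) (g ∘ suc) n))
    (solve 5 (λ a b c x y → (a :+ b) :* c :+ (x :+ y) := (a :* c :+ x) :+ (b :* c :+ y)) refl _ _ _ _ _)

  ⊛-scaleˡ : ∀ a f g n → ((λ i → a * f i) ⊛ g) n ≈ a * (f ⊛ g) n
  ⊛-scaleˡ a f g zero    = *-assoc _ _ _
  ⊛-scaleˡ a f g (suc n) = trans (+-congˡ (⊛-scaleˡ a (f ∘ suc) g n))
    (solve 4 (λ a b c x → a :* b :* c :+ a :* x := a :* (b :* c :+ x)) refl _ _ _ _)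

  ⊛-suc : ∀ f g n → (f ⊛ g) (suc n) ≈ f (suc n) * g 0 + (f ⊛ (g ∘ suc)) n
  ⊛-suc f g zero    = +-comm _ _
  ⊛-suc f g (suc n) = trans (+-congˡ (⊛-suc (f ∘ suc) g n))
    (solve 3 (λ a b c → a :+ (b :+ c) := b :+ (a :+ c)) refl _ _ _)

  ⊛-comm : ∀ f g n → (f ⊛ g) n ≈ (g ⊛ f) n
  ⊛-comm f g zero    = *-comm _ _
  ⊛-comm f g (suc n) = trans (+-cong (*-comm _ _) (⊛-comm (f ∘ suc) g n)) (sym (⊛-suc g f n))

  ⊛-assoc : ∀ f g h n → ((f ⊛ g) ⊛ h) n ≈ (f ⊛ (g ⊛ h)) n
  ⊛-assoc f g h zero    = *-assoc _ _ _
  ⊛-assoc f g h (suc n) = begin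
    f 0 * g 0 * h (suc n) + ((λ i → f 0 * g (suc i) + (f⁺ ⊛ g) i) ⊛ h) n
      ≈⟨ +-congˡ (trans (⊛-distribʳ h (λ i → f 0 * g⁺ i) (f⁺ ⊛ g) n)
           (+-cong (⊛-scaleˡ (f 0) g⁺ h n) (⊛-assoc f⁺ g h n))) ⟩
    f 0 * g 0 * h (suc n) + (f 0 * (g⁺ ⊛ h) n + (f⁺ ⊛ (g ⊛ h)) n)
      ≈⟨ solve 5 (λ a b c x y → a :* b :* c :+ (a :* x :+ y) := a :* (b :* c :+ x) :+ y) refl _ _ _ _ _ ⟩
    f 0 * (g 0 * h (suc n) + (g⁺ ⊛ h) n) + (f⁺ ⊛ (g ⊛ h)) n
      ∎
    where
    f⁺ = f ∘ suc
    g⁺ = g ∘ suc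

  const-⊛ : ∀ a g n → (const a ⊛ g) n ≈ a * g n
  const-⊛ a g zero    = refl
  const-⊛ a g (suc n) = trans (+-congˡ (⊛-zeroˡ g (λ _ → refl) n)) (+-identityʳ _)

  ⊛-identityˡ : ∀ g n → (const 1# ⊛ g) n ≈ g n
  ⊛-identityˡ g n = trans (const-⊛ 1# g n) (*-identityˡ _)

  ring⟦⟧ : CommutativeRing 0ℓ 0ℓ
  ring⟦⟧ = record
    { Carrier = ℕ → ⟨R⟩
    ; _≈_     = λ f g → ∀ n → f n ≈ g n
    ; _+_     = λ f g n → f n + g n
    ; _*_     = _⊛_
    ; -_      = λ f n → - f n
    ; 0#      = λ _ → 0#
    ; 1#      = const 1#
    ; isCommutativeRing = record
      { isRing = record
        { +-isAbelianGroup = record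
          { isGroup = record
            { isMonoid = record
              { isSemigroup = record
                { isMagma = record
                  { isEquivalence = record
                    { refl  = λ _ → refl
                    ; sym   = λ p n → sym (p n)
                    ; trans = λ p q n → trans (p n) (q n)
                    }
                  ; ∙-cong = λ p q n → +-cong (p n) (q n)
                  }
                ; assoc = λ f g h n → +-assoc (f n) (g n) (h n)
                }
              ; identity = (λ f n → +-identityˡ (f n)) , (λ f n → +-identityʳ (f n))
              }
            ; inverse = (λ f n → -‿inverseˡ (f n)) , (λ f n → -‿inverseʳ (f n))
            ; ⁻¹-cong = λ p n → -‿cong (p n)
            }
          ; comm = λ f g n → +-comm (f n) (g n)
          }
        ; *-cong     = ⊛-cong
        ; *-assoc    = ⊛-assoc
        ; *-identity = ⊛-identityˡ , λ f n → trans (⊛-comm f (const 1#) n) (⊛-identityˡ f n)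
        ; distrib    = (λ f g h n → trans (⊛-comm f _ n) (trans (⊛-distribʳ f g h n)
                         (+-cong (⊛-comm g f n) (⊛-comm h f n))))
                     , (λ f g h n → ⊛-distribʳ f g h n)
        }
      ; *-comm = ⊛-comm
      }
    }

-- Elementary symmetric functions and choices of distinct letters

module Elementary (R : CommutativeRing 0ℓ 0ℓ) where
  open RingKit R
  open Sums R
  open PowerSeries R
  open Solver

  e : ∀ {k} → ℕ → (Fin k → ⟨R⟩) → ⟨R⟩
  e         zero    y = 1#
  e {zero}  (suc j) y = 0#
  e {suc k} (suc j) y = e (suc j) (y ∘ suc) + y zero * e j (y ∘ suc)

  e-cong : ∀ {k} j {y z : Fin k → ⟨R⟩} → (∀ i → y i ≈ z i) → e j y ≈ e j z
  e-cong         zero    p = refl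
  e-cong {zero}  (suc j) p = refl
  e-cong {suc k} (suc j) p =
    +-cong (e-cong (suc j) (p ∘ suc)) (*-cong (p zero) (e-cong j (p ∘ suc)))

  -- `e` peels off the first variable, but the variable that `Poly (suc k)` adds is the last one.
  e-top : ∀ {k} j (y : Fin (suc k) → ⟨R⟩) →
          e (suc j) y ≈ e (suc j) (y ∘ inject₁) + y (Fin.fromℕ k) * e j (y ∘ inject₁)
  e-top {zero}  zero    y = refl
  e-top {zero}  (suc j) y = refl
  e-top {suc k} zero    y = trans (+-congʳ (e-top 0 (y ∘ suc)))
    (solve 3 (λ a b c → (a :+ b :* con (+ 1)) :+ c :* con (+ 1) := (a :+ c :* con (+ 1)) :+ b :* con (+ 1)) refl _ _ _)
  e-top {suc k} (suc j) y = trans (+-cong (e-top (suc j) (y ∘ suc)) (*-congˡ (e-top j (y ∘ suc))))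
    (solve 5 (λ a b c d f → (a :+ b :* c) :+ d :* (c :+ b :* f) := (a :+ d :* c) :+ b :* (c :+ d :* f)) refl _ _ _ _ _)

  -- Setting a variable to zero stands for forbidding its letter, without a change of the type
  -- `Fin k`.
  kill : ∀ {k} → Fin k → (Fin k → ⟨R⟩) → Fin k → ⟨R⟩
  kill zero    y zero    = 0#
  kill zero    y (suc d) = y (suc d)
  kill (suc c) y zero    = y zero
  kill (suc c) y (suc d) = kill c (y ∘ suc) d

  kill-comm : ∀ {k} c d (y : Fin k → ⟨R⟩) i → kill d (kill c y) i ≈ kill c (kill d y) i
  kill-comm zero    zero    y i       = refl
  kill-comm zero    (suc d) y zero    = refl
  kill-comm zero    (suc d) y (suc i) = refl
  kill-comm (suc c) zero    y zero    = refl
  kill-comm (suc c) zero    y (suc i) = refl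
  kill-comm (suc c) (suc d) y zero    = refl
  kill-comm (suc c) (suc d) y (suc i) = kill-comm c d (y ∘ suc) i

  -- Both sides weigh an ordered choice of two different letters, with weight 0 if the letters
  -- agree.
  kill-swap : ∀ {k} c d (y : Fin k → ⟨R⟩) → y c * kill c y d ≈ y d * kill d y c
  kill-swap zero    zero    y = refl
  kill-swap zero    (suc d) y = *-comm _ _
  kill-swap (suc c) zero    y = *-comm _ _
  kill-swap (suc c) (suc d) y = kill-swap c d (y ∘ suc)

  kill-sum : ∀ {k} c (y a : Fin k → ⟨R⟩) →
    ∑ (allFin k) (λ d → kill c y d * a d) + y c * a c ≈ ∑ (allFin k) (λ d → y d * a d)
  kill-sum {suc k} zero y a = trans (+-congʳ (∑-allFin {k} (λ d → kill zero y d * a d))) (trans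
    (solve 3 (λ p s t → (con (+ 0) :* p :+ s) :+ t := t :+ s) refl (a zero) _ _)
    (sym (∑-allFin {k} (λ d → y d * a d))))
  kill-sum {suc k} (suc c) y a = trans (+-congʳ (∑-allFin {k} (λ d → kill (suc c) y d * a d))) (trans (+-assoc _ _ _)
    (trans (+-congˡ (kill-sum c (y ∘ suc) (a ∘ suc))) (sym (∑-allFin {k} (λ d → y d * a d)))))

  e-kill : ∀ {k} c j (y : Fin k → ⟨R⟩) → e (suc j) y ≈ e (suc j) (kill c y) + y c * e j (kill c y)
  e-kill zero zero    y = +-congʳ
    (solve 1 (λ a → a := a :+ con (+ 0) :* con (+ 1)) refl _)
  e-kill zero (suc j) y = +-cong
    (solve 2 (λ a b → a := a :+ con (+ 0) :* b) refl _ _)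
    (*-congˡ (solve 2 (λ a b → a := a :+ con (+ 0) :* b) refl _ _))
  e-kill (suc c) zero    y = trans (+-congʳ (e-kill c 0 (y ∘ suc)))
    (solve 3 (λ a b d → (a :+ b :* con (+ 1)) :+ d :* con (+ 1) := (a :+ d :* con (+ 1)) :+ b :* con (+ 1)) refl _ _ _)
  e-kill (suc c) (suc j) y = trans (+-cong (e-kill c (suc j) (y ∘ suc)) (*-congˡ (e-kill c j (y ∘ suc))))
    (solve 5 (λ a b p d f → (a :+ b :* p) :+ d :* (p :+ b :* f) := (a :+ d :* p) :+ b :* (p :+ d :* f)) refl _ _ _ _ _)

  -- Every set of `suc j` letters arises once for each of its elements `c`. This is Euler's identity
  -- for a homogeneous polynomial, as `e j (kill c y)` is the derivative of `e (suc j)` in the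
  -- variable `c`.
  euler : ∀ {k} j (y : Fin k → ⟨R⟩) →
    ∑ (allFin k) (λ c → y c * e j (kill c y)) ≈ ι (suc j) * e (suc j) y
  euler {zero}  j y = sym (zeroʳ _)
  euler {suc k} zero y = begin
    ∑ (allFin (suc k)) (λ c → y c * 1#)
      ≈⟨ ∑-allFin {k} (λ c → y c * 1#) ⟩
    y zero * 1# + ∑ (allFin k) (λ c → y (suc c) * 1#)
      ≈⟨ +-congˡ (euler 0 (y ∘ suc)) ⟩
    y zero * 1# + ι 1 * e 1 (y ∘ suc)
      ≈⟨ solve 2 (λ a b → a :* con (+ 1) :+ (con (+ 1) :+ con (+ 0)) :* b := (con (+ 1) :+ con (+ 0)) :*
        (b :+ a :* con (+ 1))) refl _ _ ⟩
    ι 1 * e 1 y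
      ∎
  euler {suc k} (suc j) y = begin
    ∑ (allFin (suc k)) (λ c → y c * e (suc j) (kill c y))
      ≈⟨ ∑-allFin {k} (λ c → y c * e (suc j) (kill c y)) ⟩
    y zero * (e (suc j) y⁺ + 0# * e j y⁺) +
    ∑ (allFin k) (λ c → y⁺ c * (e (suc j) (kill c y⁺) + y zero * e j (kill c y⁺)))
      ≈⟨ +-congˡ (trans (∑-cong (allFin k) λ c →
           solve 4 (λ a b c d → a :* (b :+ c :* d) := a :* b :+ c :* (a :* d)) refl _ _ _ _)
           (trans (∑-+ (allFin k) _ _)
             (+-cong (euler (suc j) y⁺) (trans (∑-*ˡ (allFin k) _ _) (*-congˡ (euler j y⁺)))))) ⟩
    y zero * (e (suc j) y⁺ + 0# * e j y⁺) +
    (ι (suc (suc j)) * e (suc (suc j)) y⁺ + y zero * (ι (suc j) * e (suc j) y⁺))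
      ≈⟨ solve 5 (λ a b c d n → a :* (b :+ con (+ 0) :* c) :+ ((con (+ 1) :+ n) :* d :+ a :* (n :* b))
           := (con (+ 1) :+ n) :* (d :+ a :* b)) refl _ _ _ _ _ ⟩
    ι (suc (suc j)) * e (suc (suc j)) y
      ∎
    where y⁺ = y ∘ suc

  -- Killing the letter chosen first keeps the later ones distinct from it.
  distinct : ∀ {k} → ℕ → (y q : Fin k → ⟨R⟩) → ⟨R⟩
  distinct {k} zero    y q = ∑ (allFin k) (λ c → y c * q c)
  distinct {k} (suc m) y q = ∑ (allFin k) (λ c → y c * distinct m (kill c y) q)

  -- `kill-swap` moves the letter `c` chosen first behind the last letter `d`; then `euler` counts
  -- which element of the remaining set was `c`. The factorial counts the orders of the `m` letters
  -- other than `d`.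
  distinct-e : ∀ {k} m (y q : Fin k → ⟨R⟩) →
    distinct m y q ≈ ι (m ℕ.!) * ∑ (allFin k) (λ d → y d * q d * e m (kill d y))
  distinct-e {k} zero y q = begin
    ∑ (allFin k) (λ c → y c * q c)              ≈⟨ ∑-cong (allFin k) (λ c → *-identityʳ _) ⟨
    ∑ (allFin k) (λ c → y c * q c * 1#)         ≈⟨ solve 1 (λ a → a := (con (+ 1) :+ con (+ 0)) :* a) refl _ ⟩
    ι 1 * ∑ (allFin k) (λ c → y c * q c * 1#)   ∎
  distinct-e {k} (suc m) y q = begin
    ∑ (allFin k) (λ c → y c * distinct m (kill c y) q)
      ≈⟨ ∑-cong (allFin k) (λ c → trans (*-congˡ (distinct-e m (kill c y) q))
           (trans (solve 3 (λ a b c → a :* (b :* c) := b :* (a :* c)) refl _ _ _)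
                  (*-congˡ (sym (∑-*ˡ (allFin k) _ _))))) ⟩
    ∑ (allFin k) (λ c → ι (m ℕ.!) * ∑ (allFin k) (λ d → y c * (kill c y d * q d * e m (kill d (kill c y)))))
      ≈⟨ trans (∑-*ˡ (allFin k) _ _) (*-congˡ (∑-swap (allFin k) (allFin k) _)) ⟩
    ι (m ℕ.!) * ∑ (allFin k) (λ d → ∑ (allFin k) (λ c → y c * (kill c y d * q d * e m (kill d (kill c y)))))
      ≈⟨ *-congˡ (∑-cong (allFin k) λ d → trans (∑-cong (allFin k) λ c → begin
           y c * (kill c y d * q d * e m (kill d (kill c y)))
             ≈⟨ solve 4 (λ a b c d → a :* (b :* c :* d) := a :* b :* (c :* d)) refl _ _ _ _ ⟩
           y c * kill c y d * (q d * e m (kill d (kill c y)))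
             ≈⟨ *-cong (kill-swap c d y) (*-congˡ (e-cong m (kill-comm c d y))) ⟩
           y d * kill d y c * (q d * e m (kill c (kill d y)))
             ≈⟨ solve 4 (λ a b c d → a :* b :* (c :* d) := a :* c :* (b :* d)) refl _ _ _ _ ⟩
           y d * q d * (kill d y c * e m (kill c (kill d y)))
             ∎)
         (trans (∑-*ˡ (allFin k) _ _) (*-congˡ (euler m (kill d y))))) ⟩
    ι (m ℕ.!) * ∑ (allFin k) (λ d → y d * q d * (ι (suc m) * e (suc m) (kill d y)))
      ≈⟨ *-congˡ (trans (∑-cong (allFin k) λ d →
           solve 3 (λ a b c → a :* (b :* c) := b :* (a :* c)) refl _ _ _) (∑-*ˡ (allFin k) _ _)) ⟩
    ι (m ℕ.!) * (ι (suc m) * ∑ (allFin k) (λ d → y d * q d * e (suc m) (kill d y)))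
      ≈⟨ trans (solve 3 (λ a b c → a :* (b :* c) := b :* a :* c) refl _ _ _)
           (*-congʳ (sym (ι-* (suc m) (m ℕ.!)))) ⟩
    ι (suc m ℕ.!) * ∑ (allFin k) (λ d → y d * q d * e (suc m) (kill d y))
      ∎

-- Sets with walks: the recursions for U and D

module Walks (R : CommutativeRing 0ℓ 0ℓ) (k : ℕ) (x : Fin k → CommutativeRing.Carrier R) where
  open RingKit R
  open Sums R
  open PowerSeries R
  open Elementary R
  open Solver

  -- `q r c` sums over the proper colourings of a path on `r` vertices hung onto a vertex of colour
  -- `c`, which itself carries no weight.
  q : ℕ → Fin k → ⟨R⟩
  q zero    c = 1#
  q (suc r) c = ∑ (allFin k) (λ d → kill c x d * q r d)

  ε : ℕ → ⟨R⟩
  ε j = e j x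

  -- A set of m letters together with a walk on suc r letters that does not start
  -- in it.  In particular U 0 r is the series of the path on r vertices.
  U : ℕ → ℕ → ⟨R⟩
  U m zero    = ε m
  U m (suc r) = ∑ (allFin k) (λ d → x d * q r d * e m (kill d x))

  -- Move the first letter `d` of the walk into the set. This gives a set of `suc m` letters with
  -- `d` marked and a shorter walk that does not start with the mark. For a given set and nonempty
  -- walk all `suc m` marks are possible if the walk starts outside the set, and all but one if it
  -- starts inside: `m` for every pair, and one more for the pairs counted by `U (suc m) r`.
  U-suc : ∀ m r → U m (suc r) ≈ ι m * ε (suc m) * U 0 r + U (suc m) r
  U-suc m zero = begin
    ∑ (allFin k) (λ d → x d * 1# * e m (kill d x))
      ≈⟨ ∑-cong (allFin k) (λ d → *-congʳ (*-identityʳ _)) ⟩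
    ∑ (allFin k) (λ d → x d * e m (kill d x))
      ≈⟨ euler m x ⟩
    ι (suc m) * ε (suc m)
      ≈⟨ solve 2 (λ n a → (con (+ 1) :+ n) :* a := n :* a :* con (+ 1) :+ a) refl _ _ ⟩
    ι m * ε (suc m) * 1# + ε (suc m)
      ∎
  U-suc m (suc r) = begin
    A
      -- `S * ε (suc m)` counts all pairs of a set and a walk; with it added, both sides can be
      -- compared letter by letter without subtraction.
      ≈⟨ solve 2 (λ a b → a := (a :+ b) :- b) refl _ _ ⟩
    (A + S * ε (suc m)) - S * ε (suc m)
      ≈⟨ +-congʳ sums ⟩
    (ι (suc m) * ε (suc m) * S + B) - S * ε (suc m)
      ≈⟨ solve 4 (λ n a s b → ((con (+ 1) :+ n) :* a :* s :+ b) :- s :* a := n :* a :* s :+ b) refl _ _ _ _ ⟩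
    ι m * ε (suc m) * S + B
      ∎
    where
    A = U m (suc (suc r))
    B = U (suc m) (suc r)
    S = U 0 (suc r)

    S-kill : ∀ d → q (suc r) d + x d * q r d ≈ S
    S-kill d = trans (kill-sum d x (q r)) (∑-cong (allFin k) λ c → sym (*-identityʳ _))

    pointwise : ∀ d →
      x d * q (suc r) d * e m (kill d x) + x d * q r d * 1# * ε (suc m) ≈
      x d * e m (kill d x) * S + x d * q r d * e (suc m) (kill d x)
    pointwise d = begin
      x d * q (suc r) d * e m (kill d x) + x d * q r d * 1# * ε (suc m)
        ≈⟨ +-congˡ (*-congˡ (e-kill d m x)) ⟩
      x d * q (suc r) d * e m (kill d x) + x d * q r d * 1# * (e (suc m) (kill d x) + x d * e m (kill d x))
        ≈⟨ solve 5 (λ x q′ q a b → x :* q′ :* a :+ x :* q :* con (+ 1) :* (b :+ x :* a)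
             := x :* a :* (q′ :+ x :* q) :+ x :* q :* b) refl _ _ _ _ _ ⟩
      x d * e m (kill d x) * (q (suc r) d + x d * q r d) + x d * q r d * e (suc m) (kill d x)
        ≈⟨ +-congʳ (*-congˡ (S-kill d)) ⟩
      x d * e m (kill d x) * S + x d * q r d * e (suc m) (kill d x)
        ∎

    sums : A + S * ε (suc m) ≈ ι (suc m) * ε (suc m) * S + B
    sums = begin
      A + S * ε (suc m)
        ≈⟨ trans (∑-+ (allFin k) _ _) (+-congˡ (∑-*ʳ (allFin k) _ _)) ⟨
      ∑ (allFin k) (λ d → x d * q (suc r) d * e m (kill d x) + x d * q r d * 1# * ε (suc m))
        ≈⟨ ∑-cong (allFin k) pointwise ⟩
      ∑ (allFin k) (λ d → x d * e m (kill d x) * S + x d * q r d * e (suc m) (kill d x))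
        ≈⟨ trans (∑-+ (allFin k) _ _) (+-congʳ (trans (∑-*ʳ (allFin k) _ _) (*-congʳ (euler m x)))) ⟩
      ι (suc m) * ε (suc m) * S + B
        ∎

  -- For `m` = 0 these are the coefficients (j-1) e_j of the path recursion, with j = i + 1.
  K : ℕ → ℕ → ⟨R⟩
  K m i = ι (m ℕ.+ i) * ε (suc (m ℕ.+ i))

  K-suc : ∀ m i → K m (suc i) ≈ K (suc m) i
  K-suc m i = reflexive (≡.cong (λ h → ι h * ε (suc h)) (ℕ.+-suc m i))

  -- `U-suc` iterated until the walk is used up. The case `m` = 0 is the recursion for paths.
  U-unfold : ∀ m r → U m (suc r) ≈ ε (suc m ℕ.+ r) + (K m ⊛ U 0) r
  U-unfold m zero = begin
    U m 1                                ≈⟨ U-suc m 0 ⟩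
    ι m * ε (suc m) * 1# + ε (suc m)     ≈⟨ +-comm _ _ ⟩
    ε (suc m) + ι m * ε (suc m) * 1#     ≡⟨ ≡.cong (λ h → ε (suc h) + ι h * ε (suc h) * 1#) (ℕ.+-identityʳ m) ⟨
    ε (suc m ℕ.+ 0) + K m 0 * 1#         ∎
  U-unfold m (suc r) = begin
    U m (suc (suc r))
      ≈⟨ U-suc m (suc r) ⟩
    ι m * ε (suc m) * U 0 (suc r) + U (suc m) (suc r)
      ≈⟨ +-congˡ (U-unfold (suc m) r) ⟩
    ι m * ε (suc m) * U 0 (suc r) + (ε (suc (suc m) ℕ.+ r) + (K (suc m) ⊛ U 0) r)
      ≈⟨ solve 3 (λ a b c → a :+ (b :+ c) := b :+ (a :+ c)) refl _ _ _ ⟩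
    ε (suc (suc m) ℕ.+ r) + (ι m * ε (suc m) * U 0 (suc r) + (K (suc m) ⊛ U 0) r)
      ≈⟨ +-cong (reflexive (≡.cong (λ h → ε (suc h)) (≡.sym (ℕ.+-suc m r))))
           (+-cong (*-congʳ (reflexive (≡.cong (λ h → ι h * ε (suc h)) (≡.sym (ℕ.+-identityʳ m)))))
             (⊛-cong (λ i → sym (K-suc m i)) (λ _ → refl) r)) ⟩
    ε (suc m ℕ.+ suc r) + (K m ⊛ U 0) (suc r)
      ∎

  -- The two-column part of D.
  R′ : ℕ → ℕ → ⟨R⟩
  R′ m zero    = 0#
  R′ m (suc r) = R′ (suc m) r + ι (suc r ℕ.* suc m) * (ε m * ε (suc r) - ε (suc m) * ε r)

  -- The factor `ι (suc m)` makes the coefficients of s_(1^N) cancel for every `r` > 0. At `r` = 0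
  -- the value is `ι m * ε m`.
  D : ℕ → ℕ → ⟨R⟩
  D m r = ι (suc m) * ε m * U 0 r - U m r

  -- `U m` obeys a recursion with the kernel `K 0` of the paths, up to products of two elementary
  -- functions. In the induction on `r` the index `m` grows, because `U-suc` turns a letter of the
  -- walk into an element of the set; the summand in the definition of `R′` is what this step leaves
  -- over.
  U-R′ : ∀ m r → U m (suc r) + R′ m (suc r) ≈ (K 0 ⊛ U m) r + (1# + ι m * ι (suc r)) * (ε m * ε (suc r))
  U-R′ m zero = begin
    U m 1 + (0# + ι (1 ℕ.* suc m) * (ε m * ε 1 - ε (suc m) * 1#))
      ≈⟨ +-cong (U-suc m 0) (+-congˡ (*-congʳ (ι-* 1 (suc m)))) ⟩
    (ι m * ε (suc m) * 1# + ε (suc m)) + (0# + ι 1 * ι (suc m) * (ε m * ε 1 - ε (suc m) * 1#))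
      ≈⟨ solve 4 (λ n a b c → (n :* b :* con (+ 1) :+ b) :+
        (con (+ 0) :+ (con (+ 1) :+ con (+ 0)) :* (con (+ 1) :+ n) :* (a :* c :- b :* con (+ 1)))
           := con (+ 0) :* c :* a :+ (con (+ 1) :+ n :* (con (+ 1) :+ con (+ 0))) :* (a :* c)) refl _ _ _ _ ⟩
    0# * ε 1 * ε m + (1# + ι m * ι 1) * (ε m * ε 1)
      ∎
  U-R′ m (suc r) = begin
    U m (suc (suc r)) + (R′ (suc m) (suc r) + ι (suc (suc r) ℕ.* suc m) * (ε m * ε (suc (suc r)) - ε (suc m) * ε (suc r)))
      ≈⟨ +-cong (U-suc m (suc r)) (+-congˡ (*-congʳ (ι-* (suc (suc r)) (suc m)))) ⟩
    (ι m * ε (suc m) * U 0 (suc r) + U (suc m) (suc r))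
      + (R′ (suc m) (suc r) + ι (suc (suc r)) * ι (suc m) * (ε m * ε (suc (suc r)) - ε (suc m) * ε (suc r)))
      ≈⟨ solve 4 (λ a b c d → (a :+ b) :+ (c :+ d) := a :+ (b :+ c) :+ d) refl _ _ _ _ ⟩
    ι m * ε (suc m) * U 0 (suc r) + (U (suc m) (suc r) + R′ (suc m) (suc r))
      + ι (suc (suc r)) * ι (suc m) * (ε m * ε (suc (suc r)) - ε (suc m) * ε (suc r))
      ≈⟨ +-congʳ (+-cong (*-congˡ (U-unfold 0 r)) (U-R′ (suc m) r)) ⟩
    ι m * ε (suc m) * (ε (suc r) + c₀) + (c₁ + (1# + ι (suc m) * ι (suc r)) * (ε (suc m) * ε (suc r)))
      + ι (suc (suc r)) * ι (suc m) * (ε m * ε (suc (suc r)) - ε (suc m) * ε (suc r))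
      ≈⟨ solve 8 (λ n a b c d s c₀ c₁ →
            n :* b :* (c :+ c₀) :+ (c₁ :+ (con (+ 1) :+ (con (+ 1) :+ n) :* (con (+ 1) :+ s)) :* (b :* c)) :+
              (con (+ 1) :+ (con (+ 1) :+ s)) :* (con (+ 1) :+ n) :* (a :* d :- b :* c)
            := ((con (+ 1) :+ s) :* d :* a :+ (n :* b :* c₀ :+ c₁)) :+
              (con (+ 1) :+ n :* (con (+ 1) :+ (con (+ 1) :+ s))) :* (a :* d))
           refl (ι m) (ε m) (ε (suc m)) (ε (suc r)) (ε (suc (suc r))) (ι r) c₀ c₁ ⟩
    (ι (suc r) * ε (suc (suc r)) * ε m + (ι m * ε (suc m) * c₀ + c₁))
      + (1# + ι m * ι (suc (suc r))) * (ε m * ε (suc (suc r)))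
      ≈⟨ +-congʳ (+-congˡ conv) ⟨
    (ι (suc r) * ε (suc (suc r)) * ε m + (K 0 ⊛ (U m ∘ suc)) r) + (1# + ι m * ι (suc (suc r))) * (ε m * ε (suc (suc r)))
      ≈⟨ +-congʳ (⊛-suc (K 0) (U m) r) ⟨
    (K 0 ⊛ U m) (suc r) + (1# + ι m * ι (suc (suc r))) * (ε m * ε (suc (suc r)))
      ∎
    where
    c₀ = (K 0 ⊛ U 0) r
    c₁ = (K 0 ⊛ U (suc m)) r

    conv : (K 0 ⊛ (U m ∘ suc)) r ≈ ι m * ε (suc m) * c₀ + c₁
    conv = begin
      (K 0 ⊛ (U m ∘ suc)) r
        ≈⟨ ⊛-cong (λ _ → refl) (U-suc m) r ⟩
      (K 0 ⊛ (λ i → ι m * ε (suc m) * U 0 i + U (suc m) i)) r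
        ≈⟨ ⊛-comm (K 0) _ r ⟩
      ((λ i → ι m * ε (suc m) * U 0 i + U (suc m) i) ⊛ K 0) r
        ≈⟨ ⊛-distribʳ (K 0) (λ i → ι m * ε (suc m) * U 0 i) (U (suc m)) r ⟩
      ((λ i → ι m * ε (suc m) * U 0 i) ⊛ K 0) r + (U (suc m) ⊛ K 0) r
        ≈⟨ +-cong (trans (⊛-scaleˡ _ (U 0) (K 0) r) (*-congˡ (⊛-comm (U 0) (K 0) r))) (⊛-comm (U (suc m)) (K 0) r) ⟩
      ι m * ε (suc m) * c₀ + c₁
        ∎

  D-⊛ : ∀ m r → (K 0 ⊛ D m) r ≈ ι (suc m) * ε m * (K 0 ⊛ U 0) r - (K 0 ⊛ U m) r
  D-⊛ m r = begin
    (K 0 ⊛ D m) r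
      ≈⟨ trans (⊛-comm (K 0) (D m) r) (⊛-cong (λ i → +-congˡ (solve 1 (λ a → :- a := :- con (+ 1) :* a) refl _))
        (λ _ → refl) r) ⟩
    ((λ i → ι (suc m) * ε m * U 0 i + - 1# * U m i) ⊛ K 0) r
      ≈⟨ ⊛-distribʳ (K 0) (λ i → ι (suc m) * ε m * U 0 i) (λ i → - 1# * U m i) r ⟩
    ((λ i → ι (suc m) * ε m * U 0 i) ⊛ K 0) r + ((λ i → - 1# * U m i) ⊛ K 0) r
      ≈⟨ +-cong (trans (⊛-scaleˡ _ (U 0) (K 0) r) (*-congˡ (⊛-comm (U 0) (K 0) r)))
                (trans (⊛-scaleˡ _ (U m) (K 0) r) (*-congˡ (⊛-comm (U m) (K 0) r))) ⟩
    ι (suc m) * ε m * (K 0 ⊛ U 0) r + - 1# * (K 0 ⊛ U m) r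
      ≈⟨ +-congˡ (solve 1 (λ a → :- con (+ 1) :* a := :- a) refl _) ⟩
    ι (suc m) * ε m * (K 0 ⊛ U 0) r - (K 0 ⊛ U m) r
      ∎

  -- The coefficient of `ε m * ε (suc r)` in the difference is (m+1) - (1 + m(r+1)) = -mr. The
  -- product on the left equals the last term `K 0 r * D m 0` of the convolution, and `D-2` cancels
  -- the two.
  D-suc : ∀ m r → D m (suc r) + ι r * ι m * (ε m * ε (suc r)) ≈ (K 0 ⊛ D m) r + R′ m (suc r)
  D-suc m r = begin
    (ι (suc m) * ε m * U 0 (suc r) - U m (suc r)) + ι r * ι m * (ε m * ε (suc r))
      ≈⟨ +-congʳ (+-cong (*-congˡ (U-unfold 0 r)) (solve 2 (λ u v → :- u := v :- (u :+ v)) refl _ _)) ⟩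
    (ι (suc m) * ε m * (ε (suc r) + c₀) + (R′ m (suc r) - (U m (suc r) + R′ m (suc r)))) + ι r * ι m * (ε m * ε (suc r))
      ≈⟨ +-congʳ (+-congˡ (+-congˡ (-‿cong (U-R′ m r)))) ⟩
    (ι (suc m) * ε m * (ε (suc r) + c₀) + (R′ m (suc r) - (cₘ + (1# + ι m * ι (suc r)) * (ε m * ε (suc r)))))
      + ι r * ι m * (ε m * ε (suc r))
      ≈⟨ solve 7 (λ n s a c c₀ cₘ w →
           ((con (+ 1) :+ n) :* a :* (c :+ c₀) :+ (w :- (cₘ :+ (con (+ 1) :+ n :* (con (+ 1) :+ s)) :* (a :* c))))
             :+ s :* n :* (a :* c)
           := ((con (+ 1) :+ n) :* a :* c₀ :- cₘ) :+ w)
           refl (ι m) (ι r) (ε m) (ε (suc r)) c₀ cₘ (R′ m (suc r)) ⟩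
    (ι (suc m) * ε m * c₀ - cₘ) + R′ m (suc r)
      ≈⟨ +-congʳ (D-⊛ m r) ⟨
    (K 0 ⊛ D m) r + R′ m (suc r)
      ∎
    where
    c₀ = (K 0 ⊛ U 0) r
    cₘ = (K 0 ⊛ U m) r

  D-1 : ∀ m → D m 1 ≈ R′ m 1
  D-1 m = begin
    D m 1                                 ≈⟨ solve 3 (λ d n a → d := d :+ con (+ 0) :* n :* a) refl _ (ι m) (ε m * ε 1) ⟩
    D m 1 + ι 0 * ι m * (ε m * ε 1)       ≈⟨ D-suc m 0 ⟩
    0# * ε 1 * D m 0 + R′ m 1             ≈⟨ solve 3 (λ a d w → con (+ 0) :* a :* d :+ w := w) refl _ _ _ ⟩
    R′ m 1                                ∎

  D-2 : ∀ m r → D m (suc (suc r)) ≈ (K 0 ⊛ (D m ∘ suc)) r + R′ m (suc (suc r))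
  D-2 m r = begin
    D m (2 ℕ.+ r)
      ≈⟨ solve 2 (λ d t → d := (d :+ t) :- t) refl _ t ⟩
    (D m (2 ℕ.+ r) + t) - t
      ≈⟨ +-congʳ (trans (D-suc m (suc r)) (+-congʳ (⊛-suc (K 0) (D m) r))) ⟩
    (ι (suc r) * ε (2 ℕ.+ r) * (ι (suc m) * ε m * 1# - ε m) + (K 0 ⊛ (D m ∘ suc)) r + R′ m (2 ℕ.+ r)) - t
      ≈⟨ solve 6 (λ s c n a k w → (s :* c :* ((con (+ 1) :+ n) :* a :* con (+ 1) :- a) :+ k :+ w) :- s :* n :*
        (a :* c) := k :+ w)
           refl (ι (suc r)) (ε (2 ℕ.+ r)) (ι m) (ε m) _ _ ⟩
    (K 0 ⊛ (D m ∘ suc)) r + R′ m (2 ℕ.+ r)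
      ∎
    where t = ι (suc r) * ι m * (ε m * ε (2 ℕ.+ r))

  -- Exchanging (a,b) with (b-1,a+1) preserves the coefficient (a+1)b in `R′` and changes the sign
  -- of e_a e_b - e_{a+1} e_{b-1}. So the outermost surplus terms cancel in pairs, which shortens
  -- the gap `d` by two; for `d` = 1 the one surplus term is its own mirror image and vanishes.
  R′-flip : ∀ m d → R′ m (d ℕ.+ m) ≈ R′ (d ℕ.+ m) m
  R′-flip m zero          = refl
  R′-flip m (suc zero)    = begin
    R′ (suc m) m + ι (suc m ℕ.* suc m) * (ε m * ε (suc m) - ε (suc m) * ε m)
      ≈⟨ solve 4 (λ w n a b → w :+ n :* (a :* b :- b :* a) := w) refl _ _ _ _ ⟩
    R′ (suc m) m
      ∎
  R′-flip m (suc (suc d)) = begin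
    R′ (suc m) (suc d ℕ.+ m) + ι (suc (suc d ℕ.+ m) ℕ.* suc m) * (ε m * ε (2 ℕ.+ (d ℕ.+ m)) - ε (suc m) * ε (suc (d ℕ.+ m)))
      ≈⟨ +-congʳ ih ⟩
    (R′ (2 ℕ.+ (d ℕ.+ m)) m + ι (suc m ℕ.* suc (suc (d ℕ.+ m))) *
      (ε (suc (d ℕ.+ m)) * ε (suc m) - ε (2 ℕ.+ (d ℕ.+ m)) * ε m)) +
      ι (suc (suc d ℕ.+ m) ℕ.* suc m) * (ε m * ε (2 ℕ.+ (d ℕ.+ m)) - ε (suc m) * ε (suc (d ℕ.+ m)))
      ≈⟨ +-congʳ (+-congˡ (*-congʳ (reflexive (≡.cong ι (ℕ.*-comm (suc m) (suc (suc (d ℕ.+ m)))))))) ⟩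
    (R′ (2 ℕ.+ (d ℕ.+ m)) m + ι (suc (suc d ℕ.+ m) ℕ.* suc m) *
      (ε (suc (d ℕ.+ m)) * ε (suc m) - ε (2 ℕ.+ (d ℕ.+ m)) * ε m)) +
      ι (suc (suc d ℕ.+ m) ℕ.* suc m) * (ε m * ε (2 ℕ.+ (d ℕ.+ m)) - ε (suc m) * ε (suc (d ℕ.+ m)))
      ≈⟨ solve 6 (λ w n a b c d → (w :+ n :* (c :* b :- d :* a)) :+ n :* (a :* d :- b :* c) := w) refl _ _ _ _ _ _ ⟩
    R′ (2 ℕ.+ (d ℕ.+ m)) m
      ∎
    where
    ih : R′ (suc m) (suc d ℕ.+ m) ≈ R′ (suc (d ℕ.+ m)) (suc m)
    ih = ≡.subst (λ h → R′ (suc m) h ≈ R′ h (suc m)) (ℕ.+-suc d m) (R′-flip (suc m) d)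

  -- Multiply `U-suc` by m+2 and write (m+2) e_{m+1} P_r as D_{m+1,r} + U_{m+1,r}. This compares
  -- consecutive lollipops.
  U-D : ∀ m r → ι (2 ℕ.+ m) * U m (suc r) ≈ ι 2 * ι (suc m) * U (suc m) r + ι m * D (suc m) r
  U-D m r = trans (*-congˡ (U-suc m r))
    (solve 4 (λ n a p u → (con (+ 1) :+ (con (+ 1) :+ n)) :* (n :* a :* p :+ u)
      := (con (+ 1) :+ (con (+ 1) :+ con (+ 0))) :* (con (+ 1) :+ n) :* u :+ n :*
        ((con (+ 1) :+ (con (+ 1) :+ n)) :* a :* p :- u))
      refl _ _ _ _)

-- Shapes, horizontal strips and vertical strips

All-product : ∀ {A B C : Set} {P : A → Set} {Q : B → Set} {S : C → Set} (h : A → B → C) →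
  (∀ {x y} → P x → Q y → S (h x y)) →
  ∀ {xs ys} → All P xs → All Q ys → All S (cartesianProductWith h xs ys)
All-product h f []         qs = []
All-product h f (p ∷ ps) qs = All.++⁺ (All.map⁺ (All.map (f p) qs)) (All-product h f ps qs)

from : ℕ → ℕ → List ℕ
from a zero    = []
from a (suc n) = a ∷ from (suc a) n

map-suc-from : ∀ a n → map suc (from a n) ≡ from (suc a) n
map-suc-from a zero    = ≡.refl
map-suc-from a (suc n) = ≡.cong (suc a ∷_) (map-suc-from (suc a) n)

from-+ : ∀ a m n → from a (m ℕ.+ n) ≡ from a m ++ from (a ℕ.+ m) n
from-+ a zero    n = ≡.cong (λ b → from b n) (≡.sym (ℕ.+-identityʳ a))
from-+ a (suc m) n = ≡.cong (a ∷_) (≡.trans (from-+ (suc a) m n)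
  (≡.cong (λ b → from (suc a) m ++ from b n) (≡.sym (ℕ.+-suc a m))))

from-bounds : ∀ a n → All (λ i → a ≤ i × i < a ℕ.+ n) (from a n)
from-bounds a zero    = []
from-bounds a (suc n) =
  (ℕ.≤-refl , ℕ.m<m+n a (s≤s z≤n)) ∷
  All.map (λ { {i} (p , q) → ℕ.<⇒≤ p , ≡.subst (i <_) (≡.sym (ℕ.+-suc a n)) q }) (from-bounds (suc a) n)

Shape : Set
Shape = List ℕ

hd : Shape → ℕ
hd []      = 0
hd (x ∷ _) = x

Descending : Shape → Set
Descending = Linked _≥_

desc-hd : ∀ {x μ} → Descending (x ∷ μ) → hd μ ≤ x
desc-hd [-]     = z≤n
desc-hd (p ∷ _) = p

desc-∷ : ∀ {x μ} → hd μ ≤ x → Descending μ → Descending (x ∷ μ)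
desc-∷ {μ = []}    p d = [-]
desc-∷ {μ = _ ∷ _} p d = p ∷ d

-- The ρ for which μ/ρ is a horizontal strip.  They keep the number of rows of
-- μ, so they may end in zeros.
hstrips : Shape → List Shape
hstrips []      = [] ∷ []
hstrips (x ∷ μ) = cartesianProductWith _∷_ (from (hd μ) (suc (x ∸ hd μ))) (hstrips μ)

-- vstrips j μ lists the λ for which λ/μ is a vertical strip of size j.  Those in
-- raised j have size suc j and a longer first row than μ; level keeps that row.
vstrips raised level : ℕ → Shape → List Shape
vstrips zero    μ = level zero μ
vstrips (suc j) μ = raised j μ ++ level (suc j) μ

raised j []      = replicate (suc j) 1 ∷ []
raised j (x ∷ μ) = map (suc x ∷_) (vstrips j μ)

level zero    []      = [] ∷ []
level (suc j) []      = []
level j       (x ∷ μ) = map (x ∷_) (if hd μ <ᵇ x then vstrips j μ else level j μ)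

hstrips-⊆ : ∀ {μ} → Descending μ →
  All (λ ρ → Descending ρ × hd ρ ≤ hd μ × sum ρ ≤ sum μ) (hstrips μ)
hstrips-⊆ {[]}    d = ([] , z≤n , z≤n) ∷ []
hstrips-⊆ {x ∷ μ} d = All-product _∷_
  (λ { {i} (y≤i , i<) (dρ , hρ , sρ) →
       let i≤x = ℕ.≤-pred (≡.subst (i <_) bound i<) in
       desc-∷ (ℕ.≤-trans hρ y≤i) dρ , i≤x , ℕ.+-mono-≤ i≤x sρ })
  (from-bounds (hd μ) _) (hstrips-⊆ (Linked.tail d))
  where
  bound : hd μ ℕ.+ suc (x ∸ hd μ) ≡ suc x
  bound = ≡.trans (ℕ.+-suc (hd μ) _) (≡.cong suc (ℕ.m+[n∸m]≡n (desc-hd d)))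

raised-hd : ∀ j μ → All (λ λ′ → hd λ′ ≡ suc (hd μ)) (raised j μ)
raised-hd j []      = ≡.refl ∷ []
raised-hd j (x ∷ μ) = All.map⁺ (All.universal (λ _ → ≡.refl) _)

level-hd : ∀ j μ → All (λ λ′ → hd λ′ ≡ hd μ) (level j μ)
level-hd zero    []      = ≡.refl ∷ []
level-hd (suc j) []      = []
level-hd zero    (x ∷ μ) = All.map⁺ (All.universal (λ _ → ≡.refl) _)
level-hd (suc j) (x ∷ μ) = All.map⁺ (All.universal (λ _ → ≡.refl) _)

vstrips-[] : ∀ j → vstrips j [] ≡ replicate j 1 ∷ []
vstrips-[] zero    = ≡.refl
vstrips-[] (suc j) = ≡.refl

vstrips-0 : ∀ μ → vstrips 0 μ ≡ μ ∷ []
vstrips-0 []      = ≡.refl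
vstrips-0 (x ∷ μ) with hd μ <ᵇ x
... | true  = ≡.cong (map (x ∷_)) (vstrips-0 μ)
... | false = ≡.cong (map (x ∷_)) (vstrips-0 μ)

level-∷ : ∀ j x μ → level j (x ∷ μ) ≡ map (x ∷_) (if hd μ <ᵇ x then vstrips j μ else level j μ)
level-∷ zero    x μ = ≡.refl
level-∷ (suc j) x μ = ≡.refl

<ᵇ-true : ∀ {m n} → m < n → (m <ᵇ n) ≡ true
<ᵇ-true {zero}  (s≤s _)         = ≡.refl
<ᵇ-true {suc m} (s≤s p@(s≤s _)) = <ᵇ-true p

<ᵇ-refl : ∀ n → (n <ᵇ n) ≡ false
<ᵇ-refl zero    = ≡.refl
<ᵇ-refl (suc n) = <ᵇ-refl n

-- Exchanging the addition of vertical strips with the removal of horizontal ones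

module Strips (R : CommutativeRing 0ℓ 0ℓ) where
  open RingKit R
  open Sums R
  open Solver

  prev : (ℕ → ⟨R⟩) → ℕ → ⟨R⟩
  prev f zero    = 0#
  prev f (suc j) = f j

  -- `L` adds a vertical strip and then removes a horizontal one, `R` does the reverse. The second
  -- letter concerns the first row: free, raised by the vertical strip (which then has size
  -- `suc j`), or capped at `hd μ`. The capped sums are needed for the recursion on rows, where a
  -- row can grow only if the row above it leaves room.
  Lf Lu Lc Rf Rc : ℕ → Shape → (Shape → ⟨R⟩) → ⟨R⟩
  Lf j μ g = ∑ (vstrips j μ) (λ λ′ → ∑ (hstrips λ′) g)
  Lu j μ g = ∑ (raised j μ) (λ λ′ → ∑ (hstrips λ′) g)
  Lc j μ g = ∑ (level j μ) (λ λ′ → ∑ (hstrips λ′) g)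
  Rf j μ g = ∑ (hstrips μ) (λ ρ → ∑ (vstrips j ρ) g)
  Rc j μ g = ∑ (hstrips μ) (λ ρ → ∑ (if hd ρ <ᵇ hd μ then vstrips j ρ else level j ρ) g)

  Lf-split : ∀ j μ g → Lf j μ g ≈ prev (λ j → Lu j μ g) j + Lc j μ g
  Lf-split zero    μ g = sym (+-identityˡ _)
  Lf-split (suc j) μ g = ∑-++ (raised j μ) (level (suc j) μ) _

  ∑-snoc : ∀ a n (f : ℕ → ⟨R⟩) → ∑ (from a (suc n)) f ≈ ∑ (from a n) f + f (a ℕ.+ n)
  ∑-snoc a n f = begin
    ∑ (from a (suc n)) f                 ≡⟨ ≡.cong (λ h → ∑ (from a h) f) (ℕ.+-comm n 1) ⟨
    ∑ (from a (n ℕ.+ 1)) f               ≡⟨ ≡.cong (λ h → ∑ h f) (from-+ a n 1) ⟩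
    ∑ (from a n ++ from (a ℕ.+ n) 1) f   ≈⟨ ∑-++ (from a n) _ f ⟩
    ∑ (from a n) f + (f (a ℕ.+ n) + 0#)  ≈⟨ +-congˡ (+-identityʳ _) ⟩
    ∑ (from a n) f + f (a ℕ.+ n)         ∎

  ∑-shift : ∀ a n (f : ℕ → ⟨R⟩) → ∑ (from a n) (f ∘ suc) ≈ ∑ (from (suc a) n) f
  ∑-shift a n f = trans (sym (∑-map (from a n) suc f))
    (reflexive (≡.cong (λ h → ∑ h f) (map-suc-from a n)))

  ∑-above : ∀ a n {f g : ℕ → ⟨R⟩} → (∀ i → a ≤ i → f i ≈ g i) → ∑ (from a n) f ≈ ∑ (from a n) g
  ∑-above a n p = ∑-cong-All (All.map (λ { (a≤i , _) → p _ a≤i }) (from-bounds a n))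

  hstrips-common : ∀ x h Λ g → All (λ λ′ → hd λ′ ≡ h) Λ →
    ∑ Λ (λ λ′ → ∑ (hstrips (x ∷ λ′)) g) ≈
    ∑ (from h (suc (x ∸ h))) (λ i → ∑ Λ (λ λ′ → ∑ (hstrips λ′) (g ∘ (i ∷_))))
  hstrips-common x h Λ g hds = trans
    (∑-cong-All (All.map (λ { {λ′} ≡.refl → ∑-product _∷_ (from h (suc (x ∸ h))) (hstrips λ′) g }) hds))
    (∑-swap Λ (from h (suc (x ∸ h))) (λ λ′ i → ∑ (hstrips λ′) (g ∘ (i ∷_))))

  level-row : ∀ j x μ g → ∑ (level j μ) (λ λ′ → ∑ (hstrips (x ∷ λ′)) g) ≈
    Lc j μ (g ∘ (hd μ ∷_)) + ∑ (from (suc (hd μ)) (x ∸ hd μ)) (λ i → Lc j μ (g ∘ (i ∷_)))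
  level-row j x μ g = hstrips-common x (hd μ) (level j μ) g (level-hd j μ)

  raised-row : ∀ j x μ g → hd μ < x → ∑ (raised j μ) (λ λ′ → ∑ (hstrips (x ∷ λ′)) g) ≈
    ∑ (from (suc (hd μ)) (x ∸ hd μ)) (λ i → Lu j μ (g ∘ (i ∷_)))
  raised-row j x μ g y<x = trans
    (hstrips-common x (suc (hd μ)) (raised j μ) g (raised-hd j μ))
    (reflexive (≡.cong (λ n → ∑ (from (suc (hd μ)) n) (λ i → Lu j μ (g ∘ (i ∷_)))) (≡.sym (ℕ.+-∸-assoc 1 y<x))))

  vstrips-row : ∀ j x μ g → hd μ < x → ∑ (vstrips j μ) (λ λ′ → ∑ (hstrips (x ∷ λ′)) g) ≈
    ∑ (from (suc (hd μ)) (x ∸ hd μ)) (λ i → Lf j μ (g ∘ (i ∷_))) + Lc j μ (g ∘ (hd μ ∷_))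
  vstrips-row zero    x μ g y<x = trans (level-row 0 x μ g) (+-comm _ _)
  vstrips-row (suc j) x μ g y<x = begin
    ∑ (raised j μ ++ level (suc j) μ) (λ λ′ → ∑ (hstrips (x ∷ λ′)) g)
      ≈⟨ ∑-++ (raised j μ) (level (suc j) μ) _ ⟩
    ∑ (raised j μ) (λ λ′ → ∑ (hstrips (x ∷ λ′)) g) + ∑ (level (suc j) μ) (λ λ′ → ∑ (hstrips (x ∷ λ′)) g)
      ≈⟨ +-cong (raised-row j x μ g y<x) (level-row (suc j) x μ g) ⟩
    ∑ is (λ i → Lu j μ (g ∘ (i ∷_))) + (Lc (suc j) μ (g ∘ (hd μ ∷_)) + ∑ is (λ i → Lc (suc j) μ (g ∘ (i ∷_))))
      ≈⟨ solve 3 (λ a b c → a :+ (b :+ c) := (a :+ c) :+ b) refl _ _ _ ⟩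
    (∑ is (λ i → Lu j μ (g ∘ (i ∷_))) + ∑ is (λ i → Lc (suc j) μ (g ∘ (i ∷_)))) + Lc (suc j) μ (g ∘ (hd μ ∷_))
      ≈⟨ +-congʳ (trans (∑-cong is λ i → Lf-split (suc j) μ (g ∘ (i ∷_))) (∑-+ is _ _)) ⟨
    ∑ is (λ i → Lf (suc j) μ (g ∘ (i ∷_))) + Lc (suc j) μ (g ∘ (hd μ ∷_))
      ∎
    where is = from (suc (hd μ)) (x ∸ hd μ)

  ∑-level-∷ : ∀ j x μ (f : Shape → ⟨R⟩) →
    ∑ (level j (x ∷ μ)) f ≈ ∑ (if hd μ <ᵇ x then vstrips j μ else level j μ) (f ∘ (x ∷_))
  ∑-level-∷ j x μ f = trans (reflexive (≡.cong (λ h → ∑ h f) (level-∷ j x μ)))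
    (∑-map (if hd μ <ᵇ x then vstrips j μ else level j μ) (x ∷_) f)

  -- Sort by the length `i` that remains of the first row. A second row grown to `suc (hd μ)` is
  -- compatible with every `i` above `hd μ`, but for `i` = `hd μ` the second row must not have
  -- grown.
  Lc-∷ : ∀ j x μ g → hd μ ≤ x → Lc j (x ∷ μ) g ≈
    ∑ (from (suc (hd μ)) (x ∸ hd μ)) (λ i → Lf j μ (g ∘ (i ∷_))) + Lc j μ (g ∘ (hd μ ∷_))
  Lc-∷ j x μ g y≤x = trans (∑-level-∷ j x μ _) (cases (ℕ.m≤n⇒m<n∨m≡n y≤x))
    where
    cases : hd μ < x ⊎ hd μ ≡ x →
      ∑ (if hd μ <ᵇ x then vstrips j μ else level j μ) (λ λ′ → ∑ (hstrips (x ∷ λ′)) g) ≈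
      ∑ (from (suc (hd μ)) (x ∸ hd μ)) (λ i → Lf j μ (g ∘ (i ∷_))) + Lc j μ (g ∘ (hd μ ∷_))
    cases (inj₁ y<x) rewrite <ᵇ-true y<x = vstrips-row j x μ g y<x
    cases (inj₂ ≡.refl) rewrite <ᵇ-refl (hd μ) = trans (level-row j (hd μ) μ g) (trans
      (reflexive (≡.cong (λ n → Lc j μ (g ∘ (hd μ ∷_)) + ∑ (from (suc (hd μ)) n) (λ i → Lc j μ (g ∘ (i ∷_))))
        (ℕ.n∸n≡0 (hd μ))))
      (trans (+-comm _ _) (reflexive (≡.cong (λ n → ∑ (from (suc (hd μ)) n) (λ i → Lf j μ (g ∘ (i ∷_)))
        + Lc j μ (g ∘ (hd μ ∷_))) (≡.sym (ℕ.n∸n≡0 (hd μ)))))))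

  -- The raised row can be cut back to the same lengths as the row `x`, or else keep its length
  -- `suc x`.
  Lu-∷ : ∀ j x μ g → hd μ ≤ x → Lu j (x ∷ μ) g ≈ Lc j (x ∷ μ) g + Lf j μ (g ∘ (suc x ∷_))
  Lu-∷ j x μ g y≤x = begin
    Lu j (x ∷ μ) g
      ≈⟨ trans (∑-map (vstrips j μ) (suc x ∷_) _) (vstrips-row j (suc x) μ g (s≤s y≤x)) ⟩
    ∑ (from (suc y) (suc x ∸ y)) (λ i → Lf j μ (g ∘ (i ∷_))) + Lc j μ (g ∘ (y ∷_))
      ≈⟨ +-congʳ (trans (reflexive (≡.cong (λ n → ∑ (from (suc y) n) (λ i → Lf j μ (g ∘ (i ∷_)))) (ℕ.+-∸-assoc 1 y≤x)))
           (trans (∑-snoc (suc y) (x ∸ y) _) (+-congˡ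
             (reflexive (≡.cong (λ i → Lf j μ (g ∘ (suc i ∷_))) (ℕ.m+[n∸m]≡n y≤x)))))) ⟩
    (∑ (from (suc y) (x ∸ y)) (λ i → Lf j μ (g ∘ (i ∷_))) + Lf j μ (g ∘ (suc x ∷_))) + Lc j μ (g ∘ (y ∷_))
      ≈⟨ solve 3 (λ a b c → (a :+ b) :+ c := (a :+ c) :+ b) refl _ _ _ ⟩
    (∑ (from (suc y) (x ∸ y)) (λ i → Lf j μ (g ∘ (i ∷_))) + Lc j μ (g ∘ (y ∷_))) + Lf j μ (g ∘ (suc x ∷_))
      ≈⟨ +-congʳ (Lc-∷ j x μ g y≤x) ⟨
    Lc j (x ∷ μ) g + Lf j μ (g ∘ (suc x ∷_))
      ∎
    where y = hd μ

  module _ (j x : ℕ) (μ : Shape) (g : Shape → ⟨R⟩) (desc : Descending (x ∷ μ)) where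
    private
      y = hd μ
      d = x ∸ y
      y≤x = desc-hd desc

      F C : ℕ → ⟨R⟩
      F i = ∑ (hstrips μ) (λ ρ → ∑ (vstrips j (i ∷ ρ)) g)
      C i = ∑ (hstrips μ) (λ ρ → ∑ (level j (i ∷ ρ)) g)

      C-hd : C y ≈ Rc j μ (g ∘ (y ∷_))
      C-hd = ∑-cong (hstrips μ) (λ ρ → ∑-level-∷ j y ρ g)

      C-above : ∀ i → y < i → C i ≈ Rf j μ (g ∘ (i ∷_))
      C-above i y<i = ∑-cong-All (All.map (λ { {ρ} (_ , hρ , _) → trans (∑-level-∷ j i ρ g)
        (reflexive (≡.cong (λ b → ∑ (if b then vstrips j ρ else level j ρ) (g ∘ (i ∷_)))
          (<ᵇ-true (ℕ.≤-<-trans hρ y<i)))) }) (hstrips-⊆ (Linked.tail desc)))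

      ∑C : ∑ (from y (suc d)) C ≈ ∑ (from (suc y) d) (λ i → Rf j μ (g ∘ (i ∷_))) + Rc j μ (g ∘ (y ∷_))
      ∑C = trans (+-cong C-hd (∑-above (suc y) d C-above)) (+-comm _ _)

      F-split : ∀ i → F i ≈ prev (λ j → Rf j μ (g ∘ (suc i ∷_))) j + C i
      F-split i = helper j
        where
        helper : ∀ j → ∑ (hstrips μ) (λ ρ → ∑ (vstrips j (i ∷ ρ)) g) ≈
          prev (λ j → Rf j μ (g ∘ (suc i ∷_))) j + ∑ (hstrips μ) (λ ρ → ∑ (level j (i ∷ ρ)) g)
        helper zero    = sym (+-identityˡ _)
        helper (suc j) = trans (∑-cong (hstrips μ) λ ρ →
            trans (∑-++ (raised j (i ∷ ρ)) (level (suc j) (i ∷ ρ)) g) (+-congʳ (∑-map (vstrips j ρ) (suc i ∷_) g)))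
          (∑-+ (hstrips μ) _ _)

      prevs : ℕ → ⟨R⟩
      prevs i = prev (λ j → Rf j μ (g ∘ (i ∷_))) j

      last : y ℕ.+ d ≡ x
      last = ℕ.m+[n∸m]≡n y≤x

    -- Sort by the final length `i` of the first row. Either the removal left it at `i`, or it left
    -- `i - 1` and the vertical strip spends one cell here, whence `prev`. Only a row left at `y`
    -- constrains the row below.
    Rc-∷ : Rc j (x ∷ μ) g ≈ ∑ (from (suc y) d) (λ i → Rf j μ (g ∘ (i ∷_)) + prev (λ j → Rf j μ (g ∘ (i ∷_))) j)
      + Rc j μ (g ∘ (y ∷_))
    Rc-∷ = begin
      Rc j (x ∷ μ) g
        ≈⟨ ∑-product _∷_ (from y (suc d)) (hstrips μ) _ ⟩
      ∑ (from y (suc d)) G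
        ≈⟨ ∑-snoc y d G ⟩
      ∑ (from y d) G + G (y ℕ.+ d)
        ≈⟨ +-cong (∑-cong-All (All.map (λ { {i} (_ , i<) → below i (≡.subst (i <_) last i<) }) (from-bounds y d)))
             (reflexive (≡.cong G last)) ⟩
      ∑ (from y d) F + G x
        ≈⟨ +-cong (trans (∑-cong (from y d) F-split) (∑-+ (from y d) _ _)) top ⟩
      (∑ (from y d) (prevs ∘ suc) + ∑ (from y d) C) + C x
        ≈⟨ trans (+-assoc _ _ _) (+-cong (∑-shift y d prevs)
             (trans (+-congˡ (reflexive (≡.cong C (≡.sym last)))) (sym (∑-snoc y d C)))) ⟩
      ∑ (from (suc y) d) prevs + ∑ (from y (suc d)) C
        ≈⟨ +-congˡ ∑C ⟩
      ∑ (from (suc y) d) prevs + (∑ (from (suc y) d) (λ i → Rf j μ (g ∘ (i ∷_))) + Rc j μ (g ∘ (y ∷_)))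
        ≈⟨ solve 3 (λ a b c → a :+ (b :+ c) := (b :+ a) :+ c) refl _ _ _ ⟩
      (∑ (from (suc y) d) (λ i → Rf j μ (g ∘ (i ∷_))) + ∑ (from (suc y) d) prevs) + Rc j μ (g ∘ (y ∷_))
        ≈⟨ +-congʳ (∑-+ (from (suc y) d) _ _) ⟨
      ∑ (from (suc y) d) (λ i → Rf j μ (g ∘ (i ∷_)) + prevs i) + Rc j μ (g ∘ (y ∷_))
        ∎
      where
      G : ℕ → ⟨R⟩
      G i = ∑ (hstrips μ) (λ ρ → ∑ (if i <ᵇ x then vstrips j (i ∷ ρ) else level j (i ∷ ρ)) g)

      below : ∀ i → i < x → G i ≈ F i
      below i i<x rewrite <ᵇ-true i<x = refl

      top : G x ≈ C x
      top rewrite <ᵇ-refl x = refl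

    Rf-∷ : Rf j (x ∷ μ) g ≈ Rc j (x ∷ μ) g + prev (λ j → Rf j μ (g ∘ (suc x ∷_))) j
    Rf-∷ = begin
      Rf j (x ∷ μ) g
        ≈⟨ ∑-product _∷_ (from y (suc d)) (hstrips μ) _ ⟩
      ∑ (from y (suc d)) F
        ≈⟨ trans (∑-cong (from y (suc d)) F-split) (∑-+ (from y (suc d)) _ _) ⟩
      ∑ (from y (suc d)) (prevs ∘ suc) + ∑ (from y (suc d)) C
        ≈⟨ +-cong (trans (∑-snoc y d (prevs ∘ suc))
          (+-cong (∑-shift y d prevs) (reflexive (≡.cong (prevs ∘ suc) last)))) ∑C ⟩
      (∑ (from (suc y) d) prevs + prevs (suc x)) + (∑ (from (suc y) d) (λ i → Rf j μ (g ∘ (i ∷_))) + Rc j μ (g ∘ (y ∷_)))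
        ≈⟨ solve 4 (λ a b c d → (a :+ b) :+ (c :+ d) := ((c :+ a) :+ d) :+ b) refl _ _ _ _ ⟩
      ((∑ (from (suc y) d) (λ i → Rf j μ (g ∘ (i ∷_))) + ∑ (from (suc y) d) prevs) + Rc j μ (g ∘ (y ∷_))) + prevs (suc x)
        ≈⟨ +-congʳ (trans Rc-∷ (+-congʳ (∑-+ (from (suc y) d) _ _))) ⟨
      Rc j (x ∷ μ) g + prevs (suc x)
        ∎

  -- A horizontal strip meets a column in at most its bottom cell, whose row then stays as a zero.
  hstrips-1^ : ∀ j g → ∑ (hstrips (replicate (suc j) 1)) g ≈ g (replicate (suc j) 1) + g (replicate j 1 ++ 0 ∷ [])
  hstrips-1^ zero    g = solve 2 (λ a b → a :+ (b :+ con (+ 0)) := b :+ a) refl _ _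
  hstrips-1^ (suc j) g = trans (∑-product _∷_ (1 ∷ []) (hstrips (replicate (suc j) 1)) g)
    (trans (+-identityʳ _) (hstrips-1^ j (g ∘ (1 ∷_))))

  -- Adding a vertical strip commutes with removing a horizontal one, except that
  -- one cell may be added and then removed again: this is the prev term.
  exchange : ∀ j {μ} g → Descending μ → (∀ ν → g (ν ++ 0 ∷ []) ≈ g ν) →
    (Lf j μ g ≈ Rf j μ g + prev (λ j → Rf j μ g) j) × (Lc j μ g ≈ Rc j μ g)
  exchange zero    {[]} g d g0 = solve 1 (λ a → a := a :+ con (+ 0)) refl _ , refl
  -- The only vertical strip on the empty shape is a column. Removing its bottom cell leaves a zero
  -- row, which `g0` discards; this gives the `prev` term.
  exchange (suc j) {[]} g d g0 = (begin
      ∑ (hstrips (replicate (suc j) 1)) g + 0#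
        ≈⟨ +-congʳ (trans (hstrips-1^ j g) (+-congˡ (g0 _))) ⟩
      (g (replicate (suc j) 1) + g (replicate j 1)) + 0#
        ≈⟨ solve 2 (λ a b → (a :+ b) :+ con (+ 0) := ((a :+ con (+ 0)) :+ con (+ 0)) :+
          ((b :+ con (+ 0)) :+ con (+ 0))) refl _ _ ⟩
      ((g (replicate (suc j) 1) + 0#) + 0#) + ((g (replicate j 1) + 0#) + 0#)
        ≡⟨ ≡.cong (λ h → ((g (replicate (suc j) 1) + 0#) + 0#) + (∑ h g + 0#)) (vstrips-[] j) ⟨
      Rf (suc j) [] g + Rf j [] g
        ∎)
    , sym (+-identityʳ _)
  exchange j {x ∷ μ} g d g0 = free j , level= j
    where
    ih : ∀ j i → let gᵢ = g ∘ (i ∷_) in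
      (Lf j μ gᵢ ≈ Rf j μ gᵢ + prev (λ j → Rf j μ gᵢ) j) × (Lc j μ gᵢ ≈ Rc j μ gᵢ)
    ih j i = exchange j {μ} (g ∘ (i ∷_)) (Linked.tail d) (λ ν → g0 (i ∷ ν))

    level= : ∀ j → Lc j (x ∷ μ) g ≈ Rc j (x ∷ μ) g
    level= j = begin
      Lc j (x ∷ μ) g
        ≈⟨ Lc-∷ j x μ g (desc-hd d) ⟩
      ∑ (from (suc (hd μ)) (x ∸ hd μ)) (λ i → Lf j μ (g ∘ (i ∷_))) + Lc j μ (g ∘ (hd μ ∷_))
        ≈⟨ +-cong (∑-cong (from (suc (hd μ)) (x ∸ hd μ)) λ i → let eq , _ = ih j i in eq) (let _ , eq = ih j (hd μ) in eq) ⟩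
      ∑ (from (suc (hd μ)) (x ∸ hd μ)) (λ i → Rf j μ (g ∘ (i ∷_)) + prev (λ j → Rf j μ (g ∘ (i ∷_))) j)
        + Rc j μ (g ∘ (hd μ ∷_))
        ≈⟨ Rc-∷ j x μ g d ⟨
      Rc j (x ∷ μ) g
        ∎

    free : ∀ j → Lf j (x ∷ μ) g ≈ Rf j (x ∷ μ) g + prev (λ j → Rf j (x ∷ μ) g) j
    free zero = begin
      Lc 0 (x ∷ μ) g              ≈⟨ level= 0 ⟩
      Rc 0 (x ∷ μ) g              ≈⟨ +-identityʳ _ ⟨
      Rc 0 (x ∷ μ) g + 0#         ≈⟨ Rf-∷ 0 x μ g d ⟨
      Rf 0 (x ∷ μ) g              ≈⟨ +-identityʳ _ ⟨
      Rf 0 (x ∷ μ) g + 0#         ∎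
    free (suc j) = begin
      Lf (suc j) (x ∷ μ) g
        ≈⟨ Lf-split (suc j) (x ∷ μ) g ⟩
      Lu j (x ∷ μ) g + Lc (suc j) (x ∷ μ) g
        ≈⟨ +-cong (Lu-∷ j x μ g (desc-hd d)) (level= (suc j)) ⟩
      (Lc j (x ∷ μ) g + Lf j μ (g ∘ (suc x ∷_))) + Rc (suc j) (x ∷ μ) g
        ≈⟨ +-congʳ (+-cong (level= j) (let eq , _ = ih j (suc x) in eq)) ⟩
      (Rc j (x ∷ μ) g + (Rf j μ (g ∘ (suc x ∷_)) + prev (λ j → Rf j μ (g ∘ (suc x ∷_))) j)) + Rc (suc j) (x ∷ μ) g
        ≈⟨ solve 4 (λ a b c d → (a :+ (b :+ c)) :+ d := (d :+ b) :+ (a :+ c)) refl _ _ _ _ ⟩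
      (Rc (suc j) (x ∷ μ) g + Rf j μ (g ∘ (suc x ∷_))) + (Rc j (x ∷ μ) g + prev (λ j → Rf j μ (g ∘ (suc x ∷_))) j)
        ≈⟨ +-cong (Rf-∷ (suc j) x μ g d) (Rf-∷ j x μ g d) ⟨
      Rf (suc j) (x ∷ μ) g + Rf j (x ∷ μ) g
        ∎

-- Adding a vertical strip to a partition gives partitions

vstrips-sum : ∀ j μ → All (λ λ′ → sum λ′ ≡ j ℕ.+ sum μ) (vstrips j μ)
raised-sum  : ∀ j μ → All (λ λ′ → sum λ′ ≡ suc j ℕ.+ sum μ) (raised j μ)
level-sum   : ∀ j μ → All (λ λ′ → sum λ′ ≡ j ℕ.+ sum μ) (level j μ)

vstrips-sum zero    μ = level-sum zero μ
vstrips-sum (suc j) μ = All.++⁺ (raised-sum j μ) (level-sum (suc j) μ)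

raised-sum j [] = sum-1^ (suc j) ∷ []
  where
  sum-1^ : ∀ j → sum (replicate j 1) ≡ j ℕ.+ 0
  sum-1^ zero    = ≡.refl
  sum-1^ (suc j) = ≡.cong suc (sum-1^ j)
raised-sum j (x ∷ μ) = All.map⁺ (All.map (λ eq → ≡.cong suc (≡.trans (≡.cong (x ℕ.+_) eq)
  (ℕ-swap x j (sum μ)))) (vstrips-sum j μ))
  where
  ℕ-swap : ∀ a b c → a ℕ.+ (b ℕ.+ c) ≡ b ℕ.+ (a ℕ.+ c)
  ℕ-swap a b c = ≡.trans (≡.sym (ℕ.+-assoc a b c)) (≡.trans (≡.cong (ℕ._+ c) (ℕ.+-comm a b)) (ℕ.+-assoc b a c))

level-sum zero    []      = ≡.refl ∷ []
level-sum (suc j) []      = []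
level-sum j (x ∷ μ) rewrite level-∷ j x μ = All.map⁺ (All.map (λ {λ′} → shift λ′) (below (hd μ <ᵇ x)))
  where
  shift : ∀ λ′ → sum λ′ ≡ j ℕ.+ sum μ → x ℕ.+ sum λ′ ≡ j ℕ.+ (x ℕ.+ sum μ)
  shift λ′ eq = ≡.trans (≡.cong (x ℕ.+_) eq) (≡.trans (≡.sym (ℕ.+-assoc x j _))
    (≡.trans (≡.cong (ℕ._+ sum μ) (ℕ.+-comm x j)) (ℕ.+-assoc j x _)))
  below : ∀ b → All (λ λ′ → sum λ′ ≡ j ℕ.+ sum μ) (if b then vstrips j μ else level j μ)
  below true  = vstrips-sum j μ
  below false = level-sum j μ

vstrips-hd : ∀ j μ → All (λ λ′ → hd μ ≤ hd λ′ × hd λ′ ≤ suc (hd μ)) (vstrips j μ)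
vstrips-hd zero    μ = All.map (λ eq → ℕ.≤-reflexive (≡.sym eq) , ℕ.m≤n⇒m≤1+n (ℕ.≤-reflexive eq)) (level-hd 0 μ)
vstrips-hd (suc j) μ = All.++⁺
  (All.map (λ eq → ℕ.≤-trans (ℕ.n≤1+n _) (ℕ.≤-reflexive (≡.sym eq)) , ℕ.≤-reflexive eq) (raised-hd j μ))
  (All.map (λ eq → ℕ.≤-reflexive (≡.sym eq) , ℕ.m≤n⇒m≤1+n (ℕ.≤-reflexive eq)) (level-hd (suc j) μ))

Positive : Shape → Set
Positive = All (0 <_)

vstrips-desc : ∀ j {μ} → Descending μ → Positive μ → All (λ λ′ → Descending λ′ × Positive λ′) (vstrips j μ)
raised-desc  : ∀ j {μ} → Descending μ → Positive μ → All (λ λ′ → Descending λ′ × Positive λ′) (raised j μ)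
level-desc   : ∀ j {μ} → Descending μ → Positive μ → All (λ λ′ → Descending λ′ × Positive λ′) (level j μ)

vstrips-desc zero    d p = level-desc zero d p
vstrips-desc (suc j) d p = All.++⁺ (raised-desc j d p) (level-desc (suc j) d p)

1^-desc : ∀ j → Descending (replicate j 1) × Positive (replicate j 1)
1^-desc zero          = [] , []
1^-desc (suc zero)    = [-] , s≤s z≤n ∷ []
1^-desc (suc (suc j)) = let d , p = 1^-desc (suc j) in s≤s z≤n ∷ d , s≤s z≤n ∷ p

raised-desc j {[]}    d p = 1^-desc (suc j) ∷ []
raised-desc j {x ∷ μ} d (0<x ∷ p) = All.map⁺ (All.zipWith
  (λ { ((_ , h) , (dλ , pλ)) → desc-∷ (ℕ.≤-trans h (s≤s (desc-hd d))) dλ , s≤s z≤n ∷ pλ })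
  (vstrips-hd j μ , vstrips-desc j (Linked.tail d) p))

level-desc zero    {[]} d p = ([] , []) ∷ []
level-desc (suc j) {[]} d p = []
level-desc j {x ∷ μ} d (0<x ∷ p) rewrite level-∷ j x μ = All.map⁺ (below (hd μ ℕ.<? x))
  where
  below : ∀ dec → All (λ λ′ → Descending (x ∷ λ′) × Positive (x ∷ λ′)) (if does dec then vstrips j μ else level j μ)
  below (yes y<x) = All.zipWith
    (λ { ((_ , h) , (dλ , pλ)) → desc-∷ (ℕ.≤-trans h y<x) dλ , 0<x ∷ pλ })
    (vstrips-hd j μ , vstrips-desc j (Linked.tail d) p)
  below (no _) = All.zipWith
    (λ { (h , (dλ , pλ)) → desc-∷ (≡.subst (_≤ x) (≡.sym h) (desc-hd d)) dλ , 0<x ∷ pλ })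
    (level-hd j μ , level-desc j (Linked.tail d) p)

vstrips-⊢ : ∀ j {μ N} → μ ⊢ N → All (_⊢ j ℕ.+ N) (vstrips j μ)
vstrips-⊢ j {μ} (d , p , ≡.refl) = All.zipWith
  (λ { ((dλ , pλ) , s) → dλ , pλ , s }) (vstrips-desc j d p , vstrips-sum j μ)

+-∸-cancel : ∀ a j {m n} → n ≤ m → a ℕ.+ (m ∸ n) ≡ (a ℕ.+ j ℕ.+ m) ∸ (j ℕ.+ n)
+-∸-cancel a j {m} {n} n≤m = begin
  a ℕ.+ (m ∸ n)                   ≡⟨ ≡.cong (a ℕ.+_) (ℕ.[m+n]∸[m+o]≡n∸o j m n) ⟨
  a ℕ.+ ((j ℕ.+ m) ∸ (j ℕ.+ n))   ≡⟨ ℕ.+-∸-assoc a (ℕ.+-monoʳ-≤ j n≤m) ⟨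
  (a ℕ.+ (j ℕ.+ m)) ∸ (j ℕ.+ n)   ≡⟨ ≡.cong (_∸ (j ℕ.+ n)) (ℕ.+-assoc a j m) ⟨
  (a ℕ.+ j ℕ.+ m) ∸ (j ℕ.+ n)     ∎
  where open ≡.≡-Reasoning

-- The Pieri rule passes from R to R⟦z⟧.

module Step (R : CommutativeRing 0ℓ 0ℓ) where
  private module B = RingKit R
  private module ΣB = Sums R
  open PowerSeries R
  open RingKit ring⟦⟧
  open Sums ring⟦⟧
  open Strips ring⟦⟧ using (prev; Rf; Lf; exchange)
  open Elementary
  open B using () renaming (⟨R⟩ to ⟨B⟩)

  -- `zpow a r` is the monomial r z^a in the new variable z.
  zpow : ℕ → ⟨B⟩ → ⟨R⟩
  zpow zero    r         = const r
  zpow (suc a) r zero    = B.0#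
  zpow (suc a) r (suc n) = zpow a r n

  zpow-cong : ∀ a {r s} → r B.≈ s → zpow a r ≈ zpow a s
  zpow-cong zero    p zero    = p
  zpow-cong zero    p (suc n) = B.refl
  zpow-cong (suc a) p zero    = B.refl
  zpow-cong (suc a) p (suc n) = zpow-cong a p n

  zpow-0# : ∀ a → zpow a B.0# ≈ 0#
  zpow-0# zero    zero    = B.refl
  zpow-0# zero    (suc n) = B.refl
  zpow-0# (suc a) zero    = B.refl
  zpow-0# (suc a) (suc n) = zpow-0# a n

  zpow-+ : ∀ a r s → zpow a (r B.+ s) ≈ zpow a r + zpow a s
  zpow-+ zero    r s zero    = B.refl
  zpow-+ zero    r s (suc n) = B.sym (B.+-identityʳ _)
  zpow-+ (suc a) r s zero    = B.sym (B.+-identityʳ _)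
  zpow-+ (suc a) r s (suc n) = zpow-+ a r s n

  const-* : ∀ r b s → const r * zpow b s ≈ zpow b (r B.* s)
  const-* r b s n = B.trans (const-⊛ r (zpow b s) n) (scale b n)
    where
    scale : ∀ b n → r B.* zpow b s n B.≈ zpow b (r B.* s) n
    scale zero    zero    = B.refl
    scale zero    (suc n) = B.zeroʳ r
    scale (suc b) zero    = B.zeroʳ r
    scale (suc b) (suc n) = scale b n

  zpow-* : ∀ a b r s → zpow a r * zpow b s ≈ zpow (a ℕ.+ b) (r B.* s)
  zpow-* zero    b r s         = const-* r b s
  zpow-* (suc a) b r s zero    = B.zeroˡ _
  zpow-* (suc a) b r s (suc n) = B.trans (B.+-cong (B.zeroˡ _) (zpow-* a b r s n)) (B.+-identityˡ _)

  zpow-∑ : ∀ {A : Set} a (xs : List A) f → zpow a (ΣB.∑ xs f) ≈ ∑ xs (λ x → zpow a (f x))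
  zpow-∑ a []       f = zpow-0# a
  zpow-∑ a (x ∷ xs) f = trans (zpow-+ a (f x) (ΣB.∑ xs f)) (+-congˡ {zpow a (f x)} (zpow-∑ a xs f))

  ∑-coeff : ∀ {A : Set} (xs : List A) (f : A → ⟨R⟩) n → ∑ xs f n B.≈ ΣB.∑ xs (λ x → f x n)
  ∑-coeff []       f n = B.refl
  ∑-coeff (x ∷ xs) f n = B.+-congˡ (∑-coeff xs f n)

  e-const : ∀ {k} j (y : Fin k → ⟨B⟩) → e ring⟦⟧ j (const ∘ y) ≈ const (e R j y)
  e-const         zero    y = refl {const B.1#}
  e-const {zero}  (suc j) y = sym {const B.0#} {0#} (zpow-0# 0)
  e-const {suc k} (suc j) y = begin
    e ring⟦⟧ (suc j) (const ∘ y ∘ suc) + const (y zero) * e ring⟦⟧ j (const ∘ y ∘ suc)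
      ≈⟨ +-cong {x = e ring⟦⟧ (suc j) (const ∘ y ∘ suc)} (e-const (suc j) (y ∘ suc))
           (*-congˡ {const (y zero)} (e-const j (y ∘ suc))) ⟩
    const (e R (suc j) (y ∘ suc)) + const (y zero) * const (e R j (y ∘ suc))
      ≈⟨ +-congˡ {const (e R (suc j) (y ∘ suc))} (const-* (y zero) 0 _) ⟩
    const (e R (suc j) (y ∘ suc)) + const (y zero B.* e R j (y ∘ suc))
      ≈⟨ zpow-+ 0 _ _ ⟨
    const (e R (suc j) y)
      ∎

  module _ (E : ℕ → ⟨B⟩) (s : Shape → ⟨B⟩) where
    -- E_j + z E_{j-1}: the elementary functions with z as a further variable.
    E⁺ : ℕ → ⟨R⟩
    E⁺ j = const (E j) + prev (λ j → zpow 1 (E j)) j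

    -- The branching rule, taken as a definition: z is the variable of the largest letter, whose
    -- cells fill the horizontal strip `μ`/`ρ`.
    s⁺ : Shape → ⟨R⟩
    s⁺ μ = ∑ (hstrips μ) (λ ρ → zpow (sum μ ∸ sum ρ) (s ρ))

    module _ (pieri : ∀ j {μ} → Descending μ → E j B.* s μ B.≈ ΣB.∑ (vstrips j μ) s)
             (trailing : ∀ μ → s (μ ++ 0 ∷ []) B.≈ s μ) where

      private
        strip : ∀ a j {μ} → Descending μ →
          zpow a (E j) * s⁺ μ ≈ ∑ (hstrips μ) (λ ρ → ∑ (vstrips j ρ) (λ ν → zpow (a ℕ.+ (sum μ ∸ sum ρ)) (s ν)))
        strip a j {μ} d = begin
          zpow a (E j) * s⁺ μ
            ≈⟨ ∑-*ˡ (hstrips μ) (zpow a (E j)) (λ ρ → zpow (sum μ ∸ sum ρ) (s ρ)) ⟨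
          ∑ (hstrips μ) (λ ρ → zpow a (E j) * zpow (sum μ ∸ sum ρ) (s ρ))
            ≈⟨ ∑-cong-All (All.map (λ {ρ} (dρ , _) →
                 trans {zpow a (E j) * zpow (sum μ ∸ sum ρ) (s ρ)} (zpow-* a _ (E j) (s ρ))
                   (trans {zpow (a ℕ.+ (sum μ ∸ sum ρ)) (E j B.* s ρ)}
                     (zpow-cong (a ℕ.+ (sum μ ∸ sum ρ)) (pieri j dρ)) (zpow-∑ (a ℕ.+ (sum μ ∸ sum ρ)) (vstrips j ρ) s)))
                 (hstrips-⊆ d)) ⟩
          ∑ (hstrips μ) (λ ρ → ∑ (vstrips j ρ) (λ ν → zpow (a ℕ.+ (sum μ ∸ sum ρ)) (s ν)))
            ∎

        -- The exponent of z depends only on the sizes of the shapes. Hence one function serves both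
        -- orders of adding and removing strips, and also the `prev` term, whose vertical strip is a
        -- cell smaller but comes with a factor z.
        g : ℕ → Shape → Shape → ⟨R⟩
        g j μ ν = zpow ((j ℕ.+ sum μ) ∸ sum ν) (s ν)

        strip-Rf : ∀ a j {μ} → Descending μ → zpow a (E j) * s⁺ μ ≈ Rf j μ (g (a ℕ.+ j) μ)
        strip-Rf a j {μ} d = trans {zpow a (E j) * s⁺ μ} (strip a j d)
          (∑-cong-All (All.map (λ {ρ} (_ , _ , ρ≤μ) →
            ∑-cong-All (All.map (λ {ν} eq → reflexive (≡.cong (λ h → zpow h (s ν)) (exponent ρ ν ρ≤μ eq)))
              (vstrips-sum j ρ))) (hstrips-⊆ d)))
          where
          exponent : ∀ ρ ν → sum ρ ≤ sum μ → sum ν ≡ j ℕ.+ sum ρ → a ℕ.+ (sum μ ∸ sum ρ) ≡ (a ℕ.+ j ℕ.+ sum μ) ∸ sum ν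
          exponent ρ ν ρ≤μ eq = ≡.trans (+-∸-cancel a j ρ≤μ) (≡.cong ((a ℕ.+ j ℕ.+ sum μ) ∸_) (≡.sym eq))

      pieri⁺ : ∀ j {μ} → Descending μ → E⁺ j * s⁺ μ ≈ ∑ (vstrips j μ) s⁺
      pieri⁺ j {μ} d = begin
        E⁺ j * s⁺ μ
          ≈⟨ distribʳ (s⁺ μ) (const (E j)) (prev (λ j → zpow 1 (E j)) j) ⟩
        const (E j) * s⁺ μ + prev (λ j → zpow 1 (E j)) j * s⁺ μ
          ≈⟨ +-cong {x = const (E j) * s⁺ μ} (strip-Rf 0 j d) (second j) ⟩
        Rf j μ (g j μ) + prev (λ i → Rf i μ (g j μ)) j
          ≈⟨ proj₁ (exchange j (g j μ) d (λ ν →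
               trans {zpow ((j ℕ.+ sum μ) ∸ sum (ν ++ 0 ∷ [])) (s (ν ++ 0 ∷ []))}
                 (zpow-cong ((j ℕ.+ sum μ) ∸ sum (ν ++ 0 ∷ [])) (trailing ν))
                 (reflexive (≡.cong (λ h → zpow ((j ℕ.+ sum μ) ∸ h) (s ν))
                   (≡.trans (sum-++ ν (0 ∷ [])) (ℕ.+-identityʳ _)))))) ⟨
        Lf j μ (g j μ)
          ≈⟨ ∑-cong-All (All.map (λ {λ′} eq → ∑-cong (hstrips λ′) λ ν →
               reflexive (≡.cong (λ h → zpow (h ∸ sum ν) (s ν)) (≡.sym eq))) (vstrips-sum j μ)) ⟩
        ∑ (vstrips j μ) s⁺
          ∎
        where
        second : ∀ j → prev (λ j → zpow 1 (E j)) j * s⁺ μ ≈ prev (λ i → Rf i μ (g j μ)) j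
        second zero    = zeroˡ (s⁺ μ)
        second (suc j) = strip-Rf 1 j d

      trailing⁺ : ∀ μ → s⁺ (μ ++ 0 ∷ []) ≈ s⁺ μ
      trailing⁺ μ = trans {s⁺ (μ ++ 0 ∷ [])} (∑-hstrips-0 μ (λ ρ → zpow (sum (μ ++ 0 ∷ []) ∸ sum ρ) (s ρ)))
        (∑-cong (hstrips μ) λ ρ →
          trans {zpow (sum (μ ++ 0 ∷ []) ∸ sum (ρ ++ 0 ∷ [])) (s (ρ ++ 0 ∷ []))}
            (zpow-cong (sum (μ ++ 0 ∷ []) ∸ sum (ρ ++ 0 ∷ [])) (trailing ρ))
            (reflexive (≡.cong₂ (λ h i → zpow (h ∸ i) (s ρ)) (sum-0 μ) (sum-0 ρ))))
        where
        sum-0 : ∀ μ → sum (μ ++ 0 ∷ []) ≡ sum μ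
        sum-0 μ = ≡.trans (sum-++ μ (0 ∷ [])) (ℕ.+-identityʳ _)

        hd-0 : ∀ μ → hd (μ ++ 0 ∷ []) ≡ hd μ
        hd-0 []      = ≡.refl
        hd-0 (_ ∷ _) = ≡.refl

        ∑-hstrips-0 : ∀ μ f → ∑ (hstrips (μ ++ 0 ∷ [])) f ≈ ∑ (hstrips μ) (λ ρ → f (ρ ++ 0 ∷ []))
        ∑-hstrips-0 []      f = refl {f (0 ∷ []) + 0#}
        ∑-hstrips-0 (x ∷ μ) f = begin
          ∑ (hstrips (x ∷ μ ++ 0 ∷ [])) f
            ≈⟨ ∑-product _∷_ (from (hd (μ ++ 0 ∷ [])) (suc (x ∸ hd (μ ++ 0 ∷ [])))) (hstrips (μ ++ 0 ∷ [])) f ⟩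
          ∑ (from (hd (μ ++ 0 ∷ [])) (suc (x ∸ hd (μ ++ 0 ∷ [])))) (λ i → ∑ (hstrips (μ ++ 0 ∷ [])) (f ∘ (i ∷_)))
            ≈⟨ ∑-cong (from (hd (μ ++ 0 ∷ [])) (suc (x ∸ hd (μ ++ 0 ∷ [])))) (λ i → ∑-hstrips-0 μ (f ∘ (i ∷_))) ⟩
          ∑ (from (hd (μ ++ 0 ∷ [])) (suc (x ∸ hd (μ ++ 0 ∷ [])))) (λ i → ∑ (hstrips μ) (λ ρ → f (i ∷ ρ ++ 0 ∷ [])))
            ≡⟨ ≡.cong (λ h → ∑ (from h (suc (x ∸ h))) (λ i → ∑ (hstrips μ) (λ ρ → f (i ∷ ρ ++ 0 ∷ [])))) (hd-0 μ) ⟩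
          ∑ (from (hd μ) (suc (x ∸ hd μ))) (λ i → ∑ (hstrips μ) (λ ρ → f (i ∷ ρ ++ 0 ∷ [])))
            ≈⟨ ∑-product _∷_ (from (hd μ) (suc (x ∸ hd μ))) (hstrips μ) (λ ρ → f (ρ ++ 0 ∷ [])) ⟨
          ∑ (hstrips (x ∷ μ)) (λ ρ → f (ρ ++ 0 ∷ []))
            ∎

-- Series in k variables and their Schur functions

-- The letter k of Fin (suc k) is the outermost variable.
Poly : ℕ → CommutativeRing 0ℓ 0ℓ
Poly zero    = ℚ.+-*-commutativeRing
Poly (suc k) = PowerSeries.ring⟦⟧ (Poly k)

⟨Poly⟩ : ℕ → Set
⟨Poly⟩ k = CommutativeRing.Carrier (Poly k)

module _ {k : ℕ} where
  count : List (Fin k) → Fin k → ℕ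
  count w i = length (filter (i Fin.≟_) w)

  count-++ : ∀ v w i → count (v ++ w) i ≡ count v i ℕ.+ count w i
  count-++ v w i = ≡.trans (≡.cong length (filter-++ (i Fin.≟_) v w)) (length-++ (filter (i Fin.≟_) v))

count-inject₁ : ∀ {k} (w : List (Fin k)) i → count (map inject₁ w) (inject₁ i) ≡ count w i
count-inject₁ []      i = ≡.refl
count-inject₁ (c ∷ w) i with i Fin.≟ c | inject₁ i Fin.≟ inject₁ c
... | yes _   | yes _ = ≡.cong suc (count-inject₁ w i)
... | no _    | no _  = count-inject₁ w i
... | yes i≡c | no p  = contradiction (≡.cong inject₁ i≡c) p
... | no i≢c  | yes p = contradiction (Fin.inject₁-injective p) i≢c

count-inject₁-top : ∀ {k} (w : List (Fin k)) → count (map inject₁ w) (Fin.fromℕ k) ≡ 0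
count-inject₁-top []      = ≡.refl
count-inject₁-top {k} (c ∷ w) with Fin.fromℕ k Fin.≟ inject₁ c
... | yes p = contradiction p Fin.fromℕ≢inject₁
... | no _  = count-inject₁-top w

count-top : ∀ k n → count (replicate n (Fin.fromℕ k)) (Fin.fromℕ k) ≡ n
count-top k zero    = ≡.refl
count-top k (suc n) with Fin.fromℕ k Fin.≟ Fin.fromℕ k
... | yes _ = ≡.cong suc (count-top k n)
... | no p  = contradiction ≡.refl p

count-top-inject₁ : ∀ {k} n (i : Fin k) → count (replicate n (Fin.fromℕ k)) (inject₁ i) ≡ 0
count-top-inject₁ zero    i = ≡.refl
count-top-inject₁ {k} (suc n) i with inject₁ i Fin.≟ Fin.fromℕ k
... | yes p = contradiction (≡.sym p) Fin.fromℕ≢inject₁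
... | no _  = count-top-inject₁ n i

monomial : ∀ k → (Fin k → ℕ) → ⟨Poly⟩ k
monomial zero    β = 1ℚ
monomial (suc k) β = Step.zpow (Poly k) (β (Fin.fromℕ k)) (monomial k (β ∘ inject₁))

monomial-cong : ∀ k {β γ} → (∀ i → β i ≡ γ i) → CommutativeRing._≈_ (Poly k) (monomial k β) (monomial k γ)
monomial-cong zero    p = ≡.refl
monomial-cong (suc k) {β} {γ} p = trans {monomial (suc k) β}
  (reflexive (≡.cong (λ h → zpow h (monomial k (β ∘ inject₁))) (p (Fin.fromℕ k))))
  (zpow-cong (γ (Fin.fromℕ k)) (monomial-cong k (p ∘ inject₁)))
  where
  open Step (Poly k)
  open CommutativeRing (Poly (suc k))

monomial-* : ∀ k β γ → let open CommutativeRing (Poly k) in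
  monomial k β * monomial k γ ≈ monomial k (λ i → β i ℕ.+ γ i)
monomial-* zero    β γ = ≡.refl
monomial-* (suc k) β γ = trans {monomial (suc k) β * monomial (suc k) γ}
  (zpow-* (β top) (γ top) (monomial k (β ∘ inject₁)) (monomial k (γ ∘ inject₁)))
  (zpow-cong (β top ℕ.+ γ top) (monomial-* k (β ∘ inject₁) (γ ∘ inject₁)))
  where
  open Step (Poly k)
  open CommutativeRing (Poly (suc k))
  top = Fin.fromℕ k

word : ∀ {k} → List (Fin k) → ⟨Poly⟩ k
word {k} w = monomial k (count w)

var : ∀ k → Fin k → ⟨Poly⟩ k
var k c = word (c ∷ [])

word-++ : ∀ {k} (v w : List (Fin k)) → let open CommutativeRing (Poly k) in word v * word w ≈ word (v ++ w)
word-++ {k} v w = trans (monomial-* k (count v) (count w))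
  (monomial-cong k λ i → ≡.sym (count-++ v w i))
  where open CommutativeRing (Poly k)

word-[] : ∀ k → let open CommutativeRing (Poly k) in word {k} [] ≈ 1#
word-[] zero    = ≡.refl
word-[] (suc k) = Step.zpow-cong (Poly k) 0 (word-[] k)

word-top : ∀ {k} (w : List (Fin k)) n →
  let open CommutativeRing (Poly (suc k)) in
  word (map inject₁ w ++ replicate n (Fin.fromℕ k)) ≈ Step.zpow (Poly k) n (word w)
word-top {k} w n = trans {word (map inject₁ w ++ tops)}
  (reflexive (≡.cong (λ h → zpow h (monomial k (count (map inject₁ w ++ tops) ∘ inject₁))) at-top))
  (zpow-cong n (monomial-cong k at-rest))
  where
  open Step (Poly k)
  open CommutativeRing (Poly (suc k))
  tops = replicate n (Fin.fromℕ k)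

  at-top : count (map inject₁ w ++ tops) (Fin.fromℕ k) ≡ n
  at-top = ≡.trans (count-++ (map inject₁ w) tops _) (≡.cong₂ ℕ._+_ (count-inject₁-top w) (count-top k n))

  at-rest : ∀ i → count (map inject₁ w ++ tops) (inject₁ i) ≡ count w i
  at-rest i = ≡.trans (count-++ (map inject₁ w) tops _)
    (≡.trans (≡.cong₂ ℕ._+_ (count-inject₁ w i) (count-top-inject₁ n i)) (ℕ.+-identityʳ _))

elem : ∀ k → ℕ → ⟨Poly⟩ k
elem k j = Elementary.e (Poly k) j (var k)

-- Defined by branching, the form in which the Pieri rule passes to one more variable; `s-tableaux`
-- identifies it with the sum over tableaux. Without variables only shapes without cells give 1.
s : ∀ k → Shape → ⟨Poly⟩ k
s zero    μ = Sums.[_] (Poly 0) (sum μ ℕ.≟ 0)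
s (suc k) μ = Step.s⁺ (Poly k) (elem k) (s k) μ

elem-suc : ∀ k j → let open CommutativeRing (Poly (suc k)) in
  elem (suc k) j ≈ Step.E⁺ (Poly k) (elem k) (s k) j
elem-suc k zero = sym {const 1# + 0ₛ} {const 1#} (+-identityʳ (const 1#))
  where
  open PowerSeries (Poly k)
  open CommutativeRing (Poly k) using (1#)
  open CommutativeRing (Poly (suc k)) using (sym; _+_; +-identityʳ) renaming (0# to 0ₛ)
elem-suc k (suc j) = begin
  e (suc j) (var (suc k))
    ≈⟨ e-top j (var (suc k)) ⟩
  e (suc j) (var (suc k) ∘ inject₁) + var (suc k) (Fin.fromℕ k) * e j (var (suc k) ∘ inject₁)
    ≈⟨ +-cong {e (suc j) (var (suc k) ∘ inject₁)} (rest (suc j))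
         (*-cong {var (suc k) (Fin.fromℕ k)} top (rest j)) ⟩
  const (elem k (suc j)) + zpow 1 1# * const (elem k j)
    ≈⟨ +-congˡ {const (elem k (suc j))} (trans {zpow 1 1# * const (elem k j)} (zpow-* 1 0 1# (elem k j))
         (zpow-cong 1 (CommutativeRing.*-identityˡ (Poly k) (elem k j)))) ⟩
  const (elem k (suc j)) + zpow 1 (elem k j)
    ∎
  where
  open Step (Poly k)
  open PowerSeries (Poly k) using (const)
  open CommutativeRing (Poly k) using (1#)
  open RingKit (Poly (suc k)) hiding (1#)
  open Elementary (Poly (suc k))

  top : var (suc k) (Fin.fromℕ k) ≈ zpow 1 1#
  top = trans {var (suc k) (Fin.fromℕ k)} (word-top {k} [] 1) (zpow-cong 1 (word-[] k))

  rest : ∀ j → e j (var (suc k) ∘ inject₁) ≈ const (elem k j)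
  rest j = trans {e j (var (suc k) ∘ inject₁)}
    (e-cong j {var (suc k) ∘ inject₁} {const ∘ var k} (λ i → word-top (i ∷ []) 0)) (e-const j (var k))

pieri : ∀ k j {μ} → Descending μ → let open CommutativeRing (Poly k) in
  elem k j * s k μ ≈ Sums.∑ (Poly k) (vstrips j μ) (s k)
trailing : ∀ k μ → let open CommutativeRing (Poly k) in s k (μ ++ 0 ∷ []) ≈ s k μ

pieri zero zero {μ} d = begin
  1ℚ * s 0 μ              ≈⟨ solve 1 (λ a → con (+ 1) :* a := a :+ con (+ 0)) refl (s 0 μ) ⟩
  s 0 μ + 0ℚ              ≡⟨ ≡.cong (λ h → ∑ h (s 0)) (vstrips-0 μ) ⟨
  ∑ (vstrips 0 μ) (s 0)   ∎
  where
  open RingKit (Poly 0)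
  open Sums (Poly 0)
  open Solver
pieri zero (suc j) {μ} d = begin
  elem 0 (suc j) * s 0 μ          ≈⟨ zeroˡ (s 0 μ) ⟩
  0ℚ                              ≈⟨ ∑-zero (vstrips (suc j) μ) (λ _ → refl) ⟨
  ∑ (vstrips (suc j) μ) (λ _ → 0ℚ)  ≈⟨ ∑-cong-All (All.map (λ {λ′} eq →
                                     []-no (sum λ′ ℕ.≟ 0) λ eq₀ → ℕ.1+n≢0 (≡.trans (≡.sym eq) eq₀))
                                       (vstrips-sum (suc j) μ)) ⟨
  ∑ (vstrips (suc j) μ) (s 0)     ∎
  where
  open RingKit (Poly 0)
  open Sums (Poly 0)
pieri (suc k) j {μ} d = trans {elem (suc k) j * s (suc k) μ}
  (*-congʳ {s (suc k) μ} (elem-suc k j))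
  (Step.pieri⁺ (Poly k) (elem k) (s k) (pieri k) (trailing k) j d)
  where open CommutativeRing (Poly (suc k))

trailing zero    μ = Sums.[]-cong (Poly 0) (sum (μ ++ 0 ∷ []) ℕ.≟ 0) (sum μ ℕ.≟ 0)
  (≡.trans (≡.sym eq)) (≡.trans eq)
  where
  eq : sum (μ ++ 0 ∷ []) ≡ sum μ
  eq = ≡.trans (sum-++ μ (0 ∷ [])) (ℕ.+-identityʳ _)
trailing (suc k) μ = Step.trailing⁺ (Poly k) (elem k) (s k) (pieri k) (trailing k) μ

s-[] : ∀ k → let open CommutativeRing (Poly k) in s k [] ≈ 1#
s-[] zero    = ≡.refl
s-[] (suc k) = trans {s (suc k) []} (+-identityʳ _) (Step.zpow-cong (Poly k) 0 (s-[] k))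
  where open CommutativeRing (Poly (suc k))

-- The Pieri rule for the empty shape, on which a column is the only vertical strip.
elem-s : ∀ k j → let open CommutativeRing (Poly k) in elem k j ≈ s k (1^ j)
elem-s k j = begin
  elem k j               ≈⟨ *-identityʳ _ ⟨
  elem k j * 1#          ≈⟨ *-congˡ (s-[] k) ⟨
  elem k j * s k []      ≈⟨ pieri k j [] ⟩
  ∑ (vstrips j []) (s k) ≡⟨ ≡.cong (λ h → ∑ h (s k)) (vstrips-[] j) ⟩
  s k (1^ j) + 0#        ≈⟨ +-identityʳ _ ⟩
  s k (1^ j)             ∎
  where
  open RingKit (Poly k)
  open Sums (Poly k)

-- Counts as coefficients of series

coeff : ∀ k → ⟨Poly⟩ k → (Fin k → ℕ) → ℚ
coeff zero    q β = q
coeff (suc k) f β = coeff k (f (β (Fin.fromℕ k))) (β ∘ inject₁)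

module _ where
  private module Polyₖ (k : ℕ) = CommutativeRing (Poly k)

  coeff-cong : ∀ k {f g} β → Polyₖ._≈_ k f g → coeff k f β ≡ coeff k g β
  coeff-cong zero    β eq = eq
  coeff-cong (suc k) β eq = coeff-cong k (β ∘ inject₁) (eq (β (Fin.fromℕ k)))

  coeff-+ : ∀ k f g β → coeff k (Polyₖ._+_ k f g) β ≡ coeff k f β ℚ.+ coeff k g β
  coeff-+ zero    f g β = ≡.refl
  coeff-+ (suc k) f g β = coeff-+ k (f (β (Fin.fromℕ k))) (g (β (Fin.fromℕ k))) (β ∘ inject₁)

  coeff-0# : ∀ k β → coeff k (Polyₖ.0# k) β ≡ 0ℚ
  coeff-0# zero    β = ≡.refl
  coeff-0# (suc k) β = coeff-0# k (β ∘ inject₁)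

  coeff-∑ : ∀ k {A : Set} (xs : List A) f β →
    coeff k (Sums.∑ (Poly k) xs f) β ≡ Sums.∑ (Poly 0) xs (λ x → coeff k (f x) β)
  coeff-∑ k []       f β = coeff-0# k β
  coeff-∑ k (x ∷ xs) f β = ≡.trans (coeff-+ k (f x) _ β) (≡.cong (coeff k (f x) β ℚ.+_) (coeff-∑ k xs f β))

  coeff-ι : ∀ k n f β → coeff k (Polyₖ._*_ k (RingKit.ι (Poly k) n) f) β ≡ RingKit.ι (Poly 0) n ℚ.* coeff k f β
  coeff-ι k zero    f β = ≡.trans (coeff-cong k β (Polyₖ.zeroˡ k f))
    (≡.trans (coeff-0# k β) (≡.sym (ℚ.*-zeroˡ (coeff k f β))))
  coeff-ι k (suc n) f β = begin
    coeff k ((1# + ι n) * f) β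
      ≡⟨ coeff-cong k β (trans (distribʳ f 1# (ι n)) (+-congʳ (*-identityˡ f))) ⟩
    coeff k (f + ι n * f) β
      ≡⟨ coeff-+ k f (ι n * f) β ⟩
    coeff k f β ℚ.+ coeff k (ι n * f) β
      ≡⟨ ≡.cong₂ ℚ._+_ (≡.sym (ℚ.*-identityˡ (coeff k f β))) (coeff-ι k n f β) ⟩
    1ℚ ℚ.* coeff k f β ℚ.+ RingKit.ι (Poly 0) n ℚ.* coeff k f β
      ≡⟨ ℚ.*-distribʳ-+ (coeff k f β) 1ℚ (RingKit.ι (Poly 0) n) ⟨
    RingKit.ι (Poly 0) (suc n) ℚ.* coeff k f β
      ∎
    where
    open CommutativeRing (Poly k)
    open RingKit (Poly k) using (ι)
    open ≡.≡-Reasoning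

  coeff-zpow-≡ : ∀ k n f (β : Fin (suc k) → ℕ) → n ≡ β (Fin.fromℕ k) →
    coeff (suc k) (Step.zpow (Poly k) n f) β ≡ coeff k f (β ∘ inject₁)
  coeff-zpow-≡ k n f β eq = ≡.cong (λ g → coeff k g (β ∘ inject₁)) (at n _ eq)
    where
    at : ∀ n m → n ≡ m → Step.zpow (Poly k) n f m ≡ f
    at zero    .zero    ≡.refl = ≡.refl
    at (suc n) .(suc n) ≡.refl = at n n ≡.refl

  coeff-zpow-≢ : ∀ k n f (β : Fin (suc k) → ℕ) → n ≢ β (Fin.fromℕ k) →
    coeff (suc k) (Step.zpow (Poly k) n f) β ≡ 0ℚ
  coeff-zpow-≢ k n f β n≢ = ≡.trans (≡.cong (λ g → coeff k g (β ∘ inject₁)) (at n _ n≢)) (coeff-0# k (β ∘ inject₁))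
    where
    at : ∀ n m → n ≢ m → Step.zpow (Poly k) n f m ≡ Polyₖ.0# k
    at zero    zero    p = contradiction ≡.refl p
    at zero    (suc m) p = ≡.refl
    at (suc n) zero    p = ≡.refl
    at (suc n) (suc m) p = at n m (p ∘ ≡.cong suc)

  ∀-top : ∀ {k} {P : Fin (suc k) → Set} → P (Fin.fromℕ k) → (∀ i → P (inject₁ i)) → ∀ i → P i
  ∀-top {zero}      p q zero    = p
  ∀-top {suc k}     p q zero    = q zero
  ∀-top {suc k} {P} p q (suc i) = ∀-top {k} {P ∘ suc} p (q ∘ suc) i

  coeff-monomial : ∀ k γ β → (d : Dec (∀ i → γ i ≡ β i)) → coeff k (monomial k γ) β ≡ Sums.[_] (Poly 0) d
  coeff-monomial zero    γ β d = ≡.sym (Sums.[]-yes (Poly 0) d λ ())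
  coeff-monomial (suc k) γ β d with γ (Fin.fromℕ k) ℕ.≟ β (Fin.fromℕ k)
  ... | no ≢  = ≡.trans (coeff-zpow-≢ k _ _ β ≢) (≡.sym (Sums.[]-no (Poly 0) d λ eq → ≢ (eq _)))
  ... | yes ≡ = ≡.trans (coeff-zpow-≡ k _ _ β ≡) (≡.trans
    (coeff-monomial k (γ ∘ inject₁) (β ∘ inject₁) d′)
    (Sums.[]-cong (Poly 0) d′ d (∀-top ≡) (_∘ inject₁)))
    where d′ = Fin.all? (λ i → γ (inject₁ i) ℕ.≟ β (inject₁ i))

map-allFin-≡ : (α : List ℕ) (f : Fin (length α) → ℕ) → map f (allFin (length α)) ≡ α → ∀ i → f i ≡ lookup α i
map-allFin-≡ α f eq i = go α f (≡.trans (≡.sym (map-tabulate id f)) eq) i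
  where
  go : (α : List ℕ) (f : Fin (length α) → ℕ) → tabulate f ≡ α → ∀ i → f i ≡ lookup α i
  go (a ∷ α) f eq zero    = proj₁ (∷-injective eq)
  go (a ∷ α) f eq (suc i) = go α (f ∘ suc) (proj₂ (∷-injective eq)) i

≡-map-allFin : (α : List ℕ) (f : Fin (length α) → ℕ) → (∀ i → f i ≡ lookup α i) → map f (allFin (length α)) ≡ α
≡-map-allFin α f eq = ≡.trans (map-tabulate id f) (go α f eq)
  where
  go : (α : List ℕ) (f : Fin (length α) → ℕ) → (∀ i → f i ≡ lookup α i) → tabulate f ≡ α
  go []      f eq = ≡.refl
  go (a ∷ α) f eq = ≡.cong₂ _∷_ (eq zero) (go α (f ∘ suc) (eq ∘ suc))

coeff-word : ∀ (α : List ℕ) w → coeff (length α) (word w) (lookup α) ≡ Sums.[_] (Poly 0) (exponents? w α)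
coeff-word α w = ≡.trans (coeff-monomial _ (count w) (lookup α) d)
  (Sums.[]-cong (Poly 0) d (exponents? w α) (≡-map-allFin α (count w)) (map-allFin-≡ α (count w)))
  where d = Fin.all? (λ i → count w i ℕ.≟ lookup α i)

-- `+ n / 1` is normalised by a gcd and does not compute for a variable `n`; coprimality with 1
-- brings it into canonical form.
fromℕ-suc : ∀ n → fromℕ (suc n) ≡ 1ℚ ℚ.+ fromℕ n
fromℕ-suc n = ≡.sym (≡.trans (≡.cong (1ℚ ℚ.+_) (ℚ.normalize-coprime {n} {0} coprime))
  (≡.cong (λ h → (+ 1 ℤ.* + 1 ℤ.+ h) ℚ./ 1) (ℤ.*-identityʳ (+ n))))
  where
  coprime = Coprime.sym (1-coprimeTo n)

fromℕ≡ι : ∀ n → fromℕ n ≡ RingKit.ι (Poly 0) n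
fromℕ≡ι zero    = ≡.refl
fromℕ≡ι (suc n) = ≡.trans (fromℕ-suc n) (≡.cong (1ℚ ℚ.+_) (fromℕ≡ι n))

fromℕ-filter : ∀ {A : Set} {P : Pred A 0ℓ} (P? : Decidable P) xs →
  fromℕ (length (filter P? xs)) ≡ Sums.∑ (Poly 0) xs (λ x → Sums.[_] (Poly 0) (P? x))
fromℕ-filter P? []       = ≡.refl
fromℕ-filter P? (x ∷ xs) with P? x
... | yes _ = ≡.trans (fromℕ-suc (length (filter P? xs))) (≡.cong (1ℚ ℚ.+_) (fromℕ-filter P? xs))
... | no  _ = ≡.trans (fromℕ-filter P? xs) (≡.sym (ℚ.+-identityˡ (Sums.∑ (Poly 0) xs (λ x → Sums.[_] (Poly 0) (P? x)))))

module _ {k : ℕ} where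
  open RingKit (Poly k)
  open Sums (Poly k)

  coeff-[] : ∀ {P : Set} (d : Dec P) f β → coeff k ([ d ] * f) β ≡ Sums.[_] (Poly 0) d ℚ.* coeff k f β
  coeff-[] (yes _) f β = ≡.trans (coeff-cong k β (*-identityˡ f)) (≡.sym (ℚ.*-identityˡ (coeff k f β)))
  coeff-[] (no _)  f β = ≡.trans (coeff-cong k β (zeroˡ f)) (≡.trans (coeff-0# k β) (≡.sym (ℚ.*-zeroˡ (coeff k f β))))

-- Schur functions as sums over semistandard tableaux

rows : ∀ k → ℕ → List (List (Fin k))
rows k r = map Vec.toList (words k r)

Sorted : ∀ {k} → List (Fin k) → Set
Sorted = Linked Fin._≤_

sorted? : ∀ {k} → Decidable (Sorted {k})
sorted? = linked? Fin._≤?_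

HeadGE : ∀ {k} → Fin k → List (Fin k) → Set
HeadGE c []      = ⊤
HeadGE c (d ∷ _) = c Fin.≤ d

headGE? : ∀ {k} (c : Fin k) → Decidable (HeadGE c)
headGE? c []      = yes tt
headGE? c (d ∷ _) = c Fin.≤? d

sorted-∷ : ∀ {k} {c : Fin k} {w} → HeadGE c w → Sorted w → Sorted (c ∷ w)
sorted-∷ {w = []}    h s = [-]
sorted-∷ {w = _ ∷ _} h s = h ∷ s

sorted-head : ∀ {k} {c : Fin k} {w} → Sorted (c ∷ w) → HeadGE c w × Sorted w
sorted-head [-]     = tt , []
sorted-head (h ∷ s) = h , s

columnStrict? : ∀ {k} (u v : List (Fin k)) → Dec (ColumnStrict u v)
columnStrict? u v = All.all? (λ (i , j) → i Fin.<? j) (zip u v)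

-- Every sorted row has this form: smaller letters followed by copies of the largest one.
extend : ∀ {k} → List (Fin k) → ℕ → List (Fin (suc k))
extend {k} w n = map inject₁ w ++ replicate n (Fin.fromℕ k)

extend-HeadGE : ∀ {k} (c : Fin k) w n → HeadGE c w → HeadGE (inject₁ c) (extend w n)
extend-HeadGE c []      zero    h = tt
extend-HeadGE c []      (suc n) h = Fin.≤fromℕ (inject₁ c)
extend-HeadGE c (d ∷ w) n       h = ≡.subst₂ ℕ._≤_ (≡.sym (Fin.toℕ-inject₁ c)) (≡.sym (Fin.toℕ-inject₁ d)) h

restrict-HeadGE : ∀ {k} (c : Fin k) w n → HeadGE (inject₁ c) (extend w n) → HeadGE c w
restrict-HeadGE c []      n h = tt
restrict-HeadGE c (d ∷ w) n h = ≡.subst₂ ℕ._≤_ (Fin.toℕ-inject₁ c) (Fin.toℕ-inject₁ d) h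

top-HeadGE : ∀ k n → HeadGE (Fin.fromℕ k) (replicate n (Fin.fromℕ k))
top-HeadGE k zero    = tt
top-HeadGE k (suc n) = Fin.≤-refl

¬top-HeadGE : ∀ {k} (d : Fin k) w n → ¬ HeadGE (Fin.fromℕ k) (extend (d ∷ w) n)
¬top-HeadGE {k} d w n h = ℕ.<⇒≱ (Fin.toℕ<n d)
  (≡.subst₂ ℕ._≤_ (Fin.toℕ-fromℕ k) (Fin.toℕ-inject₁ d) h)

strict-[] : ∀ {k} (u : List (Fin k)) → ColumnStrict u []
strict-[] []      = []
strict-[] (_ ∷ _) = []

-- Nothing can stand below a largest letter, so the whole lower row lies under `u`: this is the
-- horizontal strip condition. The hypothesis on lengths is there because `zip` would ignore a lower
-- row that overhangs.
strict-restrict : ∀ {k} (u v : List (Fin k)) a b → length v ℕ.+ b ≤ length u ℕ.+ a →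
  ColumnStrict (extend u a) (extend v b) → length v ℕ.+ b ≤ length u × ColumnStrict u v
strict-restrict []      []      a       zero    l cs = z≤n , []
strict-restrict []      []      (suc a) (suc b) l (c ∷ cs) = contradiction c (ℕ.<-irrefl ≡.refl)
strict-restrict []      (d ∷ v) (suc a) b       l (c ∷ cs) = contradiction c (ℕ.≤⇒≯ (Fin.≤fromℕ (inject₁ d)))
strict-restrict (c ∷ u) []      a       zero    l cs = z≤n , []
strict-restrict (c ∷ u) []      a       (suc b) (s≤s l) (_ ∷ cs) =
  let l′ , _ = strict-restrict u [] a b l cs in s≤s l′ , []
strict-restrict (c ∷ u) (d ∷ v) a b (s≤s l) (c<d ∷ cs) =
  let l′ , cs′ = strict-restrict u v a b l cs
  in s≤s l′ , ≡.subst₂ ℕ._<_ (Fin.toℕ-inject₁ c) (Fin.toℕ-inject₁ d) c<d ∷ cs′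

inject₁<top : ∀ {k} (c : Fin k) → inject₁ c Fin.< Fin.fromℕ k
inject₁<top {k} c = ≡.subst₂ ℕ._<_ (≡.sym (Fin.toℕ-inject₁ c)) (≡.sym (Fin.toℕ-fromℕ k)) (Fin.toℕ<n c)

strict-extend : ∀ {k} (u v : List (Fin k)) a b → length v ℕ.+ b ≤ length u →
  ColumnStrict u v → ColumnStrict (extend u a) (extend v b)
strict-extend []      []      zero    zero    l cs = []
strict-extend []      []      (suc a) zero    l cs = []
strict-extend (c ∷ u) []      a zero    l cs = []
strict-extend (c ∷ u) []      a (suc b) (s≤s l) cs = inject₁<top c ∷ strict-extend u [] a b l (strict-[] u)
strict-extend (c ∷ u) (d ∷ v) a b (s≤s l) (c<d ∷ cs) =
  ≡.subst₂ ℕ._<_ (≡.sym (Fin.toℕ-inject₁ c)) (≡.sym (Fin.toℕ-inject₁ d)) c<d ∷ strict-extend u v a b l cs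

rows-length : ∀ k r → All (λ w → length w ≡ r) (rows k r)
rows-length k r = All.map⁺ (All.universal toList-length (words k r))
  where
  toList-length : ∀ {r} (w : Vec (Fin k) r) → length (Vec.toList w) ≡ r
  toList-length Vec.[]      = ≡.refl
  toList-length (c Vec.∷ w) = ≡.cong suc (toList-length w)

module Rows (R : CommutativeRing 0ℓ 0ℓ) where
  open RingKit R
  open Sums R
  open Solver

  ∑-top : ∀ k (f : Fin (suc k) → ⟨R⟩) →
    ∑ (allFin (suc k)) f ≈ ∑ (allFin k) (f ∘ inject₁) + f (Fin.fromℕ k)
  ∑-top zero    f = +-comm _ _
  ∑-top (suc k) f = begin
    ∑ (allFin (suc (suc k))) f
      ≈⟨ trans (∑-allFin {suc k} f) (+-congˡ (∑-top k (f ∘ suc))) ⟩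
    f zero + (∑ (allFin k) (f ∘ suc ∘ inject₁) + f (suc (Fin.fromℕ k)))
      ≈⟨ +-assoc _ _ _ ⟨
    (f zero + ∑ (allFin k) (f ∘ inject₁ ∘ suc)) + f (suc (Fin.fromℕ k))
      ≈⟨ +-congʳ (∑-allFin {k} (f ∘ inject₁)) ⟨
    ∑ (allFin (suc k)) (f ∘ inject₁) + f (Fin.fromℕ (suc k))
      ∎

  ∑-rows-suc : ∀ k r (f : List (Fin k) → ⟨R⟩) →
    ∑ (rows k (suc r)) f ≈ ∑ (allFin k) (λ c → ∑ (rows k r) (f ∘ (c ∷_)))
  ∑-rows-suc k r f = begin
    ∑ (rows k (suc r)) f
      ≈⟨ ∑-map (words k (suc r)) Vec.toList f ⟩
    ∑ (words k (suc r)) (f ∘ Vec.toList)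
      ≈⟨ ∑-product Vec._∷_ (allFin k) (words k r) (f ∘ Vec.toList) ⟩
    ∑ (allFin k) (λ c → ∑ (words k r) (λ w → f (c ∷ Vec.toList w)))
      ≈⟨ ∑-cong (allFin k) (λ c → ∑-map (words k r) Vec.toList (f ∘ (c ∷_))) ⟨
    ∑ (allFin k) (λ c → ∑ (rows k r) (f ∘ (c ∷_)))
      ∎

  sorted-[] : ∀ {k} (c : Fin k) w → [ sorted? (c ∷ w) ] ≈ [ sorted? w ] * [ headGE? c w ]
  sorted-[] c w = []-× (sorted? w) (headGE? c w) (sorted? (c ∷ w))
    (λ s → let h , s′ = sorted-head s in s′ , h) (λ s h → sorted-∷ h s)

  -- The index `i` is the number of smaller letters. The induction on the length separates the rows
  -- by their first letter.
  ∑-sorted-rows : ∀ k r (f : List (Fin (suc k)) → ⟨R⟩) →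
    ∑ (rows (suc k) r) (λ w → [ sorted? w ] * f w) ≈
    ∑ (from 0 (suc r)) (λ i → ∑ (rows k i) (λ w → [ sorted? w ] * f (extend w (r ∸ i))))
  ∑-sorted-rows k zero    f = sym (+-identityʳ _)
  ∑-sorted-rows k (suc r) f = begin
    ∑ (rows (suc k) (suc r)) (λ w → [ sorted? w ] * f w)
      ≈⟨ trans (∑-rows-suc (suc k) r _) (∑-cong (allFin (suc k)) λ c →
           trans (∑-cong (rows (suc k) r) λ w →
             trans (*-congʳ (sorted-[] c w)) (*-assoc _ _ _))
           (∑-sorted-rows k r (g c))) ⟩
    ∑ (allFin (suc k)) G
      ≈⟨ trans (∑-top k G) (+-comm _ _) ⟩
    G (Fin.fromℕ k) + ∑ (allFin k) (G ∘ inject₁)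
      ≈⟨ +-cong top-row other-rows ⟩
    ∑ (rows k 0) (λ w → [ sorted? w ] * f (extend w (suc r))) +
    ∑ (from 1 (suc r)) (λ i → ∑ (rows k i) (λ w → [ sorted? w ] * f (extend w (suc r ∸ i))))
      ∎
    where
    g : Fin (suc k) → List (Fin (suc k)) → ⟨R⟩
    g c w = [ headGE? c w ] * f (c ∷ w)

    G : Fin (suc k) → ⟨R⟩
    G c = ∑ (from 0 (suc r)) (λ i → ∑ (rows k i) (λ w → [ sorted? w ] * g c (extend w (r ∸ i))))

    -- A sorted row that begins with the largest letter contains no other, so only `i` = 0 survives.
    top-row : G (Fin.fromℕ k) ≈ ∑ (rows k 0) (λ w → [ sorted? w ] * f (extend w (suc r)))
    top-row = trans (+-cong
      (+-congʳ (*-congˡ (trans (*-congʳ ([]-yes (headGE? (Fin.fromℕ k) (replicate r (Fin.fromℕ k)))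
        (top-HeadGE k r))) (*-identityˡ _))))
      (trans (∑-cong-All (All.map (λ { {suc i} (_ , _) → trans (∑-rows-suc k i _)
        (∑-zero (allFin k) λ d → ∑-zero (rows k i) λ w →
          trans (*-congˡ (trans (*-congʳ ([]-no (headGE? (Fin.fromℕ k) (extend (d ∷ w) (r ∸ suc i)))
            (¬top-HeadGE d w (r ∸ suc i)))) (zeroˡ _))) (zeroʳ _)) })
        (from-bounds 1 r))) (∑-zero (from 1 r) λ _ → refl)))
      (+-identityʳ _)

    other-rows : ∑ (allFin k) (G ∘ inject₁) ≈
      ∑ (from 1 (suc r)) (λ i → ∑ (rows k i) (λ w → [ sorted? w ] * f (extend w (suc r ∸ i))))
    other-rows = begin
      ∑ (allFin k) (G ∘ inject₁)
        ≈⟨ ∑-swap (allFin k) (from 0 (suc r)) _ ⟩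
      ∑ (from 0 (suc r)) (λ i → ∑ (allFin k) (λ c → ∑ (rows k i) (λ w → [ sorted? w ] * g (inject₁ c) (extend w (r ∸ i)))))
        ≈⟨ ∑-cong (from 0 (suc r)) (λ i → trans (∑-cong (allFin k) λ c → ∑-cong (rows k i) λ w →
             trans (sym (*-assoc _ _ _)) (*-congʳ (trans
               (*-congˡ ([]-cong (headGE? (inject₁ c) (extend w (r ∸ i))) (headGE? c w)
                 (restrict-HeadGE c w (r ∸ i)) (extend-HeadGE c w (r ∸ i))))
               (sym (sorted-[] c w)))))
             (sym (∑-rows-suc k i (λ w → [ sorted? w ] * f (extend w (r ∸ i)))))) ⟩
      ∑ (from 0 (suc r)) (λ i → ∑ (rows k (suc i)) (λ w → [ sorted? w ] * f (extend w (r ∸ i))))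
        ≈⟨ Strips.∑-shift R 0 (suc r) (λ i → ∑ (rows k i) (λ w → [ sorted? w ] * f (extend w (suc r ∸ i)))) ⟩
      ∑ (from 1 (suc r)) (λ i → ∑ (rows k i) (λ w → [ sorted? w ] * f (extend w (suc r ∸ i))))
        ∎

  ∑-from-≥ : ∀ y r (f : ℕ → ⟨R⟩) → y ≤ r →
    ∑ (from 0 (suc r)) (λ i → [ y ℕ.≤? i ] * f i) ≈ ∑ (from y (suc (r ∸ y))) f
  ∑-from-≥ y r f y≤r = begin
    ∑ (from 0 (suc r)) h
      ≡⟨ ≡.cong (λ n → ∑ (from 0 n) h) (≡.trans (ℕ.+-suc y (r ∸ y)) (≡.cong suc (ℕ.m+[n∸m]≡n y≤r))) ⟨
    ∑ (from 0 (y ℕ.+ suc (r ∸ y))) h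
      ≡⟨ ≡.cong (λ is → ∑ is h) (from-+ 0 y (suc (r ∸ y))) ⟩
    ∑ (from 0 y ++ from y (suc (r ∸ y))) h
      ≈⟨ ∑-++ (from 0 y) (from y (suc (r ∸ y))) h ⟩
    ∑ (from 0 y) h + ∑ (from y (suc (r ∸ y))) h
      ≈⟨ +-cong (trans (∑-cong-All (All.map (λ {i} (_ , i<y) →
             trans (*-congʳ ([]-no (y ℕ.≤? i) (ℕ.<⇒≱ i<y))) (zeroˡ _)) (from-bounds 0 y))) (∑-zero (from 0 y) λ _ → refl))
           (∑-cong-All (All.map (λ {i} (y≤i , _) →
             trans (*-congʳ ([]-yes (y ℕ.≤? i) y≤i)) (*-identityˡ _)) (from-bounds y (suc (r ∸ y))))) ⟩
    0# + ∑ (from y (suc (r ∸ y))) f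
      ≈⟨ +-identityˡ _ ⟩
    ∑ (from y (suc (r ∸ y))) f
      ∎
    where
    h : ℕ → ⟨R⟩
    h i = [ y ℕ.≤? i ] * f i

module _ {k : ℕ} where
  open CommutativeRing (Poly k) using (1#; _*_) renaming (Carrier to ⟨R⟩)
  open Sums (Poly k)

  strict : List (Fin k) → List (Fin k) → ⟨R⟩
  strict w v = [ columnStrict? w v ]

  -- Sums over semistandard tableaux with an extra factor φ w for the first row w.
  tableaux : (List (Fin k) → ⟨R⟩) → Shape → ⟨R⟩
  tableaux φ []      = 1#
  tableaux φ (r ∷ μ) = ∑ (rows k r) λ w → [ sorted? w ] * (φ w * (word w * tableaux (strict w) μ))

module StripLargest (k : ℕ) where
  private module B = RingKit (Poly k)
  private module ΣB = Sums (Poly k)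
  open Step (Poly k)
  open PowerSeries (Poly k) using (const; const-⊛)
  open RingKit (Poly (suc k))
  open Sums (Poly (suc k))
  open Rows (Poly (suc k))
  open Solver

  []-const : ∀ {P : Set} (d : Dec P) → [ d ] ≈ const ΣB.[ d ]
  []-const (yes _) = refl {const B.1#}
  []-const (no _)  = sym {const B.0#} {0#} (zpow-0# 0)

  below : (List (Fin k) → ⟨Poly⟩ k) → Shape → ⟨R⟩
  below φ μ = ∑ (hstrips μ) (λ ρ → zpow (sum μ ∸ sum ρ) (tableaux φ ρ))

  module _ (r : ℕ) (μ : Shape) (desc : Descending (r ∷ μ))
           (φ⁺ : List (Fin (suc k)) → ⟨R⟩) (φ : List (Fin k) → ⟨Poly⟩ k) (C : ⟨R⟩) where

    private
      y = hd μ

      cell : ℕ → Shape → List (Fin k) → ⟨Poly⟩ k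
      cell i ρ w = ΣB.[ sorted? w ] B.* (φ w B.* (word w B.* tableaux (strict w) ρ))

      exponent : ℕ → Shape → ℕ
      exponent i ρ = (r ∸ i) ℕ.+ (sum μ ∸ sum ρ)

      F : ℕ → ⟨R⟩
      F i = ∑ (hstrips μ) (λ ρ → zpow (exponent i ρ) (tableaux φ (i ∷ ρ)))

      exponent-∸ : ∀ i ρ → i ≤ r → sum ρ ≤ sum μ → exponent i ρ ≡ (r ℕ.+ sum μ) ∸ (i ℕ.+ sum ρ)
      exponent-∸ i ρ i≤r ρ≤μ = ≡.sym (≡.trans (≡.sym (ℕ.∸-+-assoc (r ℕ.+ sum μ) i (sum ρ)))
        (≡.trans (≡.cong (_∸ sum ρ) (ℕ.+-∸-comm (sum μ) i≤r)) (ℕ.+-∸-assoc (r ∸ i) ρ≤μ)))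

    -- One row of the branching rule. The factor `φ⁺` from the row above must become the factor `φ`
    -- of the smaller letters times a `C` that is constant along the row. For column strictness `C`
    -- is the bracket of the condition that the row fits under the smaller letters of the row above.
    strip-row :
      (∀ i w → length w ≡ i → i ≤ r → φ⁺ (extend w (r ∸ i)) ≈ C * const (φ w)) →
      (∀ i w → length w ≡ i → i ≤ r →
        tableaux (strict (extend w (r ∸ i))) μ ≈ [ y ℕ.≤? i ] * below (strict w) μ) →
      tableaux φ⁺ (r ∷ μ) ≈ C * below φ (r ∷ μ)
    strip-row φ-extend inner = begin
      tableaux φ⁺ (r ∷ μ)
        ≈⟨ ∑-sorted-rows k r (λ w → φ⁺ w * (word w * tableaux (strict w) μ)) ⟩
      ∑ (from 0 (suc r)) (λ i → ∑ (rows k i) (G i))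
        ≈⟨ ∑-cong-All (All.map (λ { {i} (_ , s≤s i≤r) → row i i≤r }) (from-bounds 0 (suc r))) ⟩
      ∑ (from 0 (suc r)) (λ i → C * ([ y ℕ.≤? i ] * F i))
        ≈⟨ ∑-*ˡ (from 0 (suc r)) C (λ i → [ y ℕ.≤? i ] * F i) ⟩
      C * ∑ (from 0 (suc r)) (λ i → [ y ℕ.≤? i ] * F i)
        ≈⟨ *-congˡ {C} (∑-from-≥ y r F (desc-hd desc)) ⟩
      C * ∑ (from y (suc (r ∸ y))) F
        ≈⟨ *-congˡ {C} (∑-cong-All (All.map (λ { {i} (_ , i<) →
             ∑-cong-All (All.map (λ {ρ} (_ , _ , ρ≤μ) →
               reflexive (≡.cong (λ h → zpow h (tableaux φ (i ∷ ρ)))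
                 (exponent-∸ i ρ (ℕ.≤-pred (≡.subst (i <_) bound i<)) ρ≤μ)))
               (hstrips-⊆ (Linked.tail desc))) }) (from-bounds y (suc (r ∸ y))))) ⟩
      C * ∑ (from y (suc (r ∸ y))) (λ i → ∑ (hstrips μ) (λ ρ → zpow ((r ℕ.+ sum μ) ∸ (i ℕ.+ sum ρ)) (tableaux φ (i ∷ ρ))))
        ≈⟨ *-congˡ {C} (∑-product _∷_ (from y (suc (r ∸ y))) (hstrips μ)
          (λ ρ → zpow ((r ℕ.+ sum μ) ∸ sum ρ) (tableaux φ ρ))) ⟨
      C * below φ (r ∷ μ)
        ∎
      where
      bound : y ℕ.+ suc (r ∸ y) ≡ suc r
      bound = ≡.trans (ℕ.+-suc y _) (≡.cong suc (ℕ.m+[n∸m]≡n (desc-hd desc)))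

      G : ℕ → List (Fin k) → ⟨R⟩
      G i w = [ sorted? w ] * (φ⁺ (extend w (r ∸ i)) * (word (extend w (r ∸ i)) * tableaux (strict (extend w (r ∸ i))) μ))

      one : ∀ i w → length w ≡ i → i ≤ r →
        G i w ≈ C * ([ y ℕ.≤? i ] * ∑ (hstrips μ) (λ ρ → zpow (exponent i ρ) (cell i ρ w)))
      one i w eq i≤r = begin
        G i w
          ≈⟨ *-cong {[ sorted? w ]} ([]-const (sorted? w)) (*-cong {φ⁺ (extend w (r ∸ i))} (φ-extend i w eq i≤r)
               (*-cong {word (extend w (r ∸ i))} (word-top w (r ∸ i)) (inner i w eq i≤r))) ⟩
        S * ((C * Φ) * (W * (H * below (strict w) μ)))
          ≈⟨ solve 6 (λ s c p w h b → s :* ((c :* p) :* (w :* (h :* b))) := c :* (h :* ((s :* (p :* w)) :* b)))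
               (λ _ → B.refl) S C Φ W H (below (strict w) μ) ⟩
        C * (H * ((S * (Φ * W)) * below (strict w) μ))
          ≈⟨ *-congˡ {C} (*-congˡ {H} (trans {(S * (Φ * W)) * below (strict w) μ}
               (*-congʳ {below (strict w) μ} SΦW) (sym
                 {∑ (hstrips μ) (λ ρ → SΦW′ * zpow (sum μ ∸ sum ρ) (tableaux (strict w) ρ))}
                 (∑-*ˡ (hstrips μ) SΦW′ (λ ρ → zpow (sum μ ∸ sum ρ) (tableaux (strict w) ρ)))))) ⟩
        C * (H * ∑ (hstrips μ) (λ ρ → SΦW′ * zpow (sum μ ∸ sum ρ) (tableaux (strict w) ρ)))
          ≈⟨ *-congˡ {C} (*-congˡ {H} (∑-cong (hstrips μ) λ ρ →
               trans {SΦW′ * zpow (sum μ ∸ sum ρ) (tableaux (strict w) ρ)}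
                 (zpow-* (r ∸ i) (sum μ ∸ sum ρ) (ΣB.[ sorted? w ] B.* (φ w B.* word w)) (tableaux (strict w) ρ))
                 (zpow-cong (exponent i ρ) (assoc₄ _ _ _ _)))) ⟩
        C * (H * ∑ (hstrips μ) (λ ρ → zpow (exponent i ρ) (cell i ρ w)))
          ∎
        where
        S = const ΣB.[ sorted? w ]
        Φ = const (φ w)
        W = zpow (r ∸ i) (word w)
        H = [ y ℕ.≤? i ]
        SΦW′ = zpow (r ∸ i) (ΣB.[ sorted? w ] B.* (φ w B.* word w))

        SΦW : S * (Φ * W) ≈ SΦW′
        SΦW = trans {S * (Φ * W)} (*-congˡ {S} (const-* (φ w) (r ∸ i) (word w)))
          (const-* ΣB.[ sorted? w ] (r ∸ i) (φ w B.* word w))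

        assoc₄ : ∀ a b c d → (a B.* (b B.* c)) B.* d B.≈ a B.* (b B.* (c B.* d))
        assoc₄ a b c d = B.trans (B.*-assoc a _ d) (B.*-congˡ (B.*-assoc b c d))

      row : ∀ i → i ≤ r → ∑ (rows k i) (G i) ≈ C * ([ y ℕ.≤? i ] * F i)
      row i i≤r = begin
        ∑ (rows k i) (G i)
          ≈⟨ ∑-cong-All (All.map (λ {w} eq → one i w eq i≤r) (rows-length k i)) ⟩
        ∑ (rows k i) (λ w → C * (H * ∑ (hstrips μ) (λ ρ → zpow (exponent i ρ) (cell i ρ w))))
          ≈⟨ trans {∑ (rows k i) (λ w → C * (H * ∑ (hstrips μ) (λ ρ → zpow (exponent i ρ) (cell i ρ w))))}
               (∑-*ˡ (rows k i) C (λ w → H * ∑ (hstrips μ) (λ ρ → zpow (exponent i ρ) (cell i ρ w))))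
               (*-congˡ {C} (∑-*ˡ (rows k i) H (λ w → ∑ (hstrips μ) (λ ρ → zpow (exponent i ρ) (cell i ρ w))))) ⟩
        C * (H * ∑ (rows k i) (λ w → ∑ (hstrips μ) (λ ρ → zpow (exponent i ρ) (cell i ρ w))))
          ≈⟨ *-congˡ {C} (*-congˡ {H} (∑-swap (rows k i) (hstrips μ) (λ w ρ → zpow (exponent i ρ) (cell i ρ w)))) ⟩
        C * (H * ∑ (hstrips μ) (λ ρ → ∑ (rows k i) (λ w → zpow (exponent i ρ) (cell i ρ w))))
          ≈⟨ *-congˡ {C} (*-congˡ {H} (∑-cong (hstrips μ) λ ρ → zpow-∑ (exponent i ρ) (rows k i) (cell i ρ))) ⟨
        C * (H * F i)
          ∎
        where H = [ y ℕ.≤? i ]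

  strip-strict : ∀ r {μ} → Descending (r ∷ μ) → ∀ i w → length w ≡ i → i ≤ r →
    tableaux (strict (extend w (r ∸ i))) μ ≈ [ hd μ ℕ.≤? i ] * below (strict w) μ
  strip-strict r {[]} d i w eq i≤r = sym {[ 0 ℕ.≤? i ] * below (strict w) []} {1#} (begin
    [ 0 ℕ.≤? i ] * below (strict w) []   ≈⟨ *-cong {[ 0 ℕ.≤? i ]} ([]-yes (0 ℕ.≤? i) z≤n) (+-identityʳ (const B.1#)) ⟩
    1# * 1#                              ≈⟨ *-identityˡ 1# ⟩
    1#                                   ∎)
  strip-strict r {q ∷ μ} d i w ≡.refl i≤r = strip-row q μ (Linked.tail d)
    (strict (extend w (r ∸ i))) (strict w) [ q ℕ.≤? i ] columns (strip-strict q (Linked.tail d))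
    where
    columns : ∀ j v → length v ≡ j → j ≤ q →
      strict (extend w (r ∸ i)) (extend v (q ∸ j)) ≈ [ q ℕ.≤? i ] * const (strict w v)
    columns j v ≡.refl j≤q = trans {[ cs ]}
      ([]-× (q ℕ.≤? length w) (columnStrict? w v) cs
        (λ p → let q≤ , p′ = strict-restrict w v (r ∸ length w) (q ∸ length v) lengths p
               in ≡.subst (_≤ length w) (ℕ.m+[n∸m]≡n j≤q) q≤ , p′)
        (λ q≤ p → strict-extend w v (r ∸ length w) (q ∸ length v) (≡.subst (_≤ length w) (≡.sym (ℕ.m+[n∸m]≡n j≤q)) q≤) p))
      (*-congˡ {[ q ℕ.≤? length w ]} ([]-const (columnStrict? w v)))
      where
      cs = columnStrict? (extend w (r ∸ length w)) (extend v (q ∸ length v))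
      lengths : length v ℕ.+ (q ∸ length v) ≤ length w ℕ.+ (r ∸ length w)
      lengths = ≡.subst₂ _≤_ (≡.sym (ℕ.m+[n∸m]≡n j≤q)) (≡.sym (ℕ.m+[n∸m]≡n i≤r)) (desc-hd d)

  strip-free : ∀ {μ} → Descending μ → tableaux {suc k} (λ _ → 1#) μ ≈ below (λ _ → B.1#) μ
  strip-free {[]}    d = sym {below (λ _ → B.1#) []} (+-identityʳ (const B.1#))
  strip-free {r ∷ μ} d = trans {tableaux {suc k} (λ _ → 1#) (r ∷ μ)}
    (strip-row r μ d (λ _ → 1#) (λ _ → B.1#) 1# (λ i w eq i≤r → sym {1# * 1#} (*-identityˡ 1#)) (strip-strict r d))
    (*-identityˡ (below (λ _ → B.1#) (r ∷ μ)))

s-tableaux : ∀ k {μ} → Descending μ → let open CommutativeRing (Poly k) in s k μ ≈ tableaux {k} (λ _ → 1#) μ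
s-tableaux zero {μ} _ = ≡.sym (no-letters μ (λ _ → 1ℚ) ≡.refl)
  where
  open Sums (Poly 0)
  -- Without letters only rows of length 0 can be filled. The factor `φ` is general because it
  -- changes from the first row to the next.
  no-letters : ∀ μ (φ : List (Fin 0) → ℚ) → φ [] ≡ 1ℚ → tableaux {0} φ μ ≡ s 0 μ
  no-letters []          φ eq = ≡.refl
  no-letters (suc r ∷ μ) φ eq = ≡.refl
  no-letters (zero ∷ μ)  φ eq = begin
    1ℚ ℚ.* (φ [] ℚ.* (1ℚ ℚ.* tableaux {0} (strict {0} []) μ)) ℚ.+ 0ℚ
      ≡⟨ ≡.cong (λ h → 1ℚ ℚ.* (h ℚ.* (1ℚ ℚ.* tableaux {0} (strict {0} []) μ)) ℚ.+ 0ℚ) eq ⟩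
    1ℚ ℚ.* (1ℚ ℚ.* (1ℚ ℚ.* tableaux {0} (strict {0} []) μ)) ℚ.+ 0ℚ
      ≡⟨ RingKit.Solver.solve (Poly 0) 1 (λ a → con (+ 1) :* (con (+ 1) :* (con (+ 1) :* a)) :+ con (+ 0) := a)
        ≡.refl (tableaux {0} (strict {0} []) μ) ⟩
    tableaux {0} (strict {0} []) μ
      ≡⟨ no-letters μ (strict {0} []) ≡.refl ⟩
    s 0 μ
      ∎
    where
    open ≡.≡-Reasoning
    open RingKit.Solver (Poly 0)
s-tableaux (suc k) {μ} d = trans {s (suc k) μ}
  (∑-cong-All (All.map (λ {ρ} (dρ , _) → zpow-cong (sum μ ∸ sum ρ) (s-tableaux k dρ)) (hstrips-⊆ d)))
  (sym {tableaux {suc k} (λ _ → 1#) μ} (StripLargest.strip-free k d))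
  where
  open CommutativeRing (Poly (suc k))
  open Sums (Poly (suc k))
  open Step (Poly k)

module _ {k : ℕ} where
  open RingKit (Poly k)
  open Sums (Poly k)
  open Solver

  Below : List (Fin k) → List (List (Fin k)) → Set
  Below w T = All Sorted T × Linked ColumnStrict (w ∷ T)

  below? : ∀ w → Decidable (Below w)
  below? w T = All.all? sorted? T ×-dec linked? columnStrict? (w ∷ T)

  private
    -- With `P?` left open this covers both a first row and a row that lies below another.
    step : ∀ r μ (φ : List (Fin k) → ⟨R⟩) →
      (∀ v → ∑ (fillings k μ) (λ T → [ below? v T ] * word (concat T)) ≈ tableaux (strict v) μ) →
      ∀ {P : List (List (Fin k)) → Set} (P? : Decidable P) →
      (∀ v T → [ P? (v ∷ T) ] ≈ [ sorted? v ] * (φ v * [ below? v T ])) →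
      ∑ (fillings k (r ∷ μ)) (λ T → [ P? T ] * word (concat T)) ≈ tableaux φ (r ∷ μ)
    step r μ φ ih P? split = trans (∑-product _∷_ (rows k r) (fillings k μ) _)
      (∑-cong (rows k r) λ v → begin
        ∑ (fillings k μ) (λ T → [ P? (v ∷ T) ] * word (v ++ concat T))
          ≈⟨ ∑-cong (fillings k μ) (λ T → trans (*-cong (split v T) (sym (word-++ v (concat T))))
               (solve 5 (λ a b c d e → (a :* (b :* c)) :* (d :* e) := (a :* (b :* d)) :* (c :* e)) refl _ _ _ _ _)) ⟩
        ∑ (fillings k μ) (λ T → ([ sorted? v ] * (φ v * word v)) * ([ below? v T ] * word (concat T)))
          ≈⟨ trans (∑-*ˡ (fillings k μ) _ _) (*-congˡ (ih v)) ⟩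
        ([ sorted? v ] * (φ v * word v)) * tableaux (strict v) μ
          ≈⟨ solve 4 (λ a b c d → (a :* (b :* c)) :* d := a :* (b :* (c :* d))) refl _ _ _ _ ⟩
        [ sorted? v ] * (φ v * (word v * tableaux (strict v) μ))
          ∎)

  fillings-below : ∀ μ w → ∑ (fillings k μ) (λ T → [ below? w T ] * word (concat T)) ≈ tableaux (strict w) μ
  fillings-below [] w = trans (+-identityʳ _) (trans
    (*-cong ([]-yes (below? w []) ([] , [-])) (word-[] k)) (*-identityˡ 1#))
  fillings-below (r ∷ μ) w = step r μ (strict w) (fillings-below μ) (below? w) λ v T → trans
      ([]-× (sorted? v) (columnStrict? w v ×-dec below? v T) (below? w (v ∷ T))
        (λ { ((s ∷ ss) , (c ∷ cs)) → s , c , ss , cs })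
        (λ { s (c , ss , cs) → s ∷ ss , c ∷ cs }))
      (*-congˡ ([]-× (columnStrict? w v) (below? v T) (columnStrict? w v ×-dec below? v T) id _,_))

  fillings-semistandard : ∀ μ →
    ∑ (fillings k μ) (λ T → [ semistandard? T ] * word (concat T)) ≈ tableaux {k} (λ _ → 1#) μ
  fillings-semistandard [] = trans (+-identityʳ _) (trans
    (*-cong ([]-yes (semistandard? {k} []) ([] , [])) (word-[] k)) (*-identityˡ 1#))
  fillings-semistandard (r ∷ μ) = step r μ (λ _ → 1#) (fillings-below μ) semistandard? λ v T → trans
      ([]-× (sorted? v) (below? v T) (semistandard? (v ∷ T))
        (λ { ((s ∷ ss) , cs) → s , ss , cs })
        (λ { s (ss , cs) → s ∷ ss , cs }))
      (*-congˡ (sym (*-identityˡ _)))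

schur-s : ∀ {μ} → Descending μ → ∀ α → schur μ α ≡ coeff (length α) (s (length α) μ) (lookup α)
schur-s {μ} d α = begin
  schur μ α
    ≡⟨ fromℕ-filter (λ T → semistandard? T ×-dec exponents? (concat T) α) (fillings k μ) ⟩
  ∑ (fillings k μ) (λ T → [ semistandard? T ×-dec exponents? (concat T) α ])
    ≡⟨ ∑-cong (fillings k μ) (λ T → []-× (semistandard? T) (exponents? (concat T) α)
      (semistandard? T ×-dec exponents? (concat T) α) id _,_) ⟩
  ∑ (fillings k μ) (λ T → [ semistandard? T ] ℚ.* [ exponents? (concat T) α ])
    ≡⟨ ∑-cong (fillings k μ) (λ T → ≡.trans (coeff-[] {k} (semistandard? T) (word (concat T)) β)
         (≡.cong ([ semistandard? T ] ℚ.*_) (coeff-word α (concat T)))) ⟨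
  ∑ (fillings k μ) (λ T → coeff k (Sums.[_] (Poly k) (semistandard? T) P.* word (concat T)) β)
    ≡⟨ coeff-∑ k (fillings k μ) (λ T → Sums.[_] (Poly k) (semistandard? T) P.* word (concat T)) β ⟨
  coeff k (Sums.∑ (Poly k) (fillings k μ) (λ T → Sums.[_] (Poly k) (semistandard? T) P.* word (concat T))) β
    ≡⟨ coeff-cong k β (P.trans (fillings-semistandard {k} μ) (P.sym (s-tableaux k d))) ⟩
  coeff k (s k μ) β
    ∎
  where
  k = length α
  β = lookup α
  module P = CommutativeRing (Poly k)
  open Sums (Poly 0)
  open ≡.≡-Reasoning

-- The chromatic symmetric function of a lollipop

LollipopProper : ∀ {k N} → ℕ → Vec (Fin k) N → Set
LollipopProper m κ = ∀ u v → LollipopAdj m u v → Vec.lookup κ u ≢ Vec.lookup κ v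

adj-suc : ∀ {N} m {u v : Fin N} → LollipopAdj m u v → LollipopAdj (suc m) (suc u) (suc v)
adj-suc m (inj₁ (u≢v , u<m , v<m))   = inj₁ ((λ eq → u≢v (Fin.suc-injective eq)) , s≤s u<m , s≤s v<m)
adj-suc m (inj₂ (inj₁ (m≤ , eq))) = inj₂ (inj₁ (s≤s m≤ , ≡.cong suc eq))
adj-suc m (inj₂ (inj₂ (m≤ , eq))) = inj₂ (inj₂ (s≤s m≤ , ≡.cong suc eq))

adj-pred : ∀ {N} m {u v : Fin N} → LollipopAdj (suc m) (suc u) (suc v) → LollipopAdj m u v
adj-pred m (inj₁ (u≢v , s≤s u<m , s≤s v<m)) = inj₁ ((λ eq → u≢v (≡.cong suc eq)) , u<m , v<m)
adj-pred m (inj₂ (inj₁ (s≤s m≤ , eq))) = inj₂ (inj₁ (m≤ , ℕ.suc-injective eq))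
adj-pred m (inj₂ (inj₂ (s≤s m≤ , eq))) = inj₂ (inj₂ (m≤ , ℕ.suc-injective eq))

-- Deleting vertex 0 usually shrinks the clique. A clique of size 1 is instead replaced by the next
-- vertex of the path, so the parameter stays 1.
adj₁-suc : ∀ {N} {u v : Fin N} → LollipopAdj 1 u v → LollipopAdj 1 (suc u) (suc v)
adj₁-suc {u = zero} {zero} (inj₁ (u≢v , _)) = contradiction ≡.refl u≢v
adj₁-suc {u = zero} {suc v} (inj₁ (_ , _ , s≤s ()))
adj₁-suc {u = suc u} (inj₁ (_ , s≤s () , _))
adj₁-suc (inj₂ (inj₁ (_ , eq))) = inj₂ (inj₁ (s≤s z≤n , ≡.cong suc eq))
adj₁-suc (inj₂ (inj₂ (_ , eq))) = inj₂ (inj₂ (s≤s z≤n , ≡.cong suc eq))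

adj₁-pred : ∀ {N} {u v : Fin N} → LollipopAdj 1 (suc u) (suc v) → LollipopAdj 1 u v
adj₁-pred (inj₁ (_ , s≤s () , _))
adj₁-pred (inj₂ (inj₁ (_ , eq))) = inj₂ (inj₁ (s≤s z≤n , ℕ.suc-injective eq))
adj₁-pred (inj₂ (inj₂ (_ , eq))) = inj₂ (inj₂ (s≤s z≤n , ℕ.suc-injective eq))

module _ {k : ℕ} where
  proper-∷⁻ : ∀ {N} m {c} {w : Vec (Fin k) N} → LollipopProper (2 ℕ.+ m) (c Vec.∷ w) →
    (∀ v → toℕ v ≤ m → c ≢ Vec.lookup w v) × LollipopProper (suc m) w
  proper-∷⁻ m p = (λ v v≤m → p zero (suc v) (inj₁ ((λ ()) , s≤s z≤n , s≤s (s≤s v≤m))))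
                , (λ u v a → p (suc u) (suc v) (adj-suc (suc m) a))

  proper-∷⁺ : ∀ {N} m {c} {w : Vec (Fin k) N} →
    (∀ v → toℕ v ≤ m → c ≢ Vec.lookup w v) → LollipopProper (suc m) w → LollipopProper (2 ℕ.+ m) (c Vec.∷ w)
  proper-∷⁺ m h p zero zero (inj₁ (u≢u , _)) = contradiction ≡.refl u≢u
  proper-∷⁺ m h p zero zero (inj₂ (inj₁ (_ , ())))
  proper-∷⁺ m h p zero zero (inj₂ (inj₂ (_ , ())))
  proper-∷⁺ m h p zero (suc v) (inj₁ (_ , _ , s≤s (s≤s v≤m))) = h v v≤m
  proper-∷⁺ m h p zero (suc v) (inj₂ (inj₁ (s≤s () , _)))
  proper-∷⁺ m h p zero (suc v) (inj₂ (inj₂ (_ , ())))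
  proper-∷⁺ m h p (suc u) zero (inj₁ (_ , s≤s (s≤s u≤m) , _)) = ≡.≢-sym (h u u≤m)
  proper-∷⁺ m h p (suc u) zero (inj₂ (inj₁ (_ , ())))
  proper-∷⁺ m h p (suc u) zero (inj₂ (inj₂ (s≤s () , _)))
  proper-∷⁺ m h p (suc u) (suc v) a = p u v (adj-pred (suc m) a)

  proper₁-∷⁻ : ∀ {N} {c d} {w : Vec (Fin k) N} → LollipopProper 1 (c Vec.∷ d Vec.∷ w) →
    c ≢ d × LollipopProper 1 (d Vec.∷ w)
  proper₁-∷⁻ p = p zero (suc zero) (inj₂ (inj₁ (s≤s z≤n , ≡.refl)))
               , (λ u v a → p (suc u) (suc v) (adj₁-suc a))

  proper₁-∷⁺ : ∀ {N} {c d} {w : Vec (Fin k) N} → c ≢ d → LollipopProper 1 (d Vec.∷ w) →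
    LollipopProper 1 (c Vec.∷ d Vec.∷ w)
  proper₁-∷⁺ h p zero zero (inj₁ (u≢u , _)) = contradiction ≡.refl u≢u
  proper₁-∷⁺ h p zero zero (inj₂ (inj₁ (_ , ())))
  proper₁-∷⁺ h p zero zero (inj₂ (inj₂ (_ , ())))
  proper₁-∷⁺ h p zero (suc v) (inj₁ (_ , _ , s≤s ()))
  proper₁-∷⁺ h p zero (suc zero) (inj₂ (inj₁ _)) = h
  proper₁-∷⁺ h p zero (suc (suc v)) (inj₂ (inj₁ (_ , ())))
  proper₁-∷⁺ h p zero (suc v) (inj₂ (inj₂ (_ , ())))
  proper₁-∷⁺ h p (suc u) zero (inj₁ (_ , s≤s () , _))
  proper₁-∷⁺ h p (suc u) zero (inj₂ (inj₁ (_ , ())))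
  proper₁-∷⁺ h p (suc zero) zero (inj₂ (inj₂ _)) = ≡.≢-sym h
  proper₁-∷⁺ h p (suc (suc u)) zero (inj₂ (inj₂ (_ , ())))
  proper₁-∷⁺ h p (suc u) (suc v) a = p u v (adj₁-pred a)

  proper₁-single : ∀ {c} → LollipopProper {k} 1 (c Vec.∷ Vec.[])
  proper₁-single zero zero (inj₁ (u≢u , _)) = contradiction ≡.refl u≢u
  proper₁-single zero zero (inj₂ (inj₁ (_ , ())))
  proper₁-single zero zero (inj₂ (inj₂ (_ , ())))

module _ {k : ℕ} where
  open RingKit (Poly k)
  open Sums (Poly k)
  open Elementary (Poly k)
  open Walks (Poly k) k (var k)

  private x = var k

  kill-self : ∀ {n} c (y : Fin n → ⟨R⟩) → kill c y c ≈ 0#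
  kill-self zero    y = refl
  kill-self (suc c) y = kill-self c (y ∘ suc)

  kill-other : ∀ {n} {c d} (y : Fin n → ⟨R⟩) → c ≢ d → kill c y d ≈ y d
  kill-other {c = zero}  {zero}  y c≢d = contradiction ≡.refl c≢d
  kill-other {c = zero}  {suc d} y c≢d = refl
  kill-other {c = suc c} {zero}  y c≢d = refl
  kill-other {c = suc c} {suc d} y c≢d = kill-other (y ∘ suc) (c≢d ∘ ≡.cong suc)

  kill-0# : ∀ {n} c {d} (y : Fin n → ⟨R⟩) → y d ≈ 0# → kill c y d ≈ 0#
  kill-0# zero    {zero}  y eq = refl
  kill-0# zero    {suc d} y eq = eq
  kill-0# (suc c) {zero}  y eq = eq
  kill-0# (suc c) {suc d} y eq = kill-0# c (y ∘ suc) eq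

  vword : ∀ {n} → Vec (Fin k) n → ⟨R⟩
  vword w = word (Vec.toList w)

  vword-∷ : ∀ {n} c (w : Vec (Fin k) n) → x c * vword w ≈ vword (c Vec.∷ w)
  vword-∷ c w = word-++ (c ∷ []) (Vec.toList w)

  -- Killing the preceding letter gives improper words weight 0, so that one may sum over all words.
  pathWeight : ∀ {n} → Fin k → Vec (Fin k) n → ⟨R⟩
  pathWeight c Vec.[]      = 1#
  pathWeight c (d Vec.∷ w) = kill c x d * pathWeight d w

  -- A letter used in the clique is killed in the weights of the later ones.
  weight : ∀ {n} → ℕ → (Fin k → ⟨R⟩) → Vec (Fin k) n → ⟨R⟩
  weight m       y Vec.[]      = 0#
  weight zero    y (c Vec.∷ w) = y c * pathWeight c w
  weight (suc m) y (c Vec.∷ w) = y c * weight m (kill c y) w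

  ∑-words-suc : ∀ n (f : Vec (Fin k) (suc n) → ⟨R⟩) →
    ∑ (words k (suc n)) f ≈ ∑ (allFin k) (λ c → ∑ (words k n) (λ w → f (c Vec.∷ w)))
  ∑-words-suc n f = ∑-product Vec._∷_ (allFin k) (words k n) f

  ∑-pathWeight : ∀ n c → ∑ (words k n) (pathWeight c) ≈ q n c
  ∑-pathWeight zero    c = +-identityʳ _
  ∑-pathWeight (suc n) c = trans (∑-words-suc n (pathWeight c))
    (∑-cong (allFin k) λ d → trans (∑-*ˡ (words k n) _ _) (*-congˡ (∑-pathWeight n d)))

  ∑-weight : ∀ m n y → ∑ (words k (suc m ℕ.+ n)) (weight m y) ≈ distinct m y (q n)
  ∑-weight zero    n y = trans (∑-words-suc n (weight 0 y))
    (∑-cong (allFin k) λ c → trans (∑-*ˡ (words k n) _ _) (*-congˡ (∑-pathWeight n c)))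
  ∑-weight (suc m) n y = trans (∑-words-suc (suc m ℕ.+ n) (weight (suc m) y))
    (∑-cong (allFin k) λ c → trans (∑-*ˡ (words k (suc m ℕ.+ n)) _ _) (*-congˡ (∑-weight m n (kill c y))))

  pathWeight-proper : ∀ {n} c (w : Vec (Fin k) n) → LollipopProper 1 (c Vec.∷ w) → pathWeight c w ≈ vword w
  pathWeight-proper c Vec.[]      p = sym (word-[] k)
  pathWeight-proper c (d Vec.∷ w) p = let c≢d , p′ = proper₁-∷⁻ p in
    trans (*-cong (kill-other x c≢d) (pathWeight-proper d w p′)) (vword-∷ d w)

  pathWeight-improper : ∀ {n} c (w : Vec (Fin k) n) → ¬ LollipopProper 1 (c Vec.∷ w) → pathWeight c w ≈ 0#
  pathWeight-improper c Vec.[] ¬p = contradiction proper₁-single ¬p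
  pathWeight-improper c (d Vec.∷ w) ¬p with c Fin.≟ d
  ... | yes ≡.refl = trans (*-congʳ (kill-self c x)) (zeroˡ _)
  ... | no c≢d     = trans (*-congˡ (pathWeight-improper d w (¬p ∘ proper₁-∷⁺ c≢d))) (zeroʳ _)

  weight-0# : ∀ {n} m y (w : Vec (Fin k) n) v → toℕ v ≤ m → y (Vec.lookup w v) ≈ 0# → weight m y w ≈ 0#
  weight-0# zero    y (c Vec.∷ w) zero    v≤m eq = trans (*-congʳ eq) (zeroˡ _)
  weight-0# (suc m) y (c Vec.∷ w) zero    v≤m eq = trans (*-congʳ eq) (zeroˡ _)
  weight-0# (suc m) y (c Vec.∷ w) (suc v) (s≤s v≤m) eq =
    trans (*-congˡ (weight-0# m (kill c y) w v v≤m (kill-0# c y eq))) (zeroʳ _)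

  weight-proper : ∀ m n y (κ : Vec (Fin k) (suc m ℕ.+ n)) → LollipopProper (suc m) κ →
    (∀ v → toℕ v ≤ m → y (Vec.lookup κ v) ≈ x (Vec.lookup κ v)) → weight m y κ ≈ vword κ
  weight-proper zero n y (c Vec.∷ w) p eq =
    trans (*-cong (eq zero z≤n) (pathWeight-proper c w p)) (vword-∷ c w)
  weight-proper (suc m) n y (c Vec.∷ w) p eq = let h , p′ = proper-∷⁻ m p in
    trans (*-cong (eq zero z≤n) (weight-proper m n (kill c y) w p′ λ v v≤m →
      trans (kill-other y (h v v≤m)) (eq (suc v) (s≤s v≤m)))) (vword-∷ c w)

  weight-improper : ∀ m n y (κ : Vec (Fin k) (suc m ℕ.+ n)) → ¬ LollipopProper (suc m) κ → weight m y κ ≈ 0#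
  weight-improper zero n y (c Vec.∷ w) ¬p = trans (*-congˡ (pathWeight-improper c w ¬p)) (zeroʳ _)
  -- Either `c` recurs on the rest of the clique, where it has been killed, or the rest of the word
  -- is improper.
  weight-improper (suc m) n y (c Vec.∷ w) ¬p
    with Fin.any? (λ v → (toℕ v ℕ.≤? m) ×-dec (c Fin.≟ Vec.lookup w v))
  ... | yes (v , v≤m , c≡) = trans (*-congˡ (weight-0# m (kill c y) w v v≤m
    (trans (reflexive (≡.cong (kill c y) (≡.sym c≡))) (kill-self c y)))) (zeroʳ _)
  ... | no ¬∃ = trans (*-congˡ (weight-improper m n (kill c y) w λ p →
    ¬p (proper-∷⁺ m (λ v v≤m c≡ → ¬∃ (v , v≤m , c≡)) p))) (zeroʳ _)

  weight-[] : ∀ m n (κ : Vec (Fin k) (suc m ℕ.+ n)) (d : Dec (LollipopProper (suc m) κ)) →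
    [ d ] * vword κ ≈ weight m x κ
  weight-[] m n κ (yes p) = trans (*-identityˡ _) (sym (weight-proper m n x κ p λ _ _ → refl))
  weight-[] m n κ (no ¬p) = trans (zeroˡ _) (sym (weight-improper m n x κ ¬p))

X-coeff : ∀ {N} (G : Graph N) α → X G α ≡
  coeff (length α) (Sums.∑ (Poly (length α)) (words (length α) N)
    (λ κ → CommutativeRing._*_ (Poly (length α)) (Sums.[_] (Poly (length α)) (proper? G κ)) (vword κ))) (lookup α)
X-coeff {N} G α = begin
  X G α
    ≡⟨ fromℕ-filter (λ κ → proper? G κ ×-dec exponents? (Vec.toList κ) α) (words k N) ⟩
  ∑ (words k N) (λ κ → [ proper? G κ ×-dec exponents? (Vec.toList κ) α ])
    ≡⟨ ∑-cong (words k N) (λ κ → []-× (proper? G κ) (exponents? (Vec.toList κ) α)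
      (proper? G κ ×-dec exponents? (Vec.toList κ) α) id _,_) ⟩
  ∑ (words k N) (λ κ → [ proper? G κ ] ℚ.* [ exponents? (Vec.toList κ) α ])
    ≡⟨ ∑-cong (words k N) (λ κ → ≡.trans (coeff-[] {k} (proper? G κ) (vword κ) β)
         (≡.cong ([ proper? G κ ] ℚ.*_) (coeff-word α (Vec.toList κ)))) ⟨
  ∑ (words k N) (λ κ → coeff k (Sums.[_] (Poly k) (proper? G κ) P.* vword κ) β)
    ≡⟨ coeff-∑ k (words k N) (λ κ → Sums.[_] (Poly k) (proper? G κ) P.* vword κ) β ⟨
  coeff k (Sums.∑ (Poly k) (words k N) (λ κ → Sums.[_] (Poly k) (proper? G κ) P.* vword κ)) β
    ∎
  where
  k = length α
  β = lookup α
  module P = CommutativeRing (Poly k)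
  open Sums (Poly 0)
  open ≡.≡-Reasoning

u : ∀ k → ℕ → ℕ → ⟨Poly⟩ k
u k = Walks.U (Poly k) k (var k)

-- The `m` clique vertices without the tail give the set of colours. The clique vertex that carries
-- the tail starts the walk, which therefore has `suc n` letters.
X-lollipop : ∀ m n α → X (lollipopGraph (suc m) n ≡.refl) α ≡
  RingKit.ι (Poly 0) (m ℕ.!) ℚ.* coeff (length α) (u (length α) m (suc n)) (lookup α)
X-lollipop m n α = ≡.trans (X-coeff (lollipopGraph (suc m) n ≡.refl) α) (≡.trans
  (coeff-cong k (lookup α) (trans (∑-cong (words k (suc m ℕ.+ n)) λ κ →
    weight-[] m n κ (proper? (lollipopGraph (suc m) n ≡.refl) κ))
    (trans (∑-weight m n (var k)) (distinct-e m (var k) (q n)))))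
  (coeff-ι k (m ℕ.!) _ (lookup α)))
  where
  k = length α
  open RingKit (Poly k)
  open Sums (Poly k)
  open Elementary (Poly k)
  open Walks (Poly k) k (var k)

-- D as a sum of Schur functions

twoColumns : ℕ → ℕ → Shape
twoColumns j d = replicate j 2 ++ replicate d 1

-- The partitions other than the column `1^ N`: a sum over them has coefficient 0 at s_(1^N).
Wide : ℕ → Shape → Set
Wide N μ = μ ⊢ N × 2 ≤ hd μ

twoColumns-desc : ∀ j d → Descending (twoColumns j d) × Positive (twoColumns j d)
twoColumns-desc zero          d       = 1^-desc d
twoColumns-desc (suc zero)    zero    = [-] , s≤s z≤n ∷ []
twoColumns-desc (suc zero)    (suc d) = let p , q = 1^-desc (suc d) in s≤s z≤n ∷ p , s≤s z≤n ∷ q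
twoColumns-desc (suc (suc j)) d       = let p , q = twoColumns-desc (suc j) d in ℕ.≤-refl ∷ p , s≤s z≤n ∷ q

sum-1^ : ∀ d → sum (1^ d) ≡ d
sum-1^ zero    = ≡.refl
sum-1^ (suc d) = ≡.cong suc (sum-1^ d)

sum-twoColumns : ∀ j d → sum (twoColumns j d) ≡ (j ℕ.+ d) ℕ.+ j
sum-twoColumns zero    d = ≡.trans (sum-1^ d) (≡.sym (ℕ.+-identityʳ d))
sum-twoColumns (suc j) d = ≡.cong suc (≡.trans (≡.cong suc (sum-twoColumns j d)) (≡.sym (ℕ.+-suc (j ℕ.+ d) j)))

twoColumns-wide : ∀ j d → Wide (suc (j ℕ.+ d) ℕ.+ suc j) (twoColumns (suc j) d)
twoColumns-wide j d =
  (proj₁ (twoColumns-desc (suc j) d) , proj₂ (twoColumns-desc (suc j) d) , sum-twoColumns (suc j) d) , ℕ.≤-refl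

-- With the first row fixed, no other row of the column can grow beyond it, so all new cells go to
-- the bottom.
level-1^ : ∀ j a → level j (1^ (suc a)) ≡ 1^ (suc a ℕ.+ j) ∷ []
level-1^ j zero    = ≡.trans (level-∷ j 1 []) (≡.cong (map (1 ∷_)) (vstrips-[] j))
level-1^ j (suc a) = ≡.trans (level-∷ j 1 (1^ (suc a))) (≡.cong (map (1 ∷_)) (level-1^ j a))

-- One list of shapes serves every number k of variables.
SchurSum : ℕ → (∀ k → ⟨Poly⟩ k) → Set
SchurSum N F = Σ[ Λ ∈ List Shape ] All (Wide N) Λ ×
  (∀ k → CommutativeRing._≈_ (Poly k) (F k) (Sums.∑ (Poly k) Λ (s k)))

module _ {N : ℕ} where
  schurSum-cong : ∀ {F G} → (∀ k → CommutativeRing._≈_ (Poly k) (F k) (G k)) → SchurSum N G → SchurSum N F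
  schurSum-cong p (Λ , w , eq) = Λ , w , λ k → CommutativeRing.trans (Poly k) (p k) (eq k)

  schurSum-0# : SchurSum N (λ k → CommutativeRing.0# (Poly k))
  schurSum-0# = [] , [] , λ k → CommutativeRing.refl (Poly k)

  schurSum-+ : ∀ {F G} → SchurSum N F → SchurSum N G → SchurSum N (λ k → CommutativeRing._+_ (Poly k) (F k) (G k))
  schurSum-+ (Λ , w , eq) (Λ′ , w′ , eq′) = Λ ++ Λ′ , All.++⁺ w w′ , λ k →
    let open CommutativeRing (Poly k) in
    trans (+-cong (eq k) (eq′ k)) (sym (Sums.∑-++ (Poly k) Λ Λ′ (s k)))

  schurSum-ι : ∀ n {F} → SchurSum N F → SchurSum N (λ k → CommutativeRing._*_ (Poly k) (RingKit.ι (Poly k) n) (F k))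
  schurSum-ι zero    {F} S = schurSum-cong (λ k → CommutativeRing.zeroˡ (Poly k) (F k)) schurSum-0#
  schurSum-ι (suc n) {F} S = schurSum-cong
    (λ k → let open RingKit (Poly k) in trans (distribʳ (F k) 1# (ι n)) (+-congʳ (*-identityˡ (F k))))
    (schurSum-+ S (schurSum-ι n S))

  schurSum-elem : ∀ j {F} → SchurSum N F → SchurSum (j ℕ.+ N) (λ k → CommutativeRing._*_ (Poly k) (elem k j) (F k))
  schurSum-elem j {F} (Λ , w , eq) = concatMap (vstrips j) Λ , wide Λ w , λ k →
    let open RingKit (Poly k)
        open Sums (Poly k) in begin
      elem k j * F k                        ≈⟨ *-congˡ (eq k) ⟩
      elem k j * ∑ Λ (s k)                  ≈⟨ ∑-*ˡ Λ (elem k j) (s k) ⟨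
      ∑ Λ (λ μ → elem k j * s k μ)          ≈⟨ ∑-cong-All (All.map (λ { ((d , _) , _) → pieri k j d }) w) ⟩
      ∑ Λ (λ μ → ∑ (vstrips j μ) (s k))     ≈⟨ ∑-concatMap Λ (vstrips j) (s k) ⟨
      ∑ (concatMap (vstrips j) Λ) (s k)     ∎
    where
    wide : ∀ Λ → All (Wide N) Λ → All (Wide (j ℕ.+ N)) (concatMap (vstrips j) Λ)
    wide []      []             = []
    wide (μ ∷ Λ) ((p , h) ∷ ws) = All.++⁺
      (All.zipWith (λ { (p′ , h′ , _) → p′ , ℕ.≤-trans h h′ }) (vstrips-⊢ j p , vstrips-hd j μ))
      (wide Λ ws)

module _ (R : CommutativeRing 0ℓ 0ℓ) where
  open RingKit R
  open Sums R
  open Solver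

  ∑-vstrips-1^ : ∀ r a (f : Shape → ⟨R⟩) →
    ∑ (vstrips (suc r) (1^ (suc a))) f ≈ ∑ (vstrips r (1^ a)) (f ∘ (2 ∷_)) + f (1^ (suc a ℕ.+ suc r))
  ∑-vstrips-1^ r a f = begin
    ∑ (map (2 ∷_) (vstrips r (1^ a)) ++ level (suc r) (1^ (suc a))) f
      ≈⟨ trans (∑-++ (map (2 ∷_) (vstrips r (1^ a))) _ f) (+-cong (∑-map (vstrips r (1^ a)) (2 ∷_) f)
           (trans (reflexive (≡.cong (λ h → ∑ h f) (level-1^ (suc r) a))) (+-identityʳ _))) ⟩
    ∑ (vstrips r (1^ a)) (f ∘ (2 ∷_)) + f (1^ (suc a ℕ.+ suc r))
      ∎

  -- On the left stand the shapes (2^b,1^c) of the given size with b at most r+1, on the right first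
  -- those with b at most r and then the one with b = r+1.
  vstrips-twoColumns : ∀ r d (f : Shape → ⟨R⟩) →
    ∑ (vstrips (suc r) (1^ (suc (r ℕ.+ d)))) f ≈
    ∑ (vstrips r (1^ (2 ℕ.+ (r ℕ.+ d)))) f + f (twoColumns (suc r) d)
  vstrips-twoColumns zero d f = begin
    ∑ (vstrips 1 (1^ (suc d))) f
      ≈⟨ ∑-vstrips-1^ 0 d f ⟩
    ∑ (vstrips 0 (1^ d)) (f ∘ (2 ∷_)) + f (1^ (suc d ℕ.+ 1))
      ≡⟨ ≡.cong₂ (λ h i → ∑ h (f ∘ (2 ∷_)) + f (1^ (suc i))) (vstrips-0 (1^ d)) (ℕ.+-comm d 1) ⟩
    (f (2 ∷ 1^ d) + 0#) + f (1^ (2 ℕ.+ d))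
      ≈⟨ solve 2 (λ a b → (a :+ con (+ 0)) :+ b := (b :+ con (+ 0)) :+ a) refl _ _ ⟩
    (f (1^ (2 ℕ.+ d)) + 0#) + f (2 ∷ 1^ d)
      ≡⟨ ≡.cong (λ h → ∑ h f + f (2 ∷ 1^ d)) (vstrips-0 (1^ (2 ℕ.+ d))) ⟨
    ∑ (vstrips 0 (1^ (2 ℕ.+ d))) f + f (2 ∷ 1^ d)
      ∎
  vstrips-twoColumns (suc r) d f = begin
    ∑ (vstrips (2 ℕ.+ r) (1^ (suc (suc (r ℕ.+ d))))) f
      ≈⟨ ∑-vstrips-1^ (suc r) (suc (r ℕ.+ d)) f ⟩
    ∑ (vstrips (suc r) (1^ (suc (r ℕ.+ d)))) (f ∘ (2 ∷_)) + f (1^ (2 ℕ.+ (r ℕ.+ d) ℕ.+ (2 ℕ.+ r)))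
      ≈⟨ +-cong (vstrips-twoColumns r d (f ∘ (2 ∷_)))
           (reflexive (≡.cong (λ h → f (1^ (2 ℕ.+ h))) (ℕ.+-suc (r ℕ.+ d) (suc r)))) ⟩
    (∑ (vstrips r (1^ (2 ℕ.+ (r ℕ.+ d)))) (f ∘ (2 ∷_)) + f (twoColumns (2 ℕ.+ r) d)) + f (1^ (3 ℕ.+ (r ℕ.+ d) ℕ.+ suc r))
      ≈⟨ solve 3 (λ a b c → (a :+ b) :+ c := (a :+ c) :+ b) refl _ _ _ ⟩
    (∑ (vstrips r (1^ (2 ℕ.+ (r ℕ.+ d)))) (f ∘ (2 ∷_)) + f (1^ (3 ℕ.+ (r ℕ.+ d) ℕ.+ suc r))) + f (twoColumns (2 ℕ.+ r) d)
      ≈⟨ +-congʳ (∑-vstrips-1^ r (2 ℕ.+ (r ℕ.+ d)) f) ⟨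
    ∑ (vstrips (suc r) (1^ (3 ℕ.+ (r ℕ.+ d)))) f + f (twoColumns (2 ℕ.+ r) d)
      ∎

elem-elem : ∀ k a j → let open CommutativeRing (Poly k) in
  elem k a * elem k j ≈ Sums.∑ (Poly k) (vstrips j (1^ a)) (s k)
elem-elem k a j = begin
  elem k a * elem k j         ≈⟨ *-comm _ _ ⟩
  elem k j * elem k a         ≈⟨ *-congˡ (elem-s k a) ⟩
  elem k j * s k (1^ a)       ≈⟨ pieri k j (proj₁ (1^-desc a)) ⟩
  ∑ (vstrips j (1^ a)) (s k)  ∎
  where
  open RingKit (Poly k)
  open Sums (Poly k)

-- The dual Jacobi-Trudi formula for two columns, of lengths r+d+1 and r+1.
schurSum-twoColumns : ∀ r d → SchurSum (suc (r ℕ.+ d) ℕ.+ suc r) (λ k → let open CommutativeRing (Poly k) in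
  elem k (suc (r ℕ.+ d)) * elem k (suc r) - elem k (2 ℕ.+ (r ℕ.+ d)) * elem k r)
schurSum-twoColumns r d = twoColumns (suc r) d ∷ [] , twoColumns-wide r d ∷ [] , λ k →
  let open RingKit (Poly k)
      open Sums (Poly k)
      open Solver in begin
    elem k (suc (r ℕ.+ d)) * elem k (suc r) - elem k (2 ℕ.+ (r ℕ.+ d)) * elem k r
      ≈⟨ +-cong (trans (elem-elem k (suc (r ℕ.+ d)) (suc r)) (vstrips-twoColumns (Poly k) r d (s k)))
           (-‿cong (elem-elem k (2 ℕ.+ (r ℕ.+ d)) r)) ⟩
    (∑ (vstrips r (1^ (2 ℕ.+ (r ℕ.+ d)))) (s k) + s k (twoColumns (suc r) d)) - ∑ (vstrips r (1^ (2 ℕ.+ (r ℕ.+ d)))) (s k)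
      ≈⟨ solve 2 (λ a b → (a :+ b) :- a := b :+ con (+ 0)) refl _ _ ⟩
    s k (twoColumns (suc r) d) + 0#
      ∎

private module Walk (k : ℕ) = Walks (Poly k) k (var k)

-- For `r` at most `m` = `r + d` the first factor of each leading product in `R′` has the larger
-- index, so every difference is one Schur function. Unfolding `R′` raises `m` and lowers `r`, hence
-- widens the gap `d` by two.
schurSum-R′-≤ : ∀ r d → SchurSum ((r ℕ.+ d) ℕ.+ r) (λ k → Walk.R′ k (r ℕ.+ d) r)
schurSum-R′-≤ zero    d = schurSum-0#
schurSum-R′-≤ (suc r) d = schurSum-+
  (≡.subst₂ (λ N m → SchurSum N (λ k → Walk.R′ k m r)) degree index (schurSum-R′-≤ r (2 ℕ.+ d)))
  (schurSum-ι (suc r ℕ.* suc (suc (r ℕ.+ d))) (schurSum-twoColumns r d))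
  where
  index : r ℕ.+ (2 ℕ.+ d) ≡ 2 ℕ.+ (r ℕ.+ d)
  index = ≡.trans (ℕ.+-suc r (suc d)) (≡.cong suc (ℕ.+-suc r d))
  degree : r ℕ.+ (2 ℕ.+ d) ℕ.+ r ≡ suc (r ℕ.+ d) ℕ.+ suc r
  degree = ≡.trans (≡.cong (ℕ._+ r) index) (≡.sym (ℕ.+-suc (suc (r ℕ.+ d)) r))

schurSum-R′ : ∀ m r → SchurSum (m ℕ.+ r) (λ k → Walk.R′ k m r)
schurSum-R′ m r with ℕ.≤-total r m
... | inj₁ r≤m = ≡.subst (λ m → SchurSum (m ℕ.+ r) (λ k → Walk.R′ k m r)) (ℕ.m+[n∸m]≡n r≤m) (schurSum-R′-≤ r (m ∸ r))
... | inj₂ m≤r = ≡.subst (λ r → SchurSum (m ℕ.+ r) (λ k → Walk.R′ k m r)) (ℕ.m∸n+n≡m m≤r) flipped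
  where
  d = r ∸ m
  flipped : SchurSum (m ℕ.+ (d ℕ.+ m)) (λ k → Walk.R′ k m (d ℕ.+ m))
  flipped = schurSum-cong (λ k → Walk.R′-flip k m d)
    (≡.subst₂ (λ N m′ → SchurSum N (λ k → Walk.R′ k m′ m))
      (≡.trans (≡.cong (ℕ._+ m) (ℕ.+-comm m d)) (ℕ.+-comm (d ℕ.+ m) m)) (ℕ.+-comm m d) (schurSum-R′-≤ m d))

schurSum-K : ∀ a N {F} → SchurSum N F → SchurSum (suc a ℕ.+ N) (λ k → CommutativeRing._*_ (Poly k) (Walk.K k a 0) (F k))
schurSum-K a N {F} S = ≡.subst (λ b → SchurSum (suc a ℕ.+ N) (λ k → let open RingKit (Poly k) in ι b * elem k (suc b) * F k))
  (≡.sym (ℕ.+-identityʳ a))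
  (schurSum-cong (λ k → let open RingKit (Poly k) in *-assoc (ι a) (elem k (suc a)) (F k))
    (schurSum-ι a (schurSum-elem (suc a) S)))

schurSum-⊛ : ∀ M r a (G : ∀ k → ℕ → ⟨Poly⟩ k) → (∀ j → j ≤ r → SchurSum (M ℕ.+ j) (λ k → G k j)) →
  SchurSum (suc a ℕ.+ (M ℕ.+ r)) (λ k → PowerSeries._⊛_ (Poly k) (Walk.K k a) (G k) r)
schurSum-⊛ M zero    a G S = schurSum-K a (M ℕ.+ 0) (S 0 z≤n)
schurSum-⊛ M (suc r) a G S = schurSum-+ (schurSum-K a (M ℕ.+ suc r) (S (suc r) ℕ.≤-refl))
  (≡.subst (λ N → SchurSum N (λ k → PowerSeries._⊛_ (Poly k) (Walk.K k a ∘ suc) (G k) r))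
    (≡.cong suc (≡.trans (≡.sym (ℕ.+-suc a (M ℕ.+ r))) (≡.cong (a ℕ.+_) (≡.sym (ℕ.+-suc M r)))))
    (schurSum-cong (λ k → PowerSeries.⊛-cong (Poly k) (Walk.K-suc k a) (λ _ → CommutativeRing.refl (Poly k)) r)
      (schurSum-⊛ M r (suc a) G λ j j≤r → S j (ℕ.m≤n⇒m≤1+n j≤r))))

schurSum-D : ∀ m r → SchurSum (suc m ℕ.+ r) (λ k → Walk.D k m (suc r))
schurSum-D m r = up-to r r ℕ.≤-refl
  where
  -- The convolution in `D-2` involves all earlier values, hence the strengthening to every `j` up
  -- to `r`.
  up-to : ∀ r j → j ≤ r → SchurSum (suc m ℕ.+ j) (λ k → Walk.D k m (suc j))
  up-to zero zero z≤n = schurSum-cong (λ k → Walk.D-1 k m)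
    (≡.subst (λ N → SchurSum N (λ k → Walk.R′ k m 1)) (ℕ.+-suc m 0) (schurSum-R′ m 1))
  up-to (suc r) j j≤1+r with ℕ.m≤n⇒m<n∨m≡n j≤1+r
  ... | inj₁ (s≤s j≤r) = up-to r j j≤r
  ... | inj₂ ≡.refl    = schurSum-cong (λ k → Walk.D-2 k m r) (schurSum-+
    (≡.subst (λ N → SchurSum N (λ k → PowerSeries._⊛_ (Poly k) (Walk.K k 0) (Walk.D k m ∘ suc) r))
      (≡.sym (ℕ.+-suc (suc m) r))
      (schurSum-⊛ (suc m) r 0 (λ k → Walk.D k m ∘ suc) (up-to r)))
    (≡.subst (λ N → SchurSum N (λ k → Walk.R′ k m (2 ℕ.+ r))) (ℕ.+-suc m (suc r)) (schurSum-R′ m (2 ℕ.+ r))))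

-- Linear combinations over the partitions of N

private module ℚₖ = RingKit (Poly 0)
open Sums (Poly 0)
open ℚₖ using (ι)

_≟ₛ_ : (ν μ : Shape) → Dec (ν ≡ μ)
_≟ₛ_ = ≡-dec ℕ._≟_

∑-filter : ∀ {A : Set} {P : Pred A 0ℓ} (P? : Decidable P) xs (f : A → ℚ) →
  ∑ (filter P? xs) f ≡ ∑ xs (λ x → [ P? x ] ℚ.* f x)
∑-filter P? []       f = ≡.refl
∑-filter P? (x ∷ xs) f with P? x
... | yes _ = ≡.cong₂ ℚ._+_ (≡.sym (ℚ.*-identityˡ (f x))) (∑-filter P? xs f)
... | no  _ = ≡.trans (∑-filter P? xs f) (≡.trans (≡.sym (ℚ.+-identityˡ _)) (≡.cong (ℚ._+ _) (≡.sym (ℚ.*-zeroˡ (f x)))))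

∑-point : ∀ k x (f : ℕ → ℚ) → x < k → ∑ (allFin k) (λ c → [ toℕ c ℕ.≟ x ] ℚ.* f (toℕ c)) ≡ f x
∑-point (suc k) zero f x<k = begin
  ∑ (allFin (suc k)) (λ c → [ toℕ c ℕ.≟ 0 ] ℚ.* f (toℕ c))
    ≡⟨ ∑-allFin {k} (λ c → [ toℕ c ℕ.≟ 0 ] ℚ.* f (toℕ c)) ⟩
  1ℚ ℚ.* f 0 ℚ.+ ∑ (allFin k) (λ c → 0ℚ ℚ.* f (suc (toℕ c)))
    ≡⟨ ≡.cong₂ ℚ._+_ (ℚ.*-identityˡ (f 0)) (∑-zero (allFin k) λ c → ℚ.*-zeroˡ (f (suc (toℕ c)))) ⟩
  f 0 ℚ.+ 0ℚ
    ≡⟨ ℚ.+-identityʳ (f 0) ⟩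
  f 0 ∎
  where open ≡.≡-Reasoning
∑-point (suc k) (suc x) f (s≤s x<k) = begin
  ∑ (allFin (suc k)) (λ c → [ toℕ c ℕ.≟ suc x ] ℚ.* f (toℕ c))
    ≡⟨ ∑-allFin {k} (λ c → [ toℕ c ℕ.≟ suc x ] ℚ.* f (toℕ c)) ⟩
  0ℚ ℚ.* f 0 ℚ.+ ∑ (allFin k) (λ c → [ suc (toℕ c) ℕ.≟ suc x ] ℚ.* f (suc (toℕ c)))
    ≡⟨ ≡.cong₂ ℚ._+_ (ℚ.*-zeroˡ (f 0)) (≡.trans (∑-cong (allFin k) λ c →
         ≡.cong (ℚ._* f (suc (toℕ c))) ([]-cong (suc (toℕ c) ℕ.≟ suc x) (toℕ c ℕ.≟ x) ℕ.suc-injective (≡.cong suc)))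
         (∑-point k x (f ∘ suc) x<k)) ⟩
  0ℚ ℚ.+ f (suc x)
    ≡⟨ ℚ.+-identityˡ (f (suc x)) ⟩
  f (suc x) ∎
  where open ≡.≡-Reasoning

∑-applyUpTo : ∀ n g (f : ℕ → ℚ) → ∑ (applyUpTo g n) f ≡ ∑ (allFin n) (λ c → f (g (toℕ c)))
∑-applyUpTo zero    g f = ≡.refl
∑-applyUpTo (suc n) g f = ≡.trans (≡.cong (f (g 0) ℚ.+_) (∑-applyUpTo n (g ∘ suc) f))
  (≡.sym (∑-allFin {n} (λ c → f (g (toℕ c)))))

parts : ∀ {k ℓ} → Vec (Fin k) ℓ → Shape
parts w = map toℕ (Vec.toList w)

∑-words-point : ∀ k ℓ μ (f : Shape → ℚ) → All (_< k) μ →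
  ∑ (words k ℓ) (λ w → [ parts w ≟ₛ μ ] ℚ.* f (parts w)) ≡ [ ℓ ℕ.≟ length μ ] ℚ.* f μ
∑-words-point k zero    []      f b = ℚ.+-identityʳ _
∑-words-point k zero    (x ∷ μ) f b = ≡.trans (ℚ.+-identityʳ _) (≡.trans (ℚ.*-zeroˡ (f [])) (≡.sym (ℚ.*-zeroˡ (f (x ∷ μ)))))
∑-words-point k (suc ℓ) []      f b = ≡.trans (∑-zero (words k (suc ℓ)) λ
  { (c Vec.∷ w) → ℚ.*-zeroˡ (f (parts (c Vec.∷ w))) })
  (≡.sym (ℚ.*-zeroˡ (f [])))
∑-words-point k (suc ℓ) (x ∷ μ) f (x<k ∷ b) = begin
  ∑ (words k (suc ℓ)) (λ w → [ parts w ≟ₛ (x ∷ μ) ] ℚ.* f (parts w))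
    ≡⟨ ∑-product Vec._∷_ (allFin k) (words k ℓ) (λ w → [ parts w ≟ₛ (x ∷ μ) ] ℚ.* f (parts w)) ⟩
  ∑ (allFin k) (λ c → ∑ (words k ℓ) (λ w → [ (toℕ c ∷ parts w) ≟ₛ (x ∷ μ) ] ℚ.* f (toℕ c ∷ parts w)))
    ≡⟨ ∑-cong (allFin k) (λ c → ≡.trans (∑-cong (words k ℓ) λ w →
         ≡.trans (≡.cong (ℚ._* f (toℕ c ∷ parts w))
           ([]-× (toℕ c ℕ.≟ x) (parts w ≟ₛ μ) ((toℕ c ∷ parts w) ≟ₛ (x ∷ μ)) ∷-injective (≡.cong₂ _∷_)))
           (ℚ.*-assoc [ toℕ c ℕ.≟ x ] [ parts w ≟ₛ μ ] (f (toℕ c ∷ parts w))))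
       (≡.trans (∑-*ˡ (words k ℓ) [ toℕ c ℕ.≟ x ] (λ w → [ parts w ≟ₛ μ ] ℚ.* f (toℕ c ∷ parts w)))
         (≡.cong ([ toℕ c ℕ.≟ x ] ℚ.*_) (∑-words-point k ℓ μ (f ∘ (toℕ c ∷_)) b)))) ⟩
  ∑ (allFin k) (λ c → [ toℕ c ℕ.≟ x ] ℚ.* ([ ℓ ℕ.≟ length μ ] ℚ.* f (toℕ c ∷ μ)))
    ≡⟨ ∑-point k x (λ y → [ ℓ ℕ.≟ length μ ] ℚ.* f (y ∷ μ)) x<k ⟩
  [ ℓ ℕ.≟ length μ ] ℚ.* f (x ∷ μ)
    ≡⟨ ≡.cong (ℚ._* f (x ∷ μ)) ([]-cong (ℓ ℕ.≟ length μ) (suc ℓ ℕ.≟ suc (length μ)) (≡.cong suc) ℕ.suc-injective) ⟩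
  [ suc ℓ ℕ.≟ length (x ∷ μ) ] ℚ.* f (x ∷ μ)
    ∎
  where open ≡.≡-Reasoning

length≤sum : ∀ {μ} → Positive μ → length μ ≤ sum μ
length≤sum []        = z≤n
length≤sum (p ∷ ps) = ℕ.+-mono-≤ p (length≤sum ps)

parts≤sum : ∀ μ → All (_≤ sum μ) μ
parts≤sum []      = []
parts≤sum (x ∷ μ) = ℕ.m≤m+n x (sum μ) ∷ All.map (λ p → ℕ.≤-trans p (ℕ.m≤n+m (sum μ) x)) (parts≤sum μ)

-- The enumeration contains each partition exactly once: the length and the parts of `μ` are at most
-- `N`, so `μ` is among the words searched, and a word is determined by its parts.
∑-partitions-point : ∀ {N μ} → μ ⊢ N → (f : Shape → ℚ) →
  ∑ (partitions N) (λ ν → [ ν ≟ₛ μ ] ℚ.* f ν) ≡ f μ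
∑-partitions-point {N} {μ} μ⊢N@(_ , pos , ≡.refl) f = begin
  ∑ (partitions N) (λ ν → [ ν ≟ₛ μ ] ℚ.* f ν)
    ≡⟨ ∑-filter (_⊢? N) (concatMap (λ ℓ → map parts (words (suc N) ℓ)) (upTo (suc N))) (λ ν → [ ν ≟ₛ μ ] ℚ.* f ν) ⟩
  ∑ (concatMap (λ ℓ → map parts (words (suc N) ℓ)) (upTo (suc N))) (λ ν → [ ν ⊢? N ] ℚ.* ([ ν ≟ₛ μ ] ℚ.* f ν))
    ≡⟨ ∑-concatMap (upTo (suc N)) (λ ℓ → map parts (words (suc N) ℓ)) h ⟩
  ∑ (upTo (suc N)) (λ ℓ → ∑ (map parts (words (suc N) ℓ)) (λ ν → [ ν ⊢? N ] ℚ.* ([ ν ≟ₛ μ ] ℚ.* f ν)))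
    ≡⟨ ∑-cong (upTo (suc N)) (λ ℓ → ≡.trans (∑-map (words (suc N) ℓ) parts h) (≡.trans
         (∑-cong (words (suc N) ℓ) λ w → swap [ parts w ⊢? N ] [ parts w ≟ₛ μ ] (f (parts w)))
         (∑-words-point (suc N) ℓ μ g (All.map s≤s (parts≤sum μ))))) ⟩
  ∑ (upTo (suc N)) (λ ℓ → [ ℓ ℕ.≟ length μ ] ℚ.* g μ)
    ≡⟨ ∑-applyUpTo (suc N) id (λ ℓ → [ ℓ ℕ.≟ length μ ] ℚ.* g μ) ⟩
  ∑ (allFin (suc N)) (λ c → [ toℕ c ℕ.≟ length μ ] ℚ.* g μ)
    ≡⟨ ∑-point (suc N) (length μ) (λ _ → g μ) (s≤s (length≤sum pos)) ⟩
  [ μ ⊢? N ] ℚ.* f μ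
    ≡⟨ ≡.cong (ℚ._* f μ) ([]-yes (μ ⊢? N) μ⊢N) ⟩
  1ℚ ℚ.* f μ
    ≡⟨ ℚ.*-identityˡ (f μ) ⟩
  f μ
    ∎
  where
  open ≡.≡-Reasoning
  g : Shape → ℚ
  g ν = [ ν ⊢? N ] ℚ.* f ν
  h : Shape → ℚ
  h ν = [ ν ⊢? N ] ℚ.* ([ ν ≟ₛ μ ] ℚ.* f ν)
  swap : ∀ a b c → a ℚ.* (b ℚ.* c) ≡ b ℚ.* (a ℚ.* c)
  swap = ℚₖ.Solver.solve 3 (λ a b c → a :* (b :* c) := b :* (a :* c)) ≡.refl
    where open ℚₖ.Solver

sumℚ-∑ : ∀ {A : Set} (xs : List A) f → sumℚ (map f xs) ≡ ∑ xs f
sumℚ-∑ []       f = ≡.refl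
sumℚ-∑ (x ∷ xs) f = ≡.cong (f x ℚ.+_) (sumℚ-∑ xs f)

combination : ℕ → (Shape → ℚ) → Series
combination N c α = ∑ (partitions N) (λ μ → c μ ℚ.* schur μ α)

module _ (N : ℕ) where
  combination-+ : ∀ c d α → combination N (λ μ → c μ ℚ.+ d μ) α ≡ combination N c α ℚ.+ combination N d α
  combination-+ c d α = ≡.trans (∑-cong (partitions N) λ μ → ℚ.*-distribʳ-+ (schur μ α) (c μ) (d μ))
    (∑-+ (partitions N) (λ μ → c μ ℚ.* schur μ α) (λ μ → d μ ℚ.* schur μ α))

  combination-* : ∀ q c α → combination N (λ μ → q ℚ.* c μ) α ≡ q ℚ.* combination N c α
  combination-* q c α = ≡.trans (∑-cong (partitions N) λ μ → ℚ.*-assoc q (c μ) (schur μ α))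
    (∑-*ˡ (partitions N) q (λ μ → c μ ℚ.* schur μ α))

-- Turns a list of shapes, possibly with repetitions, into Schur coefficients.
multiplicity : List Shape → Shape → ℚ
multiplicity Λ ν = ∑ Λ (λ μ → [ ν ≟ₛ μ ])

combination-multiplicity : ∀ {N Λ} → All (_⊢ N) Λ → ∀ α → combination N (multiplicity Λ) α ≡ ∑ Λ (λ μ → schur μ α)
combination-multiplicity {N} {Λ} ps α = begin
  ∑ (partitions N) (λ ν → ∑ Λ (λ μ → [ ν ≟ₛ μ ]) ℚ.* schur ν α)
    ≡⟨ ∑-cong (partitions N) (λ ν → ≡.sym (∑-*ʳ Λ (schur ν α) (λ μ → [ ν ≟ₛ μ ]))) ⟩
  ∑ (partitions N) (λ ν → ∑ Λ (λ μ → [ ν ≟ₛ μ ] ℚ.* schur ν α))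
    ≡⟨ ∑-swap (partitions N) Λ (λ ν μ → [ ν ≟ₛ μ ] ℚ.* schur ν α) ⟩
  ∑ Λ (λ μ → ∑ (partitions N) (λ ν → [ ν ≟ₛ μ ] ℚ.* schur ν α))
    ≡⟨ ∑-cong-All (All.map (λ p → ∑-partitions-point p (λ ν → schur ν α)) ps) ⟩
  ∑ Λ (λ μ → schur μ α)
    ∎
  where open ≡.≡-Reasoning

combination-coeff : ∀ {N Λ} → All (_⊢ N) Λ → ∀ α →
  combination N (multiplicity Λ) α ≡ coeff (length α) (Sums.∑ (Poly (length α)) Λ (s (length α))) (lookup α)
combination-coeff {N} {Λ} ps α = ≡.trans (combination-multiplicity ps α) (≡.trans
  (∑-cong-All (All.map (λ { (d , _) → schur-s d α }) ps))
  (≡.sym (coeff-∑ (length α) Λ (s (length α)) (lookup α))))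

[]-nonNeg : ∀ {P : Set} (d : Dec P) → 0ℚ ℚ.≤ [ d ]
[]-nonNeg (yes _) = ℚ.nonNegative⁻¹ 1ℚ
[]-nonNeg (no _)  = ℚ.≤-refl

multiplicity-nonNeg : ∀ Λ ν → 0ℚ ℚ.≤ multiplicity Λ ν
multiplicity-nonNeg []      ν = ℚ.≤-refl
multiplicity-nonNeg (μ ∷ Λ) ν = ℚ.+-mono-≤ ([]-nonNeg (ν ≟ₛ μ)) (multiplicity-nonNeg Λ ν)

hd-1^ : ∀ N → hd (1^ N) ≤ 1
hd-1^ zero    = z≤n
hd-1^ (suc N) = s≤s z≤n

multiplicity-1^ : ∀ {N M Λ} → All (Wide M) Λ → multiplicity Λ (1^ N) ≡ 0ℚ
multiplicity-1^ []            = ≡.refl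
multiplicity-1^ {N} {Λ = μ ∷ Λ} ((_ , h) ∷ ws) = ≡.trans
  (≡.cong₂ ℚ._+_ ([]-no (1^ N ≟ₛ μ) λ eq → ℕ.<⇒≱ (≡.subst (λ ν → 1 < hd ν) (≡.sym eq) h) (hd-1^ N)) (multiplicity-1^ {N} ws))
  (ℚ.+-identityˡ 0ℚ)

0<ι : ∀ n → ℚ.Positive (ι (suc n))
0≤ι : ∀ n → 0ℚ ℚ.≤ ι n

0<ι n = ℚ.positive (ℚ.<-≤-trans (ℚ.positive⁻¹ 1ℚ) (≡.subst (ℚ._≤ ι (suc n)) (ℚ.+-identityʳ 1ℚ) (ℚ.+-monoʳ-≤ 1ℚ (0≤ι n))))

0≤ι zero    = ℚ.≤-refl
0≤ι (suc n) = ℚ.<⇒≤ (ℚ.positive⁻¹ (ι (suc n)) {{0<ι n}})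

inverse : ∀ p → ℚ.Positive p → ℚ
inverse p pos = (ℚ.1/ p) {{ℚ.pos⇒nonZero p {{pos}}}}

inverse-* : ∀ p (pos : ℚ.Positive p) → p ℚ.* inverse p pos ≡ 1ℚ
inverse-* p pos = ℚ.*-inverseʳ p {{ℚ.pos⇒nonZero p {{pos}}}}

*-cancel-pos : ∀ p → ℚ.Positive p → ∀ {x y} → p ℚ.* x ≡ p ℚ.* y → x ≡ y
*-cancel-pos p pos {x} {y} eq = begin
  x                              ≡⟨ unit x ⟨
  inverse p pos ℚ.* (p ℚ.* x)    ≡⟨ ≡.cong (inverse p pos ℚ.*_) eq ⟩
  inverse p pos ℚ.* (p ℚ.* y)    ≡⟨ unit y ⟩
  y                              ∎
  where
  open ≡.≡-Reasoning
  unit : ∀ x → inverse p pos ℚ.* (p ℚ.* x) ≡ x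
  unit x = ≡.trans (≡.sym (ℚ.*-assoc (inverse p pos) p x))
    (≡.trans (≡.cong (ℚ._* x) (≡.trans (ℚ.*-comm (inverse p pos) p) (inverse-* p pos))) (ℚ.*-identityˡ x))

-- Normalised Schur coefficients of lollipops

abstract
  -- Abstract, since only the width of these shapes and the sum of their Schur functions matter, not
  -- the list that the recursion builds.
  dShapes : ℕ → ℕ → List Shape
  dShapes m n = proj₁ (schurSum-D m n)

  dShapes-wide : ∀ m n → All (Wide (suc m ℕ.+ n)) (dShapes m n)
  dShapes-wide m n = proj₁ (proj₂ (schurSum-D m n))

  dShapes-sum : ∀ m n k → CommutativeRing._≈_ (Poly k) (Walks.D (Poly k) k (var k) m (suc n))
    (Sums.∑ (Poly k) (dShapes m n) (s k))
  dShapes-sum m n = proj₂ (proj₂ (schurSum-D m n))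

2^_ : ℕ → ℚ
2^ zero  = 1ℚ
2^ suc n = ι 2 ℚ.* (2^ n)

2^-pos : ∀ n → ℚ.Positive (2^ n)
2^-pos zero    = _
2^-pos (suc n) = ℚ.pos*pos⇒pos (ι 2) {{0<ι 1}} (2^ n) {{2^-pos n}}

-- The coefficient of s_(1^N) in u k m (suc n), where N = suc m + n.
leading : ℕ → ℕ → ℚ
leading m n = ι (suc m) ℚ.* (2^ n)

leading-pos : ∀ m n → ℚ.Positive (leading m n)
leading-pos m n = ℚ.pos*pos⇒pos (ι (suc m)) {{0<ι m}} (2^ n) {{2^-pos n}}

module _ (m n : ℕ) where
  private
    p = ι (2 ℕ.+ m) ℚ.* leading m (suc n)
    pos = ℚ.pos*pos⇒pos (ι (2 ℕ.+ m)) {{0<ι (suc m)}} (leading m (suc n)) {{leading-pos m (suc n)}}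

  -- The factor of D after `U-D` is divided by (m+2) `leading m (suc n)`, which equals 2(m+1)
  -- `leading (suc m) n`. It is 0 for `m` = 0, where the cliques of sizes 1 and 2 both give a path.
  step : ℚ
  step = ι m ℚ.* inverse p pos

  step-* : (ι (2 ℕ.+ m) ℚ.* leading m (suc n)) ℚ.* step ≡ ι m
  step-* = ≡.trans (ℚₖ.Solver.solve 3 (λ a b c → a :* (b :* c) := b :* (a :* c)) ≡.refl p (ι m) (inverse p pos))
    (≡.trans (≡.cong (ι m ℚ.*_) (inverse-* p pos)) (ℚ.*-identityʳ (ι m)))
    where open ℚₖ.Solver

  step-nonNeg : ℚ.NonNegative step
  step-nonNeg = ℚ.nonNeg*nonNeg⇒nonNeg (ι m) {{ℚ.nonNegative (0≤ι m)}} (inverse p pos)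
    {{ℚ.pos⇒nonNeg (inverse p pos) {{ℚ.1/pos⇒pos p {{pos}}}}}}

-- The Schur coefficients of the lollipop with clique size suc m and tail
-- length n, divided by the one at (1^N).
normalised : ℕ → ℕ → Shape → ℚ
normalised m zero    = multiplicity (1^ (suc m) ∷ [])
normalised m (suc n) = λ ν → normalised (suc m) n ν ℚ.+ step m n ℚ.* multiplicity (dShapes (suc m) n) ν

-- Induction on the tail by `U-D`. The base case belongs to the complete graph: `U m 1` is (m+1)
-- e_{m+1}, a multiple of s_(1^N).
coeff-u : ∀ m n α → let k = length α in
  coeff k (u k m (suc n)) (lookup α) ≡ leading m n ℚ.* combination (suc m ℕ.+ n) (normalised m n) α
coeff-u m zero α = begin
  coeff k (u k m 1) β
    ≡⟨ coeff-cong k β (begin-≈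
         W.U m 1                              ≈⟨ W.U-suc m 0 ⟩
         K.ι m * W.ε (suc m) * 1# + W.ε (suc m) ≈⟨ solve 2
           (λ n a → n :* a :* con (+ 1) :+ a := (con (+ 1) :+ n) :* a) refl (K.ι m) (W.ε (suc m)) ⟩
         K.ι (suc m) * W.ε (suc m)            ≈⟨ *-congˡ (trans (elem-s k (suc m)) (sym (+-identityʳ (s k (1^ (suc m)))))) ⟩
         K.ι (suc m) * S.∑ Λ (s k)            ∎-≈) ⟩
  coeff k (K.ι (suc m) * S.∑ Λ (s k)) β
    ≡⟨ coeff-ι k (suc m) (S.∑ Λ (s k)) β ⟩
  ι (suc m) ℚ.* coeff k (S.∑ Λ (s k)) β
    ≡⟨ ≡.cong₂ ℚ._*_ (ℚ.*-identityʳ (ι (suc m))) (combination-coeff (1^⊢ ∷ []) α) ⟨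
  leading m 0 ℚ.* combination (suc m ℕ.+ 0) (normalised m 0) α
    ∎
  where
  k = length α
  β = lookup α
  Λ = 1^ (suc m) ∷ []
  module K = RingKit (Poly k)
  module S = Sums (Poly k)
  module W = Walks (Poly k) k (var k)
  open K using (_+_; _*_; 1#; refl; sym; trans; *-congˡ; +-identityʳ; _≈_; step-≈-⟩) renaming (begin_ to begin-≈_; _∎ to _∎-≈)
  open K.Solver
  open ≡.≡-Reasoning
  1^⊢ : 1^ (suc m) ⊢ suc m ℕ.+ 0
  1^⊢ = proj₁ (1^-desc (suc m)) , proj₂ (1^-desc (suc m)) , ≡.trans (sum-1^ (suc m)) (≡.sym (ℕ.+-identityʳ (suc m)))
coeff-u m (suc n) α = *-cancel-pos (ι (2 ℕ.+ m)) (0<ι (suc m)) (begin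
  ι (2 ℕ.+ m) ℚ.* coeff k (u k m (2 ℕ.+ n)) β
    ≡⟨ coeff-ι k (2 ℕ.+ m) (u k m (2 ℕ.+ n)) β ⟨
  coeff k (K.ι (2 ℕ.+ m) K.* u k m (2 ℕ.+ n)) β
    ≡⟨ coeff-cong k β (K.trans (W.U-D m (suc n)) (K.+-cong (K.*-assoc _ _ _) (K.*-congˡ (dShapes-sum (suc m) n k)))) ⟩
  coeff k (K.ι 2 K.* (K.ι (suc m) K.* u k (suc m) (suc n)) K.+ K.ι m K.* S.∑ Λ (s k)) β
    ≡⟨ ≡.trans (coeff-+ k _ _ β) (≡.cong₂ ℚ._+_
         (≡.trans (coeff-ι k 2 _ β) (≡.cong (ι 2 ℚ.*_)
           (≡.trans (coeff-ι k (suc m) _ β) (≡.cong (ι (suc m) ℚ.*_) (coeff-u (suc m) n α)))))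
         (≡.trans (coeff-ι k m _ β) (≡.cong (ι m ℚ.*_)
           (≡.sym (combination-coeff (All.map proj₁ (dShapes-wide (suc m) n)) α))))) ⟩
  ι 2 ℚ.* (ι (suc m) ℚ.* (leading (suc m) n ℚ.* C)) ℚ.+ ι m ℚ.* T
    ≡⟨ ≡.cong (λ h → ι 2 ℚ.* (ι (suc m) ℚ.* (leading (suc m) n ℚ.* C)) ℚ.+ h ℚ.* T) (step-* m n) ⟨
  ι 2 ℚ.* (ι (suc m) ℚ.* ((ι (2 ℕ.+ m) ℚ.* (2^ n)) ℚ.* C)) ℚ.+ ((ι (2 ℕ.+ m) ℚ.* leading m (suc n)) ℚ.* step m n) ℚ.* T
    ≡⟨ ℚₖ.Solver.solve 7 (λ two a b t c w d → two :* (a :* ((b :* t) :* c)) :+ ((b :* (a :* (two :* t))) :* w) :* d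
          := b :* ((a :* (two :* t)) :* (c :+ w :* d))) ≡.refl (ι 2) (ι (suc m)) (ι (2 ℕ.+ m)) (2^ n) C (step m n) T ⟩
  ι (2 ℕ.+ m) ℚ.* (leading m (suc n) ℚ.* (C ℚ.+ step m n ℚ.* T))
    ≡⟨ ≡.cong (λ h → ι (2 ℕ.+ m) ℚ.* (leading m (suc n) ℚ.* h)) combine ⟨
  ι (2 ℕ.+ m) ℚ.* (leading m (suc n) ℚ.* combination (suc m ℕ.+ suc n) (normalised m (suc n)) α)
    ∎)
  where
  k = length α
  β = lookup α
  Λ = dShapes (suc m) n
  N = suc (suc m) ℕ.+ n
  C = combination N (normalised (suc m) n) α
  T = combination N (multiplicity Λ) α
  module K = RingKit (Poly k)
  module S = Sums (Poly k)
  module W = Walks (Poly k) k (var k)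
  open ℚₖ.Solver
  open ≡.≡-Reasoning
  combine : combination (suc m ℕ.+ suc n) (normalised m (suc n)) α ≡ C ℚ.+ step m n ℚ.* T
  combine = ≡.trans (≡.cong (λ N → combination N (normalised m (suc n)) α) (ℕ.+-suc (suc m) n))
    (≡.trans (combination-+ N (normalised (suc m) n) (λ ν → step m n ℚ.* multiplicity Λ ν) α)
      (≡.cong (C ℚ.+_) (combination-* N (step m n) (multiplicity Λ) α)))

normalised-1^ : ∀ m n → normalised m n (1^ (suc m ℕ.+ n)) ≡ 1ℚ
normalised-1^ m zero = ≡.trans (ℚ.+-identityʳ _)
  ([]-yes (1^ (suc m ℕ.+ 0) ≟ₛ 1^ (suc m)) (≡.cong 1^ (ℕ.+-identityʳ (suc m))))
normalised-1^ m (suc n) = begin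
  normalised (suc m) n (1^ (suc m ℕ.+ suc n)) ℚ.+ step m n ℚ.* multiplicity (dShapes (suc m) n) (1^ (suc m ℕ.+ suc n))
    ≡⟨ ≡.cong₂ (λ a b → normalised (suc m) n (1^ a) ℚ.+ step m n ℚ.* b) (ℕ.+-suc (suc m) n)
         (multiplicity-1^ {suc m ℕ.+ suc n} (dShapes-wide (suc m) n)) ⟩
  normalised (suc m) n (1^ (suc (suc m) ℕ.+ n)) ℚ.+ step m n ℚ.* 0ℚ
    ≡⟨ ≡.cong₂ ℚ._+_ (normalised-1^ (suc m) n) (ℚ.*-zeroʳ (step m n)) ⟩
  1ℚ ℚ.+ 0ℚ
    ≡⟨ ℚ.+-identityʳ 1ℚ ⟩
  1ℚ
    ∎
  where open ≡.≡-Reasoning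

-- Each vertex moved from the clique to the tail adds a nonnegative multiple of multiplicities to
-- every coefficient.
normalised-mono : ∀ d m n ν → normalised (d ℕ.+ m) n ν ℚ.≤ normalised m (d ℕ.+ n) ν
normalised-mono zero    m n ν = ℚ.≤-refl
normalised-mono (suc d) m n ν = ℚ.≤-trans
  (≡.subst (λ h → normalised h n ν ℚ.≤ normalised (suc m) (d ℕ.+ n) ν) (ℕ.+-suc d m) (normalised-mono d (suc m) n ν))
  (≡.subst (ℚ._≤ normalised m (suc d ℕ.+ n) ν) (ℚ.+-identityʳ _)
    (ℚ.+-monoʳ-≤ (normalised (suc m) (d ℕ.+ n) ν) (ℚ.nonNegative⁻¹ _
      {{ℚ.nonNeg*nonNeg⇒nonNeg (step m (d ℕ.+ n)) {{step-nonNeg m (d ℕ.+ n)}}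
          (multiplicity (dShapes (suc m) (d ℕ.+ n)) ν)
            {{ℚ.nonNegative (multiplicity-nonNeg (dShapes (suc m) (d ℕ.+ n)) ν)}}}})))

-- The order on lollipops

open import Data.Nat using (_+_)

module _ {N : ℕ} (G H : ConnectedGraph N) {q q′ : ℚ} {c c′ : List ℕ → ℚ} where
  -- As `c` and `c′` are 1 at the column, the quotient in `Xₛ` is `q` over `q′`, and `Xₛ` becomes
  -- `q` times the combination with coefficients `c μ - c′ μ`.
  ≥ₛ-normalised : ℚ.Positive q → ℚ.Positive q′ → c (1^ N) ≡ 1ℚ → c′ (1^ N) ≡ 1ℚ →
    (∀ α → X (graph G) α ≡ q ℚ.* combination N c α) →
    (∀ α → X (graph H) α ≡ q′ ℚ.* combination N c′ α) →
    (∀ ν → c′ ν ℚ.≤ c ν) → G ≥ₛ H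
  ≥ₛ-normalised pos pos′ c-1 c′-1 XG XH c′≤c = record
    { cG = λ ν → q ℚ.* c ν
    ; cH = λ ν → q′ ℚ.* c′ ν
    ; expansionG = λ α → expand q c α (XG α)
    ; expansionH = λ α → expand q′ c′ α (XH α)
    ; nonZero = nz
    ; schurPositive = (λ ν → q ℚ.* (c ν ℚ.- c′ ν)) , difference , λ ν _ → nonNeg ν
    }
    where
    open ≡.≡-Reasoning

    expand : ∀ q c α {x} → x ≡ q ℚ.* combination N c α → x ≡ sumℚ (map (λ μ → (q ℚ.* c μ) ℚ.* schur μ α) (partitions N))
    expand q c α eq = ≡.trans eq (≡.trans (≡.sym (combination-* N q c α)) (≡.sym (sumℚ-∑ (partitions N) _)))

    a = q ℚ.* c (1^ N)
    b = q′ ℚ.* c′ (1^ N)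

    b≡q′ : b ≡ q′
    b≡q′ = ≡.trans (≡.cong (q′ ℚ.*_) c′-1) (ℚ.*-identityʳ q′)

    nz : ℚ.NonZero b
    nz = ≡.subst ℚ.NonZero (≡.sym b≡q′) (ℚ.pos⇒nonZero q′ {{pos′}})

    ratio : (a ℚ.÷ b) {{nz}} ℚ.* q′ ≡ q
    ratio = begin
      (a ℚ.* (ℚ.1/ b) {{nz}}) ℚ.* q′   ≡⟨ ≡.cong ((a ℚ.* (ℚ.1/ b) {{nz}}) ℚ.*_) b≡q′ ⟨
      (a ℚ.* (ℚ.1/ b) {{nz}}) ℚ.* b    ≡⟨ ℚ.*-assoc a ((ℚ.1/ b) {{nz}}) b ⟩
      a ℚ.* ((ℚ.1/ b) {{nz}} ℚ.* b)    ≡⟨ ≡.cong (a ℚ.*_) (ℚ.*-inverseˡ b {{nz}}) ⟩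
      a ℚ.* 1ℚ                         ≡⟨ ℚ.*-identityʳ a ⟩
      q ℚ.* c (1^ N)                   ≡⟨ ≡.cong (q ℚ.*_) c-1 ⟩
      q ℚ.* 1ℚ                         ≡⟨ ℚ.*-identityʳ q ⟩
      q                                ∎

    minus-1 : ∀ x → ℚ.- x ≡ (ℚ.- 1ℚ) ℚ.* x
    minus-1 = solve 1 (λ x → :- x := (:- con (+ 1)) :* x) ≡.refl
      where open RingKit.Solver (Poly 0)

    difference : ∀ α → Xₛ G H a b {{nz}} α ≡ sumℚ (map (λ μ → (q ℚ.* (c μ ℚ.- c′ μ)) ℚ.* schur μ α) (partitions N))
    difference α = expand q (λ μ → c μ ℚ.- c′ μ) α (begin
      X (graph G) α ℚ.- (a ℚ.÷ b) {{nz}} ℚ.* X (graph H) α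
        ≡⟨ ≡.cong₂ (λ x y → x ℚ.- (a ℚ.÷ b) {{nz}} ℚ.* y) (XG α) (XH α) ⟩
      q ℚ.* C ℚ.- (a ℚ.÷ b) {{nz}} ℚ.* (q′ ℚ.* C′)
        ≡⟨ ≡.cong (λ h → q ℚ.* C ℚ.- h) (≡.trans (≡.sym (ℚ.*-assoc ((a ℚ.÷ b) {{nz}}) q′ C′)) (≡.cong (ℚ._* C′) ratio)) ⟩
      q ℚ.* C ℚ.- q ℚ.* C′
        ≡⟨ solve 3 (λ q x y → q :* x :- q :* y := q :* (x :+ :- con (+ 1) :* y)) ≡.refl q C C′ ⟩
      q ℚ.* (C ℚ.+ (ℚ.- 1ℚ) ℚ.* C′)
        ≡⟨ ≡.cong (q ℚ.*_) (≡.trans (≡.cong (C ℚ.+_) (≡.sym (combination-* N (ℚ.- 1ℚ) c′ α)))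
             (≡.sym (combination-+ N c (λ μ → (ℚ.- 1ℚ) ℚ.* c′ μ) α))) ⟩
      q ℚ.* combination N (λ μ → c μ ℚ.+ (ℚ.- 1ℚ) ℚ.* c′ μ) α
        ≡⟨ ≡.cong (q ℚ.*_) (Sums.∑-cong (Poly 0) (partitions N) λ μ →
          ≡.cong (λ h → (c μ ℚ.+ h) ℚ.* schur μ α) (≡.sym (minus-1 (c′ μ)))) ⟩
      q ℚ.* combination N (λ μ → c μ ℚ.- c′ μ) α
        ∎)
      where
      C  = combination N c α
      C′ = combination N c′ α
      open RingKit.Solver (Poly 0)

    nonNeg : ∀ ν → 0ℚ ℚ.≤ q ℚ.* (c ν ℚ.- c′ ν)
    nonNeg ν = ℚ.nonNegative⁻¹ (q ℚ.* (c ν ℚ.- c′ ν))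
      {{ℚ.nonNeg*nonNeg⇒nonNeg q {{ℚ.pos⇒nonNeg q {{pos}}}} (c ν ℚ.- c′ ν) {{ℚ.nonNegative gap}}}}
      where
      gap : 0ℚ ℚ.≤ c ν ℚ.- c′ ν
      gap = ≡.subst (ℚ._≤ c ν ℚ.- c′ ν) (ℚ.+-inverseʳ (c′ ν)) (ℚ.+-monoˡ-≤ (ℚ.- c′ ν) (c′≤c ν))

X-cong : ∀ {N} (G H : Graph N) → (∀ {u v} → Graph.Adj G u v → Graph.Adj H u v) →
  (∀ {u v} → Graph.Adj H u v → Graph.Adj G u v) → ∀ α → X G α ≡ X H α
X-cong {N} G H to of α = ≡.cong (λ κs → fromℕ (length κs)) (filter-≐
  (λ κ → proper? G κ ×-dec exponents? (Vec.toList κ) α)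
  (λ κ → proper? H κ ×-dec exponents? (Vec.toList κ) α)
  ((λ { (p , x) → (λ u v a → p u v (of a)) , x }) , (λ { (p , x) → (λ u v a → p u v (to a)) , x }))
  (words (length α) N))

X-lollipop-normalised : ∀ m n α → X (graph (lollipop (suc m) n ≡.refl)) α ≡
  (ι (m ℕ.!) ℚ.* leading m n) ℚ.* combination (suc m + n) (normalised m n) α
X-lollipop-normalised m n α = ≡.trans (X-lollipop m n α)
  (≡.trans (≡.cong (ι (m ℕ.!) ℚ.*_) (coeff-u m n α)) (≡.sym (ℚ.*-assoc (ι (m ℕ.!)) (leading m n) _)))

scale-pos : ∀ m n → ℚ.Positive (ι (m ℕ.!) ℚ.* leading m n)
scale-pos m n = ℚ.pos*pos⇒pos (ι (m ℕ.!)) {{factorial-pos (m ℕ.!) (ℕ.1≤n! m)}} (leading m n) {{leading-pos m n}}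
  where
  factorial-pos : ∀ i → 1 ≤ i → ℚ.Positive (ι i)
  factorial-pos (suc i) _ = 0<ι i

lollipop-≥ₛ : ∀ {N} (G H : ConnectedGraph N) d m n′
  (eq : suc m + (d + n′) ≡ N) (eq′ : suc (d + m) + n′ ≡ N) →
  G ∼ lollipop (suc m) (d + n′) eq → H ∼ lollipop (suc (d + m)) n′ eq′ → G ≥ₛ H
lollipop-≥ₛ {N} G H d m n′ ≡.refl eq′ G∼ H∼ = ≥ₛ-normalised G H
  {ι (m ℕ.!) ℚ.* leading m (d + n′)} {ι ((d + m) ℕ.!) ℚ.* leading (d + m) n′}
  {normalised m (d + n′)} {normalised (d + m) n′}
  (scale-pos m (d + n′)) (scale-pos (d + m) n′)
  (normalised-1^ m (d + n′))
  (≡.trans (≡.cong (λ N → normalised (d + m) n′ (1^ N)) (≡.sym eq′)) (normalised-1^ (d + m) n′))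
  (λ α → ≡.trans (G∼ α) (X-lollipop-normalised m (d + n′) α))
  (λ α → ≡.trans (H∼ α) (transport eq′ α))
  (normalised-mono d m n′)
  where
  transport : ∀ {N} (eq : suc (d + m) + n′ ≡ N) α → X (graph (lollipop (suc (d + m)) n′ eq)) α ≡
    (ι ((d + m) ℕ.!) ℚ.* leading (d + m) n′) ℚ.* combination N (normalised (d + m) n′) α
  transport ≡.refl = X-lollipop-normalised (d + m) n′

clique-≤⇒≥ₛ : ∀ {N} (G H : ConnectedGraph N) m n m′ n′ (eq : m + n ≡ N) (eq′ : m′ + n′ ≡ N) →
  1 ≤ m → m ≤ m′ → G ∼ lollipop m n eq → H ∼ lollipop m′ n′ eq′ → G ≥ₛ H
clique-≤⇒≥ₛ {N} G H (suc m) n (suc m′) n′ eq eq′ _ (s≤s m≤m′) =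
  go (m′ ∸ m) m′ n (≡.sym (ℕ.m∸n+n≡m m≤m′)) (ℕ.+-cancelˡ-≡ (suc m) n _ (≡.trans eq (≡.trans (≡.sym eq′) tails))) eq eq′
  where
  tails : suc m′ + n′ ≡ suc m + (m′ ∸ m + n′)
  tails = ≡.cong suc (≡.trans (≡.cong (_+ n′) (≡.sym (ℕ.m+[n∸m]≡n m≤m′))) (ℕ.+-assoc m (m′ ∸ m) n′))

  -- With `m′` and `n` general their equations can be matched, which avoids transporting the graphs
  -- along them.
  go : ∀ d m′ n → m′ ≡ d + m → n ≡ d + n′ → (eq : suc m + n ≡ N) (eq′ : suc m′ + n′ ≡ N) →
    G ∼ lollipop (suc m) n eq → H ∼ lollipop (suc m′) n′ eq′ → G ≥ₛ H
  go d _ _ ≡.refl ≡.refl = lollipop-≥ₛ G H d m n′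

lollipops-chain : ∀ N → IsChain (Lollipops N)
lollipops-chain N G H (m , n , eq , 1≤m , G∼) (m′ , n′ , eq′ , 1≤m′ , H∼) = Sum.map
  (λ m≤m′ → clique-≤⇒≥ₛ G H m n m′ n′ eq eq′ 1≤m m≤m′ G∼ H∼)
  (λ m′≤m → clique-≤⇒≥ₛ H G m′ n′ m n eq′ eq 1≤m′ m′≤m H∼ G∼)
  (ℕ.≤-total m m′)

path-∼ : ∀ N → path (suc N) ∼ lollipop 1 N ≡.refl
path-∼ N = X-cong (pathGraph (suc N)) (lollipopGraph 1 N ≡.refl)
  (λ { (inj₁ eq) → inj₂ (inj₁ (s≤s z≤n , eq)) ; (inj₂ eq) → inj₂ (inj₂ (s≤s z≤n , eq)) })
  of
  where
  of : ∀ {u v : Fin (suc N)} → LollipopAdj 1 u v → suc (toℕ u) ≡ toℕ v ⊎ suc (toℕ v) ≡ toℕ u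
  of {zero}  {zero}  (inj₁ (u≢u , _)) = contradiction ≡.refl u≢u
  of {zero}  {suc v} (inj₁ (_ , _ , s≤s ()))
  of {suc u}         (inj₁ (_ , s≤s () , _))
  of (inj₂ (inj₁ (_ , eq))) = inj₁ eq
  of (inj₂ (inj₂ (_ , eq))) = inj₂ eq

complete-∼ : ∀ N → complete (suc N) ∼ lollipop (suc N) 0 (ℕ.+-identityʳ (suc N))
complete-∼ N = X-cong (completeGraph (suc N)) (lollipopGraph (suc N) 0 (ℕ.+-identityʳ (suc N)))
  (λ {u} {v} u≢v → inj₁ (u≢v , Fin.toℕ<n u , Fin.toℕ<n v))
  (λ {u} {v} → of u v)
  where
  of : ∀ (u v : Fin (suc N)) → LollipopAdj (suc N) u v → u ≢ v
  of u v (inj₁ (u≢v , _))            = u≢v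
  of u v (inj₂ (inj₁ (_ , eq))) ≡.refl = ℕ.1+n≢n eq
  of u v (inj₂ (inj₂ (_ , eq))) ≡.refl = ℕ.1+n≢n eq

theorem5p4 : ∀ (N : ℕ) → 1 ≤ N →
    IsChain (Lollipops N)
    × (∀ (m n : ℕ) (3≤m : 3 ≤ m) (eq : m + n ≡ N) →
    lollipop (m ∸ 1) (n + 1) (lengthenTail 3≤m eq) ≥ₛ lollipop m n eq)
    × IsMaximum (Lollipops N) (path N)
    × IsMinimum (Lollipops N) (complete N)
theorem5p4 (suc N) _ =
    lollipops-chain (suc N)
  , (λ m n 3≤m eq → clique-≤⇒≥ₛ (lollipop (m ∸ 1) (n + 1) (lengthenTail 3≤m eq)) (lollipop m n eq)
      (m ∸ 1) (n + 1) m n (lengthenTail 3≤m eq) eq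
      (ℕ.∸-monoˡ-≤ 1 (ℕ.≤-trans (s≤s (s≤s z≤n)) 3≤m)) (ℕ.m∸n≤m m 1) (λ _ → ≡.refl) (λ _ → ≡.refl))
  , ((1 , N , ≡.refl , s≤s z≤n , path-∼ N) ,
     λ { H (m , n , eq , 1≤m , H∼) →
       clique-≤⇒≥ₛ (path (suc N)) H 1 N m n ≡.refl eq (s≤s z≤n) 1≤m (path-∼ N) H∼ })
  , ((suc N , 0 , ℕ.+-identityʳ (suc N) , s≤s z≤n , complete-∼ N) ,
     λ { H (m , n , eq , 1≤m , H∼) →
       clique-≤⇒≥ₛ H (complete (suc N)) m n (suc N) 0 eq (ℕ.+-identityʳ (suc N)) 1≤m
         (≡.subst (m ≤_) eq (ℕ.m≤m+n m n)) H∼ (complete-∼ N) })
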